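{- Let $x\in(0,1)$ and let $H$ be a graph with at least one edge and chromatic number $\chi(H)=r$ (so $r\ge2$). Let $\eta>0$, $\sigma:=\sigma(H)$, $h:=|H|$ and $\omega:=(h-\sigma)/(r-1)$. Then there exists $n_0=n_0(\eta,x,H)\in\mathbb{N}$ such that the following holds: if $G$ is a graph on $n\ge n_0$ vertices with degree sequence $d_1\le d_2\le\dots\le d_n$ such that \[d_i\ge\left(g_H(x)-\frac{x\sigma}{h}\right)n+\frac{(r-1)x\sigma}{h-x\sigma}\,i\quad\text{for all } 1\le i\le \left(\frac{h-x\sigma}{(r-1)h}\right)n,\] then $G$ contains an $H$-tiling covering at least $(x-\eta)n$ vertices.
   Context: For a graph $H$, $\sigma(H)$ denotes the smallest possible size of a colour class over all proper colourings of $H$ with $\chi(H)$ colours. The critical chromatic number is $\chi_{cr}(H):=(\chi(H)-1)\frac{|H|}{|H|-\sigma(H)}$, and for $x\in(0,1)$, $g_H(x):=x\left(1-\frac{1}{\chi_{cr}(H)}\right)+(1-x)\left(1-\frac{1}{r-1}\right)$ where $r=\chi(H)$. An $H$-tiling in $G$ is a collection of vertex-disjoint copies of $H$ in $G$. The degree sequence $d_1\le\dots\le d_n$ of $G$ is the list of vertex degrees in non-decreasing order.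
   Formalization: The parameters x in (0,1) and η > 0 range over the rational numbers instead of the real numbers. -}

module Defs where

open import Data.Bool using (Bool; true; false; T)
open import Data.Nat as ℕ using (ℕ; zero; suc; _∸_; _<_; _≤_)
import Data.Nat.Properties as ℕP
open import Data.Fin using (Fin)
open import Data.Fin.Properties using () renaming (_≟_ to _≟ᶠ_)
open import Data.List using (List; []; _∷_; length; filter; map; allFin)
open import Data.Integer using (+_)
open import Data.Rational using (ℚ; 0ℚ; 1ℚ; _/_; _÷_; _+_; _*_; _-_; ≢-nonZero)
open import Data.Rational.Properties using () renaming (_≟_ to _≟ℚ_)
open import Data.Product using (Σ; ∃; ∃₂; _×_; _,_)
open import Relation.Binary.PropositionalEquality using (_≡_; _≢_)
open import Relation.Nullary using (¬_; yes; no)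
open import Relation.Nullary.Decidable using (T?)
import Data.List.Sort

record Graph (n : ℕ) : Set where
  field
    adj      : Fin n → Fin n → Bool
    sym      : ∀ i j → adj i j ≡ adj j i
    loopless : ∀ i → adj i i ≡ false
open Graph public

HasEdge : ∀ {h} → Graph h → Set
HasEdge H = ∃₂ λ i j → adj H i j ≡ true

ProperColouring : ∀ {h} → Graph h → (k : ℕ) → (Fin h → Fin k) → Set
ProperColouring H k c = ∀ i j → adj H i j ≡ true → c i ≢ c j

Colourable : ∀ {h} → Graph h → ℕ → Set
Colourable {h} H k = Σ (Fin h → Fin k) (ProperColouring H k)

IsChromaticNumber : ∀ {h} → Graph h → ℕ → Set
IsChromaticNumber H r = Colourable H r × (∀ k → k < r → ¬ Colourable H k)

classSize : ∀ {h k} → (Fin h → Fin k) → Fin k → ℕ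
classSize {h} c a = length (filter (λ v → c v ≟ᶠ a) (allFin h))

IsSigma : ∀ {h} → Graph h → (r s : ℕ) → Set
IsSigma {h} H r s =
  (Σ (Fin h → Fin r) λ c → ProperColouring H r c × ∃ λ a → classSize c a ≡ s)
  × (∀ (c : Fin h → Fin r) → ProperColouring H r c → ∀ a → s ≤ classSize c a)

ℕ→ℚ : ℕ → ℚ
ℕ→ℚ n = (+ n) / 1

-- total division (returns 0 when dividing by 0; all denominators used
-- below are nonzero under the hypotheses of the theorem)
infixl 7 _÷'_
_÷'_ : ℚ → ℚ → ℚ
p ÷' q with q ≟ℚ 0ℚ
... | yes _ = 0ℚ
... | no q≢0 = _÷_ p q {{≢-nonZero q≢0}}

χcr : (h r σ : ℕ) → ℚ
χcr h r σ = (ℕ→ℚ (r ∸ 1) * ℕ→ℚ h) ÷' (ℕ→ℚ h - ℕ→ℚ σ)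

gH : (h r σ : ℕ) → ℚ → ℚ
gH h r σ x = x * (1ℚ - 1ℚ ÷' χcr h r σ) + (1ℚ - x) * (1ℚ - 1ℚ ÷' ℕ→ℚ (r ∸ 1))

degree : ∀ {n} → Graph n → Fin n → ℕ
degree {n} G v = length (filter (λ u → T? (adj G v u)) (allFin n))

open Data.List.Sort ℕP.≤-decTotalOrder using (sort)

degreeSequence : ∀ {n} → Graph n → List ℕ
degreeSequence {n} G = sort (map (degree G) (allFin n))

nth : List ℕ → ℕ → ℕ
nth []       _       = 0
nth (x ∷ _)  zero    = x
nth (_ ∷ xs) (suc i) = nth xs i

-- d_i (1-based), for 1 ≤ i ≤ n
d : ∀ {n} → Graph n → ℕ → ℕ
d G i = nth (degreeSequence G) (i ∸ 1)

record HTiling {h n : ℕ} (H : Graph h) (G : Graph n) : Set where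
  field
    copies : ℕ
    emb    : Fin copies → Fin h → Fin n
    disjointInjective : ∀ a u b v → emb a u ≡ emb b v → (a ≡ b × u ≡ v)
    edges  : ∀ a u v → adj H u v ≡ true → adj G (emb a u) (emb a v) ≡ true
open HTiling public

covered : ∀ {h n} {H : Graph h} {G : Graph n} → HTiling H G → ℕ
covered {h} T = copies T ℕ.* h

-- Write x = X / D and ρ = r - 1, and call "tile" a complete r-partite graph with one part of size
-- B t and ρ parts of size A t, where A = hD - Xσ and B = ρXσ. A tile contains an H-tiling of density
-- x (permute the larger colour classes of H cyclically), so it suffices to tile almost all of G.
--
-- Consider a tiling by tiles of constant scale t, and let Y be the set of its uncovered vertices.
-- If many v ∈ Y see all parts of a tile Q, or all but the small one, then Q can be rebuilt from
-- smaller tiles so as to cover more vertices. If many v ∈ Y see all parts of Q but a large one which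
-- contains many vertices of degree larger than that of v, then exchanging such vertices raises the
-- degrees in Y. If neither happens, a typical v ∈ Y misses about A t vertices of each tile that has a
-- large part of degrees at most that of v, and (A + B) t of any other tile. The degree sequence bounds
-- the number of the former tiles, so Y inherits the degree condition, scaled to |Y|, and hence contains
-- a tile, found greedily part by part. In each case the potential Σ wt v over the covered v grows; wt
-- prefers covering more vertices and, subject to that, vertices of low degree.
--
-- No regularity lemma is needed: many vertices with the same trace on a tile of bounded size are found
-- by the pigeonhole principle. Each such improvement leaves tiles smaller by a constant factor c, but
-- boundedly many passes through G suffice.

module Submission where

open import Defs hiding (sym; copies; emb; disjointInjective; edges)
open import Data.Nat using (ℕ; _≤_; _∸_)
open import Data.Product using (∃; Σ; _×_; _,_; proj₁; proj₂)
open import Relation.Binary.PropositionalEquality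

-- In the units of the overview a tile of scale 1 has N = ρ A + B = ρ h D vertices, and the
-- hypothesis reads d_i ≥ (1 - (A + B) / N) n + (B / A) i for i ≤ (A / N) n. This explains the shape
-- of a tile. A vertex that misses the small part and a large one misses the fraction (A + B) / N of
-- the tile, which is all that the constant term allows. On a tile of order N T where it misses only
-- one large part it saves B T; such a tile contains about A T vertices of no larger degree, so the
-- saving is B / A per low vertex, which is the slope. The two effects cancel, and what is left for
-- the uncovered set Y is about (A / N) |Y| missing vertices. The obstacle is that every count is
-- approximate. There are five sources of error, and each may cost A n / (5 H), which is harmless
-- while at least n / H vertices are uncovered; `L`, `c₀`, `F` and `quota` are chosen accordingly.
-- These errors raise A to A + 1, the greedy search raises it to A + 2, and B ≥ 2 ρ + 2 pays for
-- both.

module Tilings where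

  open import Data.Bool using (Bool; true; false; _∧_; not; if_then_else_)
  open import Data.Empty using (⊥; ⊥-elim)
  open import Data.Fin using (Fin; zero; suc; toℕ; fromℕ<; splitAt; punchIn; punchOut; join)
  open import Data.Fin.Properties using (all?; any?; ¬∀⟶∃¬; punchInᵢ≢i; punchIn-injective; punchOut-injective; join-splitAt; toℕ-fromℕ<; toℕ-injective; toℕ<n) renaming (_≟_ to _≟ᶠ_)
  open import Data.Integer as ℤ using (-[1+_])
  import Data.Integer.Properties as ℤ
  import Data.Integer.Tactic.RingSolver as ℤ-Ring
  open import Data.List using (List; []; _∷_; _++_; length; replicate; filter; map; allFin; tabulate)
  open import Data.List.Properties using (length-++; length-replicate; filter-none; map-tabulate)
  open import Data.List.Relation.Binary.Permutation.Propositional.Properties using (filter-↭; ↭-length)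
  open import Data.List.Relation.Unary.All as All using (All; []; _∷_)
  open import Data.List.Relation.Unary.AllPairs using (AllPairs; []; _∷_)
  open import Data.List.Relation.Unary.Linked.Properties using (Linked⇒AllPairs)
  open import Data.Nat using (zero; suc; _+_; _*_; _^_; _<_; z≤n; s≤s; _≤?_; _<?_; _≟_; >-nonZero; _⊓_; NonZero)
  open import Data.Nat.DivMod using (_/_; _%_; m≡m%n+[m/n]*n; m%n<n; m/n*n≤m; m*n/n≡m; /-monoˡ-≤; %-distribˡ-+; m%n%n≡m%n; [m+n]%n≡m%n; m<n⇒m%n≡m)
  open import Data.Nat.Properties hiding (_≟_; _≤?_; _<?_)
  open import Data.Nat.Tactic.RingSolver using (solve-∀)
  open import Data.List.Sort ≤-decTotalOrder using (sort-↭; sort-↗)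
  open import Data.Rational as ℚ using (ℚ; 0ℚ; 1ℚ; mkℚ; ↥_; ↧ₙ_; toℚᵘ)
  import Data.Rational.Properties as ℚ
  open import Data.Rational.Solver using (module +-*-Solver)
  open import Data.Rational.Unnormalised as ℚᵘ using (mkℚᵘ; *≡*; *≤*)
  import Data.Rational.Unnormalised.Properties as ℚᵘ
  open import Data.Sum using (_⊎_; inj₁; inj₂)
  open import Function using (_∘_; id)
  open import Relation.Nullary using (¬_; Dec; yes; no)
  open import Relation.Nullary.Decidable using (⌊_⌋; ¬?; _→-dec_; _×-dec_; _⊎-dec_; T?)
  open import Relation.Unary using (Pred; Decidable)
  open import Algebra.Properties.Semiring.Sum +-*-semiring using (sum; ∑-distrib-+; ∑-comm; *-distribˡ-sum; *-distribʳ-sum; sum-cong-≗)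

  -- A linear inequality follows from a weighted sum `p ≤ q` of its hypotheses. With the slack `s`
  -- written out, what remains is a polynomial identity over ℕ, free of subtraction, for the ring
  -- solver.
  ≤-by-certificate : ∀ {x z p q} s → p ≤ q → x + q + s ≡ z + p → x ≤ z
  ≤-by-certificate {x} {z} {p} {q} s p≤q e = +-cancelʳ-≤ q x z (begin
    x + q      ≤⟨ m≤m+n (x + q) s ⟩
    x + q + s  ≡⟨ e ⟩
    z + p      ≤⟨ +-monoʳ-≤ z p≤q ⟩
    z + q      ∎)
    where open ≤-Reasoning

  *-exchange : ∀ a b c → a * (b * c) ≡ b * (a * c)
  *-exchange = solve-∀

  𝟙 : Bool → ℕ
  𝟙 true  = 1
  𝟙 false = 0

  ⌊⌋-sound : ∀ {p} {P : Set p} (P? : Dec P) → ⌊ P? ⌋ ≡ true → P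
  ⌊⌋-sound (yes p) _ = p

  ⌊⌋-complete : ∀ {p} {P : Set p} (P? : Dec P) → P → ⌊ P? ⌋ ≡ true
  ⌊⌋-complete (yes _) _ = refl
  ⌊⌋-complete (no ¬p) p = ⊥-elim (¬p p)

  ⌊⌋-false : ∀ {p} {P : Set p} (P? : Dec P) → ⌊ P? ⌋ ≡ false → ¬ P
  ⌊⌋-false (no ¬p) _ = ¬p

  -- Finding a tile among the uncovered vertices

  ¬true⇒false : ∀ {b} → ¬ (b ≡ true) → b ≡ false
  ¬true⇒false {false} _ = refl
  ¬true⇒false {true}  f = ⊥-elim (f refl)

  true≢false : ∀ {b} → b ≡ true → b ≡ false → ⊥
  true≢false refl ()

  ∧-true⁻ : ∀ a b → a ∧ b ≡ true → a ≡ true × b ≡ true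
  ∧-true⁻ true true _ = refl , refl

  ∧-true⁺ : ∀ {a b} → a ≡ true → b ≡ true → a ∧ b ≡ true
  ∧-true⁺ refl refl = refl

  not-true⁻ : ∀ {b} → not b ≡ true → b ≡ false
  not-true⁻ {false} _ = refl

  -- Vertex sets and finite sums

  VSet : ℕ → Set
  VSet n = Fin n → Bool

  infixl 6 _∩_ _∖_
  infix  4 _⊆_ _∈_

  _∩_ _∖_ : ∀ {n} → VSet n → VSet n → VSet n
  (P ∩ Q) v = P v ∧ Q v
  (P ∖ Q) v = P v ∧ not (Q v)

  _∈_ : ∀ {n} → Fin n → VSet n → Set
  v ∈ P = P v ≡ true

  _⊆_ : ∀ {n} → VSet n → VSet n → Set
  P ⊆ Q = ∀ v → v ∈ P → v ∈ Q

  ∩⁻ : ∀ {n} (P Q : VSet n) v → v ∈ P ∩ Q → v ∈ P × v ∈ Q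
  ∩⁻ P Q v = ∧-true⁻ (P v) (Q v)

  ∖⁻ : ∀ {n} (P Q : VSet n) v → v ∈ P ∖ Q → v ∈ P × Q v ≡ false
  ∖⁻ P Q v h = proj₁ (∧-true⁻ (P v) _ h) , not-true⁻ (proj₂ (∧-true⁻ (P v) _ h))

  ∩⊆ˡ : ∀ {n} (P Q : VSet n) → P ∩ Q ⊆ P
  ∩⊆ˡ P Q v = proj₁ ∘ ∩⁻ P Q v

  ∩⊆ʳ : ∀ {n} (P Q : VSet n) → P ∩ Q ⊆ Q
  ∩⊆ʳ P Q v = proj₂ ∘ ∩⁻ P Q v

  ∖⊆ : ∀ {n} (P Q : VSet n) → P ∖ Q ⊆ P
  ∖⊆ P Q v = proj₁ ∘ ∖⁻ P Q v

  ∅ : ∀ {n} → VSet n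
  ∅ _ = false

  # : ∀ {n} → VSet n → ℕ
  # P = sum (𝟙 ∘ P)

  sum-mono : ∀ {n} {f g : Fin n → ℕ} → (∀ i → f i ≤ g i) → sum f ≤ sum g
  sum-mono {zero}  _ = z≤n
  sum-mono {suc n} h = +-mono-≤ (h zero) (sum-mono (h ∘ suc))

  sum-const : ∀ n c → sum {n} (λ _ → c) ≡ n * c
  sum-const zero    c = refl
  sum-const (suc n) c = cong (c +_) (sum-const n c)

  sum-≡0 : ∀ {n} {f : Fin n → ℕ} → (∀ i → f i ≡ 0) → sum f ≡ 0
  sum-≡0 {zero}  h = refl
  sum-≡0 {suc n} h = cong₂ _+_ (h zero) (sum-≡0 (h ∘ suc))

  term≤sum : ∀ {n} (f : Fin n → ℕ) i → f i ≤ sum f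
  term≤sum f zero    = m≤m+n _ _
  term≤sum f (suc i) = ≤-trans (term≤sum (f ∘ suc) i) (m≤n+m _ _)

  two-terms≤sum : ∀ {n} (f : Fin n → ℕ) {i j} → i ≢ j → f i + f j ≤ sum f
  two-terms≤sum f {zero}  {zero}  i≢j = ⊥-elim (i≢j refl)
  two-terms≤sum f {zero}  {suc j} i≢j = +-monoʳ-≤ (f zero) (term≤sum (f ∘ suc) j)
  two-terms≤sum f {suc i} {zero}  i≢j =
    subst (_≤ sum f) (+-comm (f zero) _) (+-monoʳ-≤ (f zero) (term≤sum (f ∘ suc) i))
  two-terms≤sum f {suc i} {suc j} i≢j =
    ≤-trans (two-terms≤sum (f ∘ suc) (i≢j ∘ cong suc)) (m≤n+m _ _)

  sum-δ : ∀ {n} (k : Fin n) c → sum (λ i → if ⌊ i ≟ᶠ k ⌋ then c else 0) ≡ c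
  sum-δ {suc n} zero c = trans (cong (c +_) (sum-≡0 {n} (λ _ → refl))) (+-identityʳ c)
  sum-δ (suc k) c = trans (sum-cong-≗ shift) (sum-δ k c)
    where
    shift : ∀ i → (if ⌊ suc i ≟ᶠ suc k ⌋ then c else 0) ≡ (if ⌊ i ≟ᶠ k ⌋ then c else 0)
    shift i with i ≟ᶠ k
    ... | yes _ = refl
    ... | no  _ = refl

  sum-𝟙≤1 : ∀ {m} (b : Fin m → Bool) → (∀ i j → i ≢ j → b i ≡ true → b j ≡ true → ⊥) → sum (𝟙 ∘ b) ≤ 1
  sum-𝟙≤1 {zero}  b h = z≤n
  sum-𝟙≤1 {suc m} b h = cases (b zero) refl
    where
    cases : ∀ c → b zero ≡ c → 𝟙 c + sum (𝟙 ∘ b ∘ suc) ≤ 1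
    cases false _ = sum-𝟙≤1 (b ∘ suc) (λ i j i≢j → h (suc i) (suc j) (λ { refl → i≢j refl }))
    cases true  e = ≤-reflexive (cong suc (sum-≡0 (λ i → cong 𝟙 (¬true⇒false (h zero (suc i) (λ ()) e)))))

  -- The improvement step

  𝟙-mono : ∀ {a b} → (a ≡ true → b ≡ true) → 𝟙 a ≤ 𝟙 b
  𝟙-mono {false} _ = z≤n
  𝟙-mono {true}  h rewrite h refl = ≤-refl

  𝟙≤1 : ∀ b → 𝟙 b ≤ 1
  𝟙≤1 true  = ≤-refl
  𝟙≤1 false = z≤n

  #-mono : ∀ {n} {P Q : VSet n} → P ⊆ Q → # P ≤ # Q
  #-mono h = sum-mono (λ v → 𝟙-mono (h v))

  𝟙-split : ∀ a b → 𝟙 a ≡ 𝟙 (a ∧ b) + 𝟙 (a ∧ not b)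
  𝟙-split false b     = refl
  𝟙-split true  true  = refl
  𝟙-split true  false = refl

  #-split : ∀ {n} (P Q : VSet n) → # P ≡ # (P ∩ Q) + # (P ∖ Q)
  #-split P Q = trans (sum-cong-≗ (λ v → 𝟙-split (P v) (Q v))) (∑-distrib-+ (𝟙 ∘ (P ∩ Q)) (𝟙 ∘ (P ∖ Q)))

  ⊆⇒∩≗ : ∀ {n} {P Q : VSet n} → Q ⊆ P → ∀ v → (P ∩ Q) v ≡ Q v
  ⊆⇒∩≗ {P = P} {Q} h v with Q v in q
  ... | true  rewrite h v q = refl
  ... | false with P v
  ...   | true  = refl
  ...   | false = refl

  𝟙-∖ : ∀ {n} {P Q : VSet n} → Q ⊆ P → ∀ v → 𝟙 (P v) ≡ 𝟙 (Q v) + 𝟙 ((P ∖ Q) v)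
  𝟙-∖ {P = P} {Q} h v = trans (𝟙-split (P v) (Q v))
    (cong (λ b → 𝟙 b + 𝟙 ((P ∖ Q) v)) (⊆⇒∩≗ {P = P} {Q} h v))

  #-∖ : ∀ {n} {P Q : VSet n} → Q ⊆ P → # P ≡ # Q + # (P ∖ Q)
  #-∖ {P = P} {Q} h = trans (sum-cong-≗ (𝟙-∖ {P = P} {Q} h)) (∑-distrib-+ (𝟙 ∘ Q) (𝟙 ∘ (P ∖ Q)))

  -- Selecting subsets: pigeonhole, homogenisation and averaging

  #-nonempty : ∀ {n} (P : VSet n) → 0 < # P → ∃ λ v → v ∈ P
  #-nonempty {suc n} P h with P zero in p
  ... | true  = zero , p
  ... | false with #-nonempty (P ∘ suc) h
  ...   | v , q = suc v , q

  choose-subset : ∀ {n} (P : VSet n) k → k ≤ # P → ∃ λ Q → Q ⊆ P × # Q ≡ k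
  choose-subset {zero}  P zero    z≤n = ∅ , (λ ()) , refl
  choose-subset {suc n} P k       k≤ with P zero in p
  choose-subset {suc n} P zero    k≤ | true =
    ∅ , (λ _ ()) , sum-≡0 {n} {λ _ → 0} (λ _ → refl)
  choose-subset {suc n} P (suc k) (s≤s k≤) | true with choose-subset (P ∘ suc) k k≤
  ... | Q , Q⊆P , #Q = (λ { zero → true ; (suc v) → Q v }) ,
                       (λ { zero _ → p ; (suc v) q → Q⊆P v q }) , cong suc #Q
  choose-subset {suc n} P k k≤ | false with choose-subset (P ∘ suc) k k≤
  ... | Q , Q⊆P , #Q = (λ { zero → false ; (suc v) → Q v }) ,
                       (λ { zero () ; (suc v) q → Q⊆P v q }) , #Q

  -- The classes only have to cover X and may overlap: a vertex can be a candidate at several parts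
  -- of a tile. Peeling off a class with at most K elements of X leaves enough for the remaining
  -- ones.
  pigeonhole : ∀ {n} m K (X : VSet n) (p : Fin m → VSet n) → (∀ v → v ∈ X → ∃ λ k → v ∈ p k) →
               m * K < # X → ∃ λ k → K < # (X ∩ p k)
  pigeonhole zero    K X p cover h with #-nonempty X h
  ... | v , v∈X with cover v v∈X
  ...   | () , _
  pigeonhole (suc m) K X p cover h with suc K ≤? # (X ∩ p zero)
  ... | yes q = zero , q
  ... | no ¬q with pigeonhole m K (X ∖ p zero) (p ∘ suc) cover′ rest
    where
    cover′ : ∀ v → v ∈ X ∖ p zero → ∃ λ k → v ∈ p (suc k)
    cover′ v q with ∖⁻ X (p zero) v q
    ... | v∈X , v∉p with cover v v∈X
    ...   | zero  , r = ⊥-elim (true≢false r v∉p)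
    ...   | suc k , r = k , r
    rest : m * K < # (X ∖ p zero)
    rest = +-cancelˡ-< K _ _ (≤-trans h (subst (_≤ K + # (X ∖ p zero)) (sym (#-split X (p zero)))
      (+-monoˡ-≤ _ (≮⇒≥ ¬q))))
  ... | k , r = suc k , ≤-trans r (#-mono sub)
    where
    sub : (X ∖ p zero) ∩ p (suc k) ⊆ X ∩ p (suc k)
    sub v q with ∩⁻ (X ∖ p zero) (p (suc k)) v q
    ... | a , b = ∧-true⁺ (∖⊆ X (p zero) v a) b

  -- Each vertex of U halves X at worst.
  homogenise : ∀ {n m} (U : VSet n) (X : VSet m) (E : Fin m → Fin n → Bool) q → 2 ^ # U * q ≤ # X →
               ∃ λ S → S ⊆ X × q ≤ # S × (∀ x y v → x ∈ S → y ∈ S → v ∈ U → E x v ≡ E y v)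
  homogenise {zero}  U X E q h = X , (λ _ z → z) , subst (_≤ # X) (+-identityʳ q) h , λ _ _ ()
  homogenise {suc n} U X E q h with U zero in u0
  ... | false with homogenise (U ∘ suc) X (λ x → E x ∘ suc) q h
  ...   | S , S⊆X , q≤ , same = S , S⊆X , q≤ , same′
    where
    same′ : ∀ x y v → x ∈ S → y ∈ S → v ∈ U → E x v ≡ E y v
    same′ x y zero    xs ys u = ⊥-elim (true≢false u u0)
    same′ x y (suc v) xs ys u = same x y v xs ys u
  homogenise {suc n} U X E q h | true with 2 ^ # (U ∘ suc) * q ≤? # (X ∩ (λ x → E x zero))
  ... | yes r with homogenise (U ∘ suc) (X ∩ (λ x → E x zero)) (λ x → E x ∘ suc) q r
  ...   | S , S⊆X , q≤ , same = S , (λ v z → ∩⊆ˡ X (λ x → E x zero) v (S⊆X v z)) , q≤ , same′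
    where
    same′ : ∀ x y v → x ∈ S → y ∈ S → v ∈ U → E x v ≡ E y v
    same′ x y zero    xs ys u = trans (∩⊆ʳ X (λ x → E x zero) x (S⊆X x xs)) (sym (∩⊆ʳ X (λ x → E x zero) y (S⊆X y ys)))
    same′ x y (suc v) xs ys u = same x y v xs ys u
  homogenise {suc n} U X E q h | true | no ¬r
    with homogenise (U ∘ suc) (X ∖ (λ x → E x zero)) (λ x → E x ∘ suc) q r
    where
    M = 2 ^ # (U ∘ suc)
    r : M * q ≤ # (X ∖ (λ x → E x zero))
    r = +-cancelˡ-≤ (M * q) _ _ (begin
      M * q + M * q          ≡⟨ double M q ⟩
      2 * M * q              ≤⟨ h ⟩
      # X  ≡⟨ #-split X (λ x → E x zero) ⟩
      # (X ∩ (λ x → E x zero)) + # (X ∖ (λ x → E x zero)) ≤⟨ +-monoˡ-≤ _ (<⇒≤ (≰⇒> ¬r)) ⟩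
      M * q + # (X ∖ (λ x → E x zero)) ∎)
      where
      open ≤-Reasoning
      double : ∀ a b → a * b + a * b ≡ 2 * a * b
      double = solve-∀
  ... | S , S⊆X , q≤ , same = S , (λ v z → ∖⊆ X (λ x → E x zero) v (S⊆X v z)) , q≤ , same′
    where
    same′ : ∀ x y v → x ∈ S → y ∈ S → v ∈ U → E x v ≡ E y v
    same′ x y zero    xs ys u = trans (proj₂ (∖⁻ X (λ x → E x zero) x (S⊆X x xs))) (sym (proj₂ (∖⁻ X (λ x → E x zero) y (S⊆X y ys))))
    same′ x y (suc v) xs ys u = same x y v xs ys u

  markov : ∀ {n} (P : VSet n) (f : Fin n → ℕ) k → (∀ v → v ∈ P → k ≤ f v) → # P * k ≤ sum f
  markov {zero}  P f k h = z≤n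
  markov {suc n} P f k h = subst (_≤ sum f) (sym (*-distribʳ-+ k (𝟙 (P zero)) (# (P ∘ suc))))
    (+-mono-≤ (head (P zero) refl) (markov (P ∘ suc) (f ∘ suc) k (h ∘ suc)))
    where
    head : ∀ b → P zero ≡ b → 𝟙 b * k ≤ f zero
    head true  e = subst (_≤ f zero) (sym (*-identityˡ k)) (h zero e)
    head false e = z≤n

  argmax : ∀ {n} (P : VSet n) (f : Fin n → ℕ) →
           (∀ v → P v ≡ false) ⊎ ∃ λ v → v ∈ P × (∀ u → u ∈ P → f u ≤ f v)
  argmax {zero}  P f = inj₁ λ ()
  argmax {suc n} P f with argmax (P ∘ suc) (f ∘ suc) | P zero in p
  ... | inj₁ none          | false = inj₁ λ { zero → p ; (suc v) → none v }
  ... | inj₁ none          | true  = inj₂ (zero , p , λ { zero _ → ≤-refl ; (suc u) q → ⊥-elim (true≢false q (none u)) })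
  ... | inj₂ (v , v∈P , m) | false = inj₂ (suc v , v∈P , λ { zero q → ⊥-elim (true≢false q p) ; (suc u) q → m u q })
  ... | inj₂ (v , v∈P , m) | true with f zero ≤? f (suc v)
  ...   | yes le = inj₂ (suc v , v∈P , λ { zero _ → le ; (suc u) q → m u q })
  ...   | no ¬le = inj₂ (zero , p , λ { zero _ → ≤-refl ; (suc u) q → ≤-trans (m u q) (<⇒≤ (≰⇒> ¬le)) })

  -- Tiles

  module Tiling {n : ℕ} (G : Graph n) (s A B : ℕ) where

    ρ r N₁ : ℕ
    ρ  = suc s
    r  = suc ρ
    N₁ = ρ * A + B

    -- The first argument is the special part, the second the part that is measured.
    size : Fin r → Fin r → ℕ
    size j i = if ⌊ i ≟ᶠ j ⌋ then B else A

    size-special : ∀ j → size j j ≡ B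
    size-special j with j ≟ᶠ j
    ... | yes _ = refl
    ... | no  f = ⊥-elim (f refl)

    size-other : ∀ {i j} → i ≢ j → size j i ≡ A
    size-other {i} {j} i≢j with i ≟ᶠ j
    ... | yes e = ⊥-elim (i≢j e)
    ... | no  _ = refl

    only : Fin r → ℕ → Fin r → ℕ
    only k c i = if ⌊ i ≟ᶠ k ⌋ then c else 0

    -- Putting the exceptional value on both sides lets the sizes be summed without truncated
    -- subtraction.
    size-balance : ∀ j i → size j i + only j A i ≡ A + only j B i
    size-balance j i with i ≟ᶠ j
    ... | yes _ = +-comm B A
    ... | no  _ = refl

    sum-size : ∀ j → sum (size j) ≡ N₁
    sum-size j = +-cancelʳ-≡ A (sum (size j)) N₁ (begin
      sum (size j) + A  ≡⟨ cong (sum (size j) +_) (sum-δ j A) ⟨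
      sum (size j) + sum (only j A)          ≡⟨ ∑-distrib-+ (size j) (only j A) ⟨
      sum (λ i → size j i + only j A i)      ≡⟨ sum-cong-≗ (size-balance j) ⟩
      sum (λ i → A + only j B i)             ≡⟨ ∑-distrib-+ (λ _ → A) (only j B) ⟩
      sum {r} (λ _ → A) + sum (only j B)     ≡⟨ cong₂ _+_ (sum-const r A) (sum-δ j B) ⟩
      r * A + B  ≡⟨ rearrange s A B ⟩
      N₁ + A  ∎)
      where
      open ≡-Reasoning
      rearrange : ∀ s a b → suc (suc s) * a + b ≡ suc s * a + b + a
      rearrange = solve-∀

    -- Distinct parts are automatically disjoint because `G` is loopless, so `Tile` has no field for
    -- that.
    Complete : ∀ {m} → (Fin m → VSet n) → Set
    Complete P = ∀ {i j u v} → i ≢ j → u ∈ P i → v ∈ P j → adj G u v ≡ true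

    Complete-⊆ : ∀ {m} {P Q : Fin m → VSet n} → (∀ i → Q i ⊆ P i) → Complete P → Complete Q
    Complete-⊆ Q⊆P c i≢j u∈ v∈ = c i≢j (Q⊆P _ _ u∈) (Q⊆P _ _ v∈)

    multiplicity : ∀ {m} → (Fin m → VSet n) → Fin n → ℕ
    multiplicity P v = sum (λ i → 𝟙 (P i v))

    ⋃ : ∀ {m} → (Fin m → VSet n) → VSet n
    ⋃ P v = ⌊ 1 ≤? multiplicity P v ⌋

    #⋃≤ : ∀ {m} (P : Fin m → VSet n) → # (⋃ P) ≤ sum (λ i → # (P i))
    #⋃≤ P = ≤-trans (sum-mono below) (≤-reflexive (∑-comm (λ v i → 𝟙 (P i v))))
      where
      below : ∀ v → 𝟙 (⋃ P v) ≤ multiplicity P v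
      below v with 1 ≤? multiplicity P v
      ... | yes q = q
      ... | no  _ = z≤n

    ⊆⋃ : ∀ {m} (P : Fin m → VSet n) i → P i ⊆ ⋃ P
    ⊆⋃ P i v p = ⌊⌋-complete (1 ≤? multiplicity P v)
      (≤-trans (≤-reflexive (cong 𝟙 (sym p))) (term≤sum (λ i → 𝟙 (P i v)) i))

    record Tile (t : ℕ) : Set where
      field
        parts    : Fin r → VSet n
        special  : Fin r
        card     : ∀ i → # (parts i) ≡ size special i * t
        complete : Complete parts
    open Tile public

    occ : ∀ {t} → Tile t → Fin n → ℕ
    occ Q = multiplicity (parts Q)

    -- Counting with multiplicity turns disjointness of the tiles into `occs Qs v ≤ 1`, and every
    -- exchange of tiles into a pointwise equation that can be summed with weights.
    occs : ∀ {t} → List (Tile t) → Fin n → ℕ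
    occs []       v = 0
    occs (Q ∷ Qs) v = occ Q v + occs Qs v

    occs-++ : ∀ {t} (Qs Rs : List (Tile t)) v → occs (Qs ++ Rs) v ≡ occs Qs v + occs Rs v
    occs-++ []       Rs v = refl
    occs-++ (Q ∷ Qs) Rs v = trans (cong (occ Q v +_) (occs-++ Qs Rs v)) (sym (+-assoc (occ Q v) _ _))

    sum-card : ∀ {t} (Q : Tile t) → sum (λ i → # (parts Q i)) ≡ N₁ * t
    sum-card {t} Q = begin
      sum (λ i → # (parts Q i))              ≡⟨ sum-cong-≗ (λ i → trans (card Q i) (*-comm (size (special Q) i) t)) ⟩
      sum (λ i → t * size (special Q) i)     ≡⟨ *-distribˡ-sum t (size (special Q)) ⟨
      t * sum (size (special Q))             ≡⟨ cong (t *_) (sum-size (special Q)) ⟩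
      t * N₁  ≡⟨ *-comm t N₁ ⟩
      N₁ * t  ∎
      where open ≡-Reasoning

    sum-occ : ∀ {t} (Q : Tile t) → sum (occ Q) ≡ N₁ * t
    sum-occ Q = trans (∑-comm (λ v i → 𝟙 (parts Q i v))) (sum-card Q)

    sum-occs : ∀ {t} (Qs : List (Tile t)) → sum (occs Qs) ≡ length Qs * (N₁ * t)
    sum-occs []       = sum-≡0 {n} (λ _ → refl)
    sum-occs (Q ∷ Qs) = trans (∑-distrib-+ (occ Q) (occs Qs)) (cong₂ _+_ (sum-occ Q) (sum-occs Qs))

    -- The list holds the special parts of the tiles to be cut out; the result is in units of the
    -- scale.
    demand : List (Fin r) → Fin r → ℕ
    demand []       i = 0
    demand (j ∷ js) i = size j i + demand js i

    demand-replicate : ∀ m j i → demand (replicate m j) i ≡ m * size j i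
    demand-replicate zero    j i = refl
    demand-replicate (suc m) j i = cong (size j i +_) (demand-replicate m j i)

    demand-++ : ∀ js ks i → demand (js ++ ks) i ≡ demand js i + demand ks i
    demand-++ []       ks i = refl
    demand-++ (j ∷ js) ks i = trans (cong (size j i +_) (demand-++ js ks i)) (sym (+-assoc (size j i) _ _))

    -- Subsets of the parts again span a complete multipartite graph, so only the part sizes matter
    -- and the special parts can be prescribed at will.
    carve : ∀ t js (P : Fin r → VSet n) → Complete P → (∀ i → # (P i) ≡ demand js i * t) →
            ∃ λ (ts : List (Tile t)) → length ts ≡ length js × (∀ v → occs ts v ≡ multiplicity P v)
    carve t [] P c h = [] , refl , λ v → sym (sum-≡0 (λ i → empty i v))
      where
      empty : ∀ i v → 𝟙 (P i v) ≡ 0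
      empty i v = n≤0⇒n≡0 (≤-trans (term≤sum (𝟙 ∘ P i) v) (≤-reflexive (h i)))
    carve t (j ∷ js) P c h = Q ∷ proj₁ rest , cong suc (proj₁ (proj₂ rest)) , λ v → begin
        occ Q v + occs (proj₁ rest) v  ≡⟨ cong (occ Q v +_) (proj₂ (proj₂ rest) v) ⟩
        multiplicity S v + multiplicity (λ i → P i ∖ S i) v ≡⟨ ∑-distrib-+ (λ i → 𝟙 (S i v)) (λ i → 𝟙 ((P i ∖ S i) v)) ⟨
        sum (λ i → 𝟙 (S i v) + 𝟙 ((P i ∖ S i) v))    ≡⟨ sum-cong-≗ (λ i → sym (𝟙-∖ {P = P i} {S i} (S⊆P i) v)) ⟩
        multiplicity P v  ∎
      where
      open ≡-Reasoning
      enough : ∀ i → size j i * t ≤ # (P i)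
      enough i = ≤-trans (*-monoˡ-≤ t (m≤m+n (size j i) (demand js i))) (≤-reflexive (sym (h i)))
      S : Fin r → VSet n
      S i = proj₁ (choose-subset (P i) (size j i * t) (enough i))
      S⊆P : ∀ i → S i ⊆ P i
      S⊆P i = proj₁ (proj₂ (choose-subset (P i) (size j i * t) (enough i)))
      #S : ∀ i → # (S i) ≡ size j i * t
      #S i = proj₂ (proj₂ (choose-subset (P i) (size j i * t) (enough i)))
      Q : Tile t
      Q = record { parts = S ; special = j ; card = #S ; complete = Complete-⊆ S⊆P c }
      rest : ∃ λ (ts : List (Tile t)) → length ts ≡ length js × (∀ v → occs ts v ≡ multiplicity (λ i → P i ∖ S i) v)
      rest = carve t js (λ i → P i ∖ S i) (Complete-⊆ (λ i → ∖⊆ (P i) (S i)) c) λ i →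
        +-cancelˡ-≡ (size j i * t) _ _ (begin
          size j i * t + # (P i ∖ S i)         ≡⟨ cong (_+ # (P i ∖ S i)) (#S i) ⟨
          # (S i) + # (P i ∖ S i)              ≡⟨ #-∖ (S⊆P i) ⟨
          # (P i)  ≡⟨ h i ⟩
          (size j i + demand js i) * t         ≡⟨ *-distribʳ-+ t (size j i) (demand js i) ⟩
          size j i * t + demand js i * t       ∎)

    subdivide : ∀ c t (Q : Tile (c * t)) →
                ∃ λ (ts : List (Tile t)) → length ts ≡ c × (∀ v → occs ts v ≡ occ Q v)
    subdivide c t Q with carve t (replicate c (special Q)) (parts Q) (complete Q) cards
      where
      cards : ∀ i → # (parts Q i) ≡ demand (replicate c (special Q)) i * t
      cards i = begin
        # (parts Q i)  ≡⟨ card Q i ⟩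
        size (special Q) i * (c * t)               ≡⟨ rearrange (size (special Q) i) c t ⟩
        c * size (special Q) i * t  ≡⟨ cong (_* t) (demand-replicate c (special Q) i) ⟨
        demand (replicate c (special Q)) i * t     ∎
        where
        open ≡-Reasoning
        rearrange : ∀ a b c → a * (b * c) ≡ b * a * c
        rearrange = solve-∀
    ... | ts , len , eq = ts , trans len (length-replicate c) , eq

    subdivide-all : ∀ c t (Qs : List (Tile (c * t))) →
                    ∃ λ (ts : List (Tile t)) → ∀ v → occs ts v ≡ occs Qs v
    subdivide-all c t []       = [] , λ _ → refl
    subdivide-all c t (Q ∷ Qs) with subdivide c t Q | subdivide-all c t Qs
    ... | ts , _ , eq | us , eq′ = ts ++ us , λ v → trans (occs-++ ts us v) (cong₂ _+_ (eq v) (eq′ v))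

    -- The tiles js₁ use S as their i-th part and M elsewhere; the tiles js₂ use what is left of Q
    -- once D is dropped from its i-th part.
    retile : ∀ {T} t (Q : Tile T) (i : Fin r) (S D : VSet n) (M : Fin r → VSet n) js₁ js₂ →
             D ⊆ parts Q i →
             (∀ k → M k ⊆ parts Q k) →
             (∀ {k u v} → k ≢ i → u ∈ S → v ∈ M k → adj G u v ≡ true) →
             # S ≡ demand js₁ i * t →
             # (parts Q i) ≡ demand js₂ i * t + # D →
             (∀ k → k ≢ i → # (M k) ≡ demand js₁ k * t) →
             (∀ k → k ≢ i → # (parts Q k) ≡ demand js₁ k * t + demand js₂ k * t) →
             ∃ λ (ts : List (Tile t)) → length ts ≡ length js₁ + length js₂ ×
               (∀ v → occs ts v + 𝟙 (D v) ≡ occ Q v + 𝟙 (S v))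
    retile t Q i S D M js₁ js₂ D⊆ M⊆ S~M #S #Qᵢ #M #Qₖ =
      proj₁ first ++ proj₁ second ,
      trans (length-++ (proj₁ first)) (cong₂ _+_ (proj₁ (proj₂ first)) (proj₁ (proj₂ second))) , balance
      where
      P₁ P₂ : Fin r → VSet n
      P₁ k with k ≟ᶠ i
      ... | yes _ = S
      ... | no  _ = M k
      P₂ k with k ≟ᶠ i
      ... | yes _ = parts Q k ∖ D
      ... | no  _ = parts Q k ∖ M k
      complete₁ : Complete P₁
      complete₁ {k} {l} k≢l u∈ v∈ with k ≟ᶠ i | l ≟ᶠ i
      ... | yes k≡i | yes l≡i = ⊥-elim (k≢l (trans k≡i (sym l≡i)))
      ... | yes _   | no l≢i  = S~M l≢i u∈ v∈
      ... | no k≢i  | yes _   = trans (Graph.sym G _ _) (S~M k≢i v∈ u∈)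
      ... | no _    | no _    = complete Q k≢l (M⊆ _ _ u∈) (M⊆ _ _ v∈)
      P₂⊆ : ∀ k → P₂ k ⊆ parts Q k
      P₂⊆ k v v∈ with k ≟ᶠ i
      ... | yes _ = ∖⊆ (parts Q k) D v v∈
      ... | no  _ = ∖⊆ (parts Q k) (M k) v v∈
      card₁ : ∀ k → # (P₁ k) ≡ demand js₁ k * t
      card₁ k with k ≟ᶠ i
      ... | yes refl = #S
      ... | no  k≢i  = #M k k≢i
      card₂ : ∀ k → # (P₂ k) ≡ demand js₂ k * t
      card₂ k with k ≟ᶠ i
      ... | yes refl = +-cancelˡ-≡ (# D) _ _ (trans (sym (#-∖ D⊆)) (trans #Qᵢ (+-comm _ (# D))))
      ... | no  k≢i  = +-cancelˡ-≡ (# (M k)) _ _ (trans (sym (#-∖ (M⊆ k)))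
                         (trans (#Qₖ k k≢i) (cong (_+ demand js₂ k * t) (sym (#M k k≢i)))))
      first  = carve t js₁ P₁ complete₁ card₁
      second = carve t js₂ P₂ (Complete-⊆ P₂⊆ (complete Q)) card₂
      pointwise : ∀ v k → 𝟙 (P₁ k v) + 𝟙 (P₂ k v) + only i (𝟙 (D v)) k ≡ 𝟙 (parts Q k v) + only i (𝟙 (S v)) k
      pointwise v k with k ≟ᶠ i
      ... | yes refl = trans (rearrange (𝟙 (S v)) (𝟙 ((parts Q k ∖ D) v)) (𝟙 (D v)))
                         (cong (_+ 𝟙 (S v)) (sym (𝟙-∖ {P = parts Q k} {D} D⊆ v)))
        where
        rearrange : ∀ a b c → a + b + c ≡ c + b + a
        rearrange = solve-∀
      ... | no _     = cong (_+ 0) (sym (𝟙-∖ {P = parts Q k} {M k} (M⊆ k) v))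
      balance : ∀ v → occs (proj₁ first ++ proj₁ second) v + 𝟙 (D v) ≡ occ Q v + 𝟙 (S v)
      balance v = begin
        occs (proj₁ first ++ proj₁ second) v + 𝟙 (D v)
          ≡⟨ cong (_+ 𝟙 (D v)) (occs-++ (proj₁ first) (proj₁ second) v) ⟩
        occs (proj₁ first) v + occs (proj₁ second) v + 𝟙 (D v)
          ≡⟨ cong (_+ 𝟙 (D v)) (cong₂ _+_ (proj₂ (proj₂ first) v) (proj₂ (proj₂ second) v)) ⟩
        multiplicity P₁ v + multiplicity P₂ v + 𝟙 (D v)
          ≡⟨ cong₂ _+_ (∑-distrib-+ (λ k → 𝟙 (P₁ k v)) (λ k → 𝟙 (P₂ k v))) (sum-δ i (𝟙 (D v))) ⟨
        sum (λ k → 𝟙 (P₁ k v) + 𝟙 (P₂ k v)) + sum (only i (𝟙 (D v)))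
          ≡⟨ ∑-distrib-+ (λ k → 𝟙 (P₁ k v) + 𝟙 (P₂ k v)) (only i (𝟙 (D v))) ⟨
        sum (λ k → 𝟙 (P₁ k v) + 𝟙 (P₂ k v) + only i (𝟙 (D v)) k)
          ≡⟨ sum-cong-≗ (pointwise v) ⟩
        sum (λ k → 𝟙 (parts Q k v) + only i (𝟙 (S v)) k)
          ≡⟨ ∑-distrib-+ (λ k → 𝟙 (parts Q k v)) (only i (𝟙 (S v))) ⟩
        occ Q v + sum (only i (𝟙 (S v)))
          ≡⟨ cong (occ Q v +_) (sum-δ i (𝟙 (S v))) ⟩
        occ Q v + 𝟙 (S v) ∎
        where open ≡-Reasoning

    -- The representative `x` decides for all of `S`: sets chosen inside its neighbourhood in `U`
    -- are joined to every vertex of `S`.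
    common-neighbours : ∀ (U X : VSet n) q → 0 < q → 2 ^ # U * q ≤ # X →
      ∃ λ S → ∃ λ x → x ∈ X × S ⊆ X × # S ≡ q ×
        (∀ y v → y ∈ S → v ∈ U → adj G x v ≡ true → adj G y v ≡ true)
    common-neighbours U X q 0<q h with homogenise U X (adj G) q h
    ... | S₀ , S₀⊆X , q≤ , same with choose-subset S₀ q q≤
    ...   | S , S⊆S₀ , #S with #-nonempty S (subst (0 <_) (sym #S) 0<q)
    ...     | x , x∈S = S , x , S₀⊆X x (S⊆S₀ x x∈S) , (λ v z → S₀⊆X v (S⊆S₀ v z)) , #S ,
                λ y v y∈ v∈ e → trans (same y x v (S⊆S₀ y y∈) (S⊆S₀ x x∈S) v∈) e

  -- Improving a tiling at one tile

  module Improvement {n : ℕ} (G : Graph n) (s A B : ℕ) (B<A : B < A) (ℓ : Fin n → ℕ) (L : ℕ) where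

    open Tiling G s A B

    -- `e₀` is N₁ - A. `C` solves B e₀ (C + L) + 1 = (B e₀ + 1) C: in `enlarge` the B e₀ t dropped
    -- vertices, at the largest possible weight, are outweighed by t by as few as (B e₀ + 1) t new
    -- ones at the smallest.
    e₀ C : ℕ
    e₀ = s * A + B
    C  = L * (B * e₀) + 1

    wt : Fin n → ℕ
    wt v = C + (L ∸ ℓ v)

    W : (Fin n → ℕ) → ℕ
    W f = sum (λ v → wt v * f v)

    W-distrib-+ : ∀ f g → W (λ v → f v + g v) ≡ W f + W g
    W-distrib-+ f g = trans (sum-cong-≗ (λ v → *-distribˡ-+ (wt v) (f v) (g v)))
                            (∑-distrib-+ (λ v → wt v * f v) (λ v → wt v * g v))

    W-cong : ∀ {f g} → (∀ v → f v ≡ g v) → W f ≡ W g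
    W-cong h = sum-cong-≗ (λ v → cong (wt v *_) (h v))

    W-lower : ∀ (P : VSet n) k → (∀ v → v ∈ P → k ≤ wt v) → # P * k ≤ W (𝟙 ∘ P)
    W-lower P k h = markov P (λ v → wt v * 𝟙 (P v)) k λ v v∈ →
      ≤-trans (h v v∈) (≤-reflexive (sym (trans (cong (λ b → wt v * 𝟙 b) v∈) (*-identityʳ (wt v)))))

    W-upper : ∀ (P : VSet n) k → (∀ v → v ∈ P → wt v ≤ k) → W (𝟙 ∘ P) ≤ # P * k
    W-upper P k h = ≤-trans (sum-mono pointwise) (≤-reflexive (sym (*-distribʳ-sum k (𝟙 ∘ P))))
      where
      pointwise : ∀ v → wt v * 𝟙 (P v) ≤ 𝟙 (P v) * k
      pointwise v with P v in v∈
      ... | true  = subst₂ _≤_ (sym (*-identityʳ (wt v))) (sym (*-identityˡ k)) (h v v∈)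
      ... | false = ≤-reflexive (*-zeroʳ (wt v))

    C≤wt : ∀ v → C ≤ wt v
    C≤wt v = m≤m+n C _

    wt≤ : ∀ v → wt v ≤ C + L
    wt≤ v = +-monoʳ-≤ C (m∸n≤m L (ℓ v))

    -- A N₁ t exceeds what either improvement takes from one part, at most A t in `swap` and A e₀ t
    -- in `enlarge`.
    Rich : ∀ {T} → ℕ → Tile T → Fin r → Fin n → Set
    Rich t Q i x = ∀ k → k ≢ i → A * N₁ * t ≤ # (parts Q k ∩ adj G x)

    Higher : ℕ → VSet n
    Higher l u = ⌊ l <? ℓ u ⌋

    retile-along : ∀ {T} t (Q : Tile T) i (X D : VSet n) js₁ js₂ →
      (∀ x → x ∈ X → Rich t Q i x) →
      2 ^ (N₁ * T) * (A * N₁ * t) ≤ # X →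
      0 < demand js₁ i * t →
      (∀ k → demand js₁ k ≤ A * N₁) →
      D ⊆ parts Q i →
      # (parts Q i) ≡ demand js₂ i * t + # D →
      (∀ k → k ≢ i → # (parts Q k) ≡ demand js₁ k * t + demand js₂ k * t) →
      ∃ λ (ts : List (Tile t)) → ∃ λ S → length ts ≡ length js₁ + length js₂ ×
        S ⊆ X × # S ≡ demand js₁ i * t × (∀ v → occs ts v + 𝟙 (D v) ≡ occ Q v + 𝟙 (S v))
    retile-along {T} t Q i X D js₁ js₂ rich big 0<q small D⊆ #Qᵢ #Qₖ =
      finish (common-neighbours (⋃ (parts Q)) X (demand js₁ i * t) 0<q enough)
      where
      #⋃ : # (⋃ (parts Q)) ≤ N₁ * T
      #⋃ = subst (# (⋃ (parts Q)) ≤_) (sum-card Q) (#⋃≤ (parts Q))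
      enough : 2 ^ # (⋃ (parts Q)) * (demand js₁ i * t) ≤ # X
      enough = ≤-trans (*-mono-≤ (^-monoʳ-≤ 2 #⋃) (*-monoˡ-≤ t (small i))) big
      finish : (∃ λ S → ∃ λ x → x ∈ X × S ⊆ X × # S ≡ demand js₁ i * t ×
        (∀ y v → y ∈ S → v ∈ ⋃ (parts Q) → adj G x v ≡ true → adj G y v ≡ true)) →
        ∃ λ (ts : List (Tile t)) → ∃ λ S → length ts ≡ length js₁ + length js₂ ×
        S ⊆ X × # S ≡ demand js₁ i * t × (∀ v → occs ts v + 𝟙 (D v) ≡ occ Q v + 𝟙 (S v))
      finish (S , x , x∈X , S⊆X , #S , nbr) =
        proj₁ res , S , proj₁ (proj₂ res) , S⊆X , #S , proj₂ (proj₂ res)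
        where
        pick : ∀ k → ∃ λ M → M ⊆ parts Q k ∩ adj G x × (k ≢ i → # M ≡ demand js₁ k * t)
        pick k with k ≟ᶠ i
        -- The new set `S` plays the i-th part, so any subset of the old one will do here.
        ... | yes k≡i = ∅ , (λ _ ()) , λ k≢i → ⊥-elim (k≢i k≡i)
        ... | no k≢i with choose-subset (parts Q k ∩ adj G x) (demand js₁ k * t)
                            (≤-trans (*-monoˡ-≤ t (small k)) (rich x x∈X k k≢i))
        ...   | M , M⊆ , #M = M , M⊆ , λ _ → #M
        M : Fin r → VSet n
        M k = proj₁ (pick k)
        M⊆ : ∀ k → M k ⊆ parts Q k
        M⊆ k v v∈ = ∩⊆ˡ (parts Q k) (adj G x) v (proj₁ (proj₂ (pick k)) v v∈)
        joined : ∀ {k u v} → k ≢ i → u ∈ S → v ∈ M k → adj G u v ≡ true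
        joined {k} {u} {v} _ u∈ v∈ = nbr u v u∈ (⊆⋃ (parts Q) k v (M⊆ k v v∈))
          (∩⊆ʳ (parts Q k) (adj G x) v (proj₁ (proj₂ (pick k)) v v∈))
        res = retile t Q i S D M js₁ js₂ D⊆ M⊆ joined #S #Qᵢ (λ k → proj₂ (proj₂ (pick k))) #Qₖ

    -- `D` is given up and `S` is gained. The bound on the number of pieces limits how much of the
    -- graph a single improvement moves to the smaller scale.
    Improved : ∀ {T} → ℕ → ℕ → Tile T → VSet n → Set
    Improved m t Q X = ∃ λ (ts : List (Tile t)) → ∃ λ S → ∃ λ D → length ts ≤ m × S ⊆ X ×
      (∀ v → occs ts v + 𝟙 (D v) ≡ occ Q v + 𝟙 (S v)) × W (𝟙 ∘ D) + t ≤ W (𝟙 ∘ S)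

    A≤N₁ : A ≤ N₁
    A≤N₁ = ≤-trans (m≤m+n A (s * A)) (m≤m+n _ B)

    1≤A : 1 ≤ A
    1≤A = ≤-trans (s≤s z≤n) B<A

    1≤N₁ : 1 ≤ N₁
    1≤N₁ = ≤-trans 1≤A A≤N₁

    size≤A : ∀ j i → size j i ≤ A
    size≤A j i with i ≟ᶠ j
    ... | yes _ = <⇒≤ B<A
    ... | no  _ = ≤-refl

    -- `S` replaces A t vertices of strictly higher level in a large part, so the shape of the tiles
    -- is kept and each exchanged vertex gains at least 1 in weight.
    swap : ∀ c t (Q : Tile (suc c * t)) i l (X : VSet n) → 1 ≤ t → i ≢ special Q →
      (∀ x → x ∈ X → ℓ x ≡ l) → (∀ u → ℓ u ≤ L) →
      (∀ x → x ∈ X → Rich t Q i x) →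
      A * t ≤ # (parts Q i ∩ Higher l) →
      2 ^ (N₁ * (suc c * t)) * (A * N₁ * t) ≤ # X →
      Improved (suc c) t Q X
    swap c t Q i l X 1≤t i≢ level ℓ≤L rich high big
      = finish (retile-along t Q i X D (j ∷ []) (replicate c j) rich big
        (subst (λ z → 0 < z * t) (sym dem) (*-mono-≤ 1≤A 1≤t)) (λ k → ≤-trans (≤-reflexive (+-identityʳ (size j k)))
          (≤-trans (size≤A j k) (m≤m*n A N₁ {{>-nonZero 1≤N₁}})))
        (λ v v∈ → ∩⊆ˡ (parts Q i) (Higher l) v (D⊆ v v∈)) #Qᵢ (λ k _ → #Qₖ k))
      where
      j = special Q
      dropped = choose-subset (parts Q i ∩ Higher l) (A * t) high
      D  = proj₁ dropped
      D⊆ = proj₁ (proj₂ dropped)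
      #D = proj₂ (proj₂ dropped)
      dem : demand (j ∷ []) i ≡ A
      dem = trans (+-identityʳ _) (size-other i≢)
      #Qₖ : ∀ k → # (parts Q k) ≡ demand (j ∷ []) k * t + demand (replicate c j) k * t
      #Qₖ k = trans (card Q k) (trans (rearrange (size j k) c t)
        (cong (λ z → (size j k + 0) * t + z * t) (sym (demand-replicate c j k))))
        where
        rearrange : ∀ a c t → a * (suc c * t) ≡ (a + 0) * t + c * a * t
        rearrange = solve-∀
      #Qᵢ : # (parts Q i) ≡ demand (replicate c j) i * t + # D
      #Qᵢ = trans (#Qₖ i) (trans (+-comm (demand (j ∷ []) i * t) _)
        (cong (demand (replicate c j) i * t +_) (trans (cong (_* t) dem) (sym #D))))
      finish : (∃ λ (ts : List (Tile t)) → ∃ λ S → length ts ≡ 1 + length (replicate c j) ×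
        S ⊆ X × # S ≡ demand (j ∷ []) i * t × (∀ v → occs ts v + 𝟙 (D v) ≡ occ Q v + 𝟙 (S v))) → Improved (suc c) t Q X
      finish (ts , S , len , S⊆X , #S , bal) =
        ts , S , D , ≤-reflexive (trans len (cong suc (length-replicate c))) , S⊆X , bal , gain
        where
        open ≤-Reasoning
        -- As no level exceeds `L`, the truncated subtraction in `wt` is strictly decreasing here.
        drop : ∀ u → u ∈ D → suc (wt u) ≤ C + (L ∸ l)
        drop u u∈ = subst (_≤ C + (L ∸ l)) (+-suc C (L ∸ ℓ u))
          (+-monoʳ-≤ C (∸-monoʳ-< (⌊⌋-sound (l <? ℓ u) (∩⊆ʳ (parts Q i) (Higher l) u (D⊆ u u∈))) (ℓ≤L u)))
        K = C + (L ∸ l)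
        predK : K ≡ suc (K ∸ 1)
        predK = sym (m+[n∸m]≡n (≤-trans (m≤n+m 1 _) (m≤m+n C (L ∸ l))))
        gain : W (𝟙 ∘ D) + t ≤ W (𝟙 ∘ S)
        gain = begin
          W (𝟙 ∘ D) + t               ≤⟨ +-mono-≤ (W-upper D (K ∸ 1) (λ u u∈ → <⇒≤pred (drop u u∈)))
                                                   (m≤n*m t A {{>-nonZero 1≤A}}) ⟩
          # D * (K ∸ 1) + A * t       ≡⟨ cong (λ z → z * (K ∸ 1) + A * t) #D ⟩
          A * t * (K ∸ 1) + A * t     ≡⟨ rearrange (A * t) (K ∸ 1) ⟩
          A * t * suc (K ∸ 1)         ≡⟨ cong₂ _*_ (trans (cong (_* t) (sym dem)) (sym #S)) (sym predK) ⟩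
          # S * K  ≤⟨ W-lower S K (λ v v∈ → ≤-reflexive (cong (λ z → C + (L ∸ z)) (sym (level v (S⊆X v v∈))))) ⟩
          W (𝟙 ∘ S)  ∎
          where
          rearrange : ∀ a k → a * k + a ≡ a * suc k
          rearrange = solve-∀

    copies-of : ∀ {m} → (Fin m → ℕ) → (Fin m → Fin r) → List (Fin r)
    copies-of {zero}  f g = []
    copies-of {suc m} f g = replicate (f zero) (g zero) ++ copies-of (f ∘ suc) (g ∘ suc)

    demand-copies-of : ∀ {m} (f : Fin m → ℕ) g i → demand (copies-of f g) i ≡ sum (λ k → f k * size (g k) i)
    demand-copies-of {zero}  f g i = refl
    demand-copies-of {suc m} f g i = trans (demand-++ (replicate (f zero) (g zero)) _ i)
      (cong₂ _+_ (demand-replicate (f zero) (g zero) i) (demand-copies-of (f ∘ suc) (g ∘ suc) i))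

    length-copies-of : ∀ {m} (f : Fin m → ℕ) g → length (copies-of f g) ≡ sum f
    length-copies-of {zero}  f g = refl
    length-copies-of {suc m} f g = trans (length-++ (replicate (f zero) (g zero)))
      (cong₂ _+_ (length-replicate (f zero)) (length-copies-of (f ∘ suc) (g ∘ suc)))

    -- How many tiles with special part `k` are built by `enlarge`, which keeps `j` a large part in
    -- all of them.
    all-but : Fin r → Fin r → ℕ
    all-but j k = if ⌊ k ≟ᶠ j ⌋ then 0 else A

    all-but-only : ∀ j k → all-but j k + only j A k ≡ A
    all-but-only j k with k ≟ᶠ j
    ... | yes _ = refl
    ... | no  _ = +-identityʳ A

    sum-all-but : ∀ j → sum (all-but j) ≡ ρ * A
    sum-all-but j = +-cancelʳ-≡ A _ _ (begin
      sum (all-but j) + A  ≡⟨ cong (sum (all-but j) +_) (sum-δ j A) ⟨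
      sum (all-but j) + sum (only j A)      ≡⟨ ∑-distrib-+ (all-but j) (only j A) ⟨
      sum (λ k → all-but j k + only j A k)  ≡⟨ sum-cong-≗ (all-but-only j) ⟩
      sum {r} (λ _ → A)  ≡⟨ sum-const r A ⟩
      A + ρ * A  ≡⟨ +-comm A (ρ * A) ⟩
      ρ * A + A  ∎)
      where open ≡-Reasoning

    -- Each of the ρ A tiles takes A from part `i`, except that the `all-but j i` tiles special at
    -- `i` take B. The correction is moved across to stay in ℕ.
    demand-rotations : ∀ j i → demand (copies-of (all-but j) (λ k → k)) i + all-but j i * A ≡ A * (ρ * A) + all-but j i * B
    demand-rotations j i = begin
      demand (copies-of (all-but j) (λ k → k)) i + all-but j i * A
        ≡⟨ cong₂ _+_ (demand-copies-of (all-but j) (λ k → k) i) (sym (sum-δ i (all-but j i * A))) ⟩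
      sum (λ k → all-but j k * size k i) + sum (only i (all-but j i * A))
        ≡⟨ ∑-distrib-+ (λ k → all-but j k * size k i) (only i (all-but j i * A)) ⟨
      sum (λ k → all-but j k * size k i + only i (all-but j i * A) k)
        ≡⟨ sum-cong-≗ pointwise ⟩
      sum (λ k → A * all-but j k + only i (all-but j i * B) k)
        ≡⟨ ∑-distrib-+ (λ k → A * all-but j k) (only i (all-but j i * B)) ⟩
      sum (λ k → A * all-but j k) + sum (only i (all-but j i * B))
        ≡⟨ cong₂ _+_ (trans (sym (*-distribˡ-sum A (all-but j))) (cong (A *_) (sum-all-but j))) (sum-δ i (all-but j i * B)) ⟩
      A * (ρ * A) + all-but j i * B ∎
      where
      open ≡-Reasoning
      pointwise : ∀ k → all-but j k * size k i + only i (all-but j i * A) k ≡ A * all-but j k + only i (all-but j i * B) k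
      pointwise k with k ≟ᶠ i
      ... | yes refl = trans (cong (λ z → all-but j k * z + all-but j k * A) (size-special k)) (rearrange (all-but j k) A B)
        where
        rearrange : ∀ x a b → x * b + x * a ≡ a * x + x * b
        rearrange = solve-∀
      ... | no k≢i = cong (_+ 0) (trans (cong (all-but j k *_) (size-other (λ i≡k → k≢i (sym i≡k)))) (*-comm (all-but j k) A))

    -- For each k ≠ j = special Q, S and the other parts hold A tiles with special part k. As S plays
    -- a large part in them, they use less of the large parts of Q, and more tiles fit in total.
    enlarge : ∀ c t (Q : Tile (c * t)) (X : VSet n) → 1 ≤ t → e₀ ≤ c →
      (∀ u → ℓ u ≤ L) →
      (∀ x → x ∈ X → Rich t Q (special Q) x) →
      2 ^ (N₁ * (c * t)) * (A * N₁ * t) ≤ # X →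
      Improved (c + N₁) t Q X
    enlarge c t Q X 1≤t e₀≤c ℓ≤L rich big
      = finish (retile-along t Q j X D js₁ js₂ rich big
        (subst (λ z → 0 < z * t) (sym demⱼ) (*-mono-≤ (*-mono-≤ 1≤A (≤-trans 1≤A (m≤m+n A _))) 1≤t)) small D⊆ #Qⱼ #Qₖ)
      where
      j = special Q
      enough : B * e₀ * t ≤ # (parts Q j)
      enough = ≤-trans (≤-trans (≤-reflexive (*-assoc B e₀ t)) (*-monoʳ-≤ B (*-monoˡ-≤ t e₀≤c)))
        (≤-reflexive (sym (trans (card Q j) (cong (_* (c * t)) (size-special j)))))
      dropped = choose-subset (parts Q j) (B * e₀ * t) enough
      D  = proj₁ dropped
      D⊆ = proj₁ (proj₂ dropped)
      #D = proj₂ (proj₂ dropped)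
      c′ = c ∸ e₀
      js₁ = copies-of (all-but j) (λ k → k)
      js₂ = replicate c′ j
      c≡ : e₀ + c′ ≡ c
      c≡ = m+[n∸m]≡n e₀≤c
      all-but-j : all-but j j ≡ 0
      all-but-j with j ≟ᶠ j
      ... | yes _ = refl
      ... | no f = ⊥-elim (f refl)
      all-but-k : ∀ {k} → k ≢ j → all-but j k ≡ A
      all-but-k {k} k≢j with k ≟ᶠ j
      ... | yes k≡j = ⊥-elim (k≢j k≡j)
      ... | no _ = refl
      demⱼ : demand js₁ j ≡ A * (ρ * A)
      demⱼ = trans (sym (trans (cong (λ z → demand js₁ j + z * A) all-but-j) (+-identityʳ _)))
        (trans (demand-rotations j j) (trans (cong (λ z → A * (ρ * A) + z * B) all-but-j) (+-identityʳ _)))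
      demₖ : ∀ {k} → k ≢ j → demand js₁ k ≡ A * e₀
      demₖ {k} k≢j = +-cancelʳ-≡ (A * A) _ _ (begin
        demand js₁ k + A * A               ≡⟨ cong (λ z → demand js₁ k + z * A) (all-but-k k≢j) ⟨
        demand js₁ k + all-but j k * A     ≡⟨ demand-rotations j k ⟩
        A * (ρ * A) + all-but j k * B      ≡⟨ cong (λ z → A * (ρ * A) + z * B) (all-but-k k≢j) ⟩
        A * (ρ * A) + A * B  ≡⟨ rearrange s A B ⟩
        A * e₀ + A * A  ∎)
        where
        open ≡-Reasoning
        rearrange : ∀ s a b → a * (suc s * a) + a * b ≡ a * (s * a + b) + a * a
        rearrange = solve-∀
      small : ∀ k → demand js₁ k ≤ A * N₁
      small k with k ≟ᶠ j
      ... | yes refl = ≤-trans (≤-reflexive demⱼ) (*-monoʳ-≤ A (m≤m+n _ B))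
      ... | no k≢j   = ≤-trans (≤-reflexive (demₖ k≢j)) (*-monoʳ-≤ A (+-monoˡ-≤ B (m≤n+m (s * A) A)))
      #Qⱼ : # (parts Q j) ≡ demand js₂ j * t + # D
      #Qⱼ = begin
        # (parts Q j)  ≡⟨ card Q j ⟩
        size j j * (c * t)  ≡⟨ cong₂ (λ a b → a * (b * t)) (size-special j) (sym c≡) ⟩
        B * ((e₀ + c′) * t)  ≡⟨ rearrange B e₀ c′ t ⟩
        c′ * B * t + B * e₀ * t               ≡⟨ cong₂ (λ a b → a * t + b) (trans (cong (c′ *_) (sym (size-special j))) (sym (demand-replicate c′ j j))) (sym #D) ⟩
        demand js₂ j * t + # D  ∎
        where
        open ≡-Reasoning
        rearrange : ∀ b e c t → b * ((e + c) * t) ≡ c * b * t + b * e * t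
        rearrange = solve-∀
      #Qₖ : ∀ k → k ≢ j → # (parts Q k) ≡ demand js₁ k * t + demand js₂ k * t
      #Qₖ k k≢j = begin
        # (parts Q k)  ≡⟨ card Q k ⟩
        size j k * (c * t)  ≡⟨ cong₂ (λ a b → a * (b * t)) (size-other k≢j) (sym c≡) ⟩
        A * ((e₀ + c′) * t)  ≡⟨ rearrange A e₀ c′ t ⟩
        A * e₀ * t + c′ * A * t               ≡⟨ cong₂ (λ a b → a * t + b * t) (sym (demₖ k≢j)) (trans (cong (c′ *_) (sym (size-other k≢j))) (sym (demand-replicate c′ j k))) ⟩
        demand js₁ k * t + demand js₂ k * t   ∎
        where
        open ≡-Reasoning
        rearrange : ∀ b e c t → b * ((e + c) * t) ≡ b * e * t + c * b * t
        rearrange = solve-∀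
      finish : (∃ λ (ts : List (Tile t)) → ∃ λ S → length ts ≡ length js₁ + length js₂ ×
        S ⊆ X × # S ≡ demand js₁ j * t × (∀ v → occs ts v + 𝟙 (D v) ≡ occ Q v + 𝟙 (S v))) → Improved (c + N₁) t Q X
      finish (ts , S , len , S⊆X , #S , bal) = ts , S , D , len≤ , S⊆X , bal , gain
        where
        len≤ : length ts ≤ c + N₁
        len≤ = begin
          length ts  ≡⟨ len ⟩
          length js₁ + length js₂     ≡⟨ cong₂ _+_ (trans (length-copies-of (all-but j) (λ k → k)) (sum-all-but j)) (length-replicate c′) ⟩
          ρ * A + c′  ≤⟨ +-mono-≤ (m≤m+n (ρ * A) B) (m∸n≤m c e₀) ⟩
          N₁ + c  ≡⟨ +-comm N₁ c ⟩
          c + N₁  ∎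
          where open ≤-Reasoning
        gap = A ∸ suc B
        A≡ : suc B + gap ≡ A
        A≡ = m+[n∸m]≡n B<A
        -- The net number of new vertices is A (ρ A) - B e₀ = (A - B) N₁, in units of t; it is
        -- positive exactly because B < A.
        surplus : A * (ρ * A) ≡ B * e₀ + suc gap * N₁
        surplus = subst (λ a → a * (ρ * a) ≡ B * (s * a + B) + suc gap * (ρ * a + B)) A≡ (rearrange s B gap)
          where
          rearrange : ∀ s b g → (suc b + g) * (suc s * (suc b + g)) ≡
                      b * (s * (suc b + g) + b) + suc g * (suc s * (suc b + g) + b)
          rearrange = solve-∀
        gain : W (𝟙 ∘ D) + t ≤ W (𝟙 ∘ S)
        gain = begin
          W (𝟙 ∘ D) + t  ≤⟨ +-monoˡ-≤ t (W-upper D (C + L) (λ v _ → wt≤ v)) ⟩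
          # D * (C + L) + t  ≡⟨ cong (λ z → z * (C + L) + t) #D ⟩
          B * e₀ * t * (C + L) + t  ≡⟨ rearrange (B * e₀) t L ⟩
          (B * e₀ + 1) * t * C  ≤⟨ *-monoˡ-≤ C (*-monoˡ-≤ t (+-monoʳ-≤ (B * e₀) (*-mono-≤ {1} {suc gap} (s≤s z≤n) 1≤N₁))) ⟩
          (B * e₀ + suc gap * N₁) * t * C            ≡⟨ cong (λ z → z * t * C) (trans (sym surplus) (sym demⱼ)) ⟩
          demand js₁ j * t * C  ≡⟨ cong (_* C) #S ⟨
          # S * C  ≤⟨ W-lower S C (λ v _ → C≤wt v) ⟩
          W (𝟙 ∘ S)  ∎
          where
          open ≤-Reasoning
          rearrange : ∀ x t l → x * t * (l * x + 1 + l) + t ≡ (x + 1) * t * (l * x + 1)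
          rearrange = solve-∀

  -- Tiles that cannot be improved

  outside : ∀ {n} → VSet n → (Fin n → ℕ) → ℕ
  outside P f = sum (λ v → f v * 𝟙 (not (P v)))

  outside-+ : ∀ {n} (P : VSet n) f g → outside P (λ v → f v + g v) ≡ outside P f + outside P g
  outside-+ P f g = trans (sum-cong-≗ (λ v → *-distribʳ-+ (𝟙 (not (P v))) (f v) (g v)))
    (∑-distrib-+ (λ v → f v * 𝟙 (not (P v))) (λ v → g v * 𝟙 (not (P v))))

  𝟙-∧ : ∀ a b → 𝟙 (a ∧ b) ≡ 𝟙 a * 𝟙 b
  𝟙-∧ true  b = sym (*-identityˡ (𝟙 b))
  𝟙-∧ false b = refl

  outside-set : ∀ {n} (P Q : VSet n) → outside P (𝟙 ∘ Q) ≡ # (Q ∖ P)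
  outside-set P Q = sum-cong-≗ (λ v → sym (𝟙-∧ (Q v) (not (P v))))

  module Obstruction {n : ℕ} (G : Graph n) (s A B : ℕ) (B<A : B < A) (ℓ : Fin n → ℕ) (L : ℕ)
                     (ℓ≤L : ∀ u → ℓ u ≤ L) (c₀ t : ℕ) (1≤t : 1 ≤ t) where

    open Tiling G s A B
    open Improvement G s A B B<A ℓ L

    T R : ℕ
    T = suc c₀ * t
    R = A * N₁ * t

    outside-occ : ∀ {u} (P : VSet n) (Q : Tile u) → outside P (occ Q) ≡ sum (λ k → # (parts Q k ∖ P))
    outside-occ P Q = begin
      sum (λ v → occ Q v * 𝟙 (not (P v)))
        ≡⟨ sum-cong-≗ (λ v → *-distribʳ-sum (𝟙 (not (P v))) (λ k → 𝟙 (parts Q k v))) ⟩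
      sum (λ v → sum (λ k → 𝟙 (parts Q k v) * 𝟙 (not (P v))))
        ≡⟨ ∑-comm (λ v k → 𝟙 (parts Q k v) * 𝟙 (not (P v))) ⟩
      sum (λ k → sum (λ v → 𝟙 (parts Q k v) * 𝟙 (not (P v))))
        ≡⟨ sum-cong-≗ (λ k → outside-set P (parts Q k)) ⟩
      sum (λ k → # (parts Q k ∖ P)) ∎
      where open ≡-Reasoning

    -- Vertices like x can improve Q at its i-th part, by `enlarge` or by `swap`.
    Candidate : Tile T → Fin n → Fin r → Set
    Candidate Q x i = Rich t Q i x × (i ≡ special Q ⊎ A * t ≤ # (parts Q i ∩ Higher (ℓ x)))

    Candidate? : ∀ Q x i → Dec (Candidate Q x i)
    Candidate? Q x i = all? (λ k → ¬? (k ≟ᶠ i) →-dec (R ≤? # (parts Q k ∩ adj G x))) ×-dec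
      ((i ≟ᶠ special Q) ⊎-dec (A * t ≤? # (parts Q i ∩ Higher (ℓ x))))

    Useful? : ∀ Q x → Dec (∃ (Candidate Q x))
    Useful? Q x = any? (Candidate? Q x)

    useful : Tile T → VSet n
    useful Q x = ⌊ Useful? Q x ⌋

    -- `K` is the pool that `retile-along` needs. `K⁺` allows for two applications of the pigeonhole
    -- principle, over the r parts and over the L + 1 levels.
    K K⁺ : ℕ
    K  = 2 ^ (N₁ * T) * R
    K⁺ = r * (suc L * K)

    level : Fin (suc L) → VSet n
    level k x = ⌊ ℓ x ≟ toℕ k ⌋

    improve : ∀ Q (Y : VSet n) → e₀ ≤ suc c₀ → K⁺ < # (Y ∩ useful Q) → Improved (suc c₀ + N₁) t Q Y
    improve Q Y e₀≤c many = in-part (pigeonhole r (suc L * K) (Y ∩ useful Q) candidate cover many)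
      where
      candidate : Fin r → VSet n
      candidate i x = ⌊ Candidate? Q x i ⌋
      cover : ∀ v → v ∈ Y ∩ useful Q → ∃ λ i → v ∈ candidate i
      cover v v∈ = proj₁ use , ⌊⌋-complete (Candidate? Q v (proj₁ use)) (proj₂ use)
        where
        use : ∃ (Candidate Q v)
        use = ⌊⌋-sound (Useful? Q v) (∩⊆ʳ Y (useful Q) v v∈)
      in-part : (∃ λ i → suc L * K < # (Y ∩ useful Q ∩ candidate i)) → Improved (suc c₀ + N₁) t Q Y
      in-part (i , many-i) = on-level (pigeonhole (suc L) K Z level
          (λ v _ → fromℕ< (s≤s (ℓ≤L v)) , ⌊⌋-complete (ℓ v ≟ _) (sym (toℕ-fromℕ< (s≤s (ℓ≤L v))))) many-i)
        where
        Z = Y ∩ useful Q ∩ candidate i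
        on-level : (∃ λ k → K < # (Z ∩ level k)) → Improved (suc c₀ + N₁) t Q Y
        on-level (k , many-k) = split (i ≟ᶠ special Q)
          where
          l = toℕ k
          X = Z ∩ level k
          X⊆Y : X ⊆ Y
          X⊆Y v v∈ = ∩⊆ˡ Y (useful Q) v (∩⊆ˡ (Y ∩ useful Q) (candidate i) v (∩⊆ˡ Z (level k) v v∈))
          at-l : ∀ x → x ∈ X → ℓ x ≡ l
          at-l x x∈ = ⌊⌋-sound (ℓ x ≟ l) (∩⊆ʳ Z (level k) x x∈)
          cand : ∀ x → x ∈ X → Candidate Q x i
          cand x x∈ = ⌊⌋-sound (Candidate? Q x i) (∩⊆ʳ (Y ∩ useful Q) (candidate i) x (∩⊆ˡ Z (level k) x x∈))
          weaken : ∀ {m} → m ≤ suc c₀ + N₁ → Improved m t Q X → Improved (suc c₀ + N₁) t Q Y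
          weaken m≤ (ts , S , D , len , S⊆X , rest) = ts , S , D , ≤-trans len m≤ , (λ v v∈ → X⊆Y v (S⊆X v v∈)) , rest
          split : Dec (i ≡ special Q) → Improved (suc c₀ + N₁) t Q Y
          split (yes refl) = weaken ≤-refl (enlarge (suc c₀) t Q X 1≤t e₀≤c ℓ≤L (λ x x∈ → proj₁ (cand x x∈)) (<⇒≤ many-k))
          split (no i≢j) = weaken (m≤m+n (suc c₀) N₁)
            (swap c₀ t Q i l X 1≤t i≢j at-l ℓ≤L (λ x x∈ → proj₁ (cand x x∈)) high (<⇒≤ many-k))
            where
            pick : ∃ λ v → v ∈ X
            pick = #-nonempty X (≤-trans (s≤s z≤n) many-k)
            high : A * t ≤ # (parts Q i ∩ Higher l)
            high = cases (proj₂ (cand (proj₁ pick) (proj₂ pick)))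
              where
              cases : i ≡ special Q ⊎ A * t ≤ # (parts Q i ∩ Higher (ℓ (proj₁ pick))) → A * t ≤ # (parts Q i ∩ Higher l)
              cases (inj₁ e) = ⊥-elim (i≢j e)
              cases (inj₂ h) = subst (λ z → A * t ≤ # (parts Q i ∩ Higher z)) (at-l (proj₁ pick) (proj₂ pick)) h

    -- A large part has A T = A t + A (c₀ t) vertices, so this many remain if fewer than A t of them
    -- are of higher level.
    low : ℕ → Tile T → Bool
    low l Q = ⌊ A * (c₀ * t) ≤? outside (Higher l) (occ Q) ⌋

    two-sizes : ∀ j {k k′} → k ≢ k′ → A + B ≤ size j k + size j k′
    two-sizes j {k} {k′} k≢ with k ≟ᶠ j | k′ ≟ᶠ j
    ... | yes refl | yes refl = ⊥-elim (k≢ refl)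
    ... | yes _    | no _     = ≤-reflexive (+-comm A B)
    ... | no _     | yes _    = ≤-refl
    ... | no _     | no _     = +-monoʳ-≤ A (<⇒≤ B<A)

    -- Call a part poor if `x` has fewer than `R` neighbours in it. With no poor part, `x` would be
    -- a candidate at the special part. Two poor parts account for (A + B) T missing vertices up to
    -- 2 R. A single poor part is a large one with few vertices of higher level, or else `x` would
    -- be a candidate there; then Q is low and the deficit B T is charged to that.
    non-neighbours-in-useless : ∀ Q x → ¬ ∃ (Candidate Q x) →
      (A + B) * T ≤ outside (adj G x) (occ Q) + (R + R) + 𝟙 (low (ℓ x) Q) * (B * T)
    non-neighbours-in-useless Q x none = first (any? (λ k → ¬? (R ≤? # (parts Q k ∩ adj G x))))
      where
      open ≤-Reasoning
      j = special Q
      l = ℓ x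
      m = outside (adj G x) (occ Q)
      missing : Fin r → ℕ
      missing k = # (parts Q k ∖ adj G x)
      Poor : Fin r → Set
      Poor k = ¬ (R ≤ # (parts Q k ∩ adj G x))
      poor-part : ∀ k → Poor k → size j k * T ≤ R + missing k
      poor-part k poor = begin
        size j k * T  ≡⟨ card Q k ⟨
        # (parts Q k)  ≡⟨ #-split (parts Q k) (adj G x) ⟩
        # (parts Q k ∩ adj G x) + missing k        ≤⟨ +-monoˡ-≤ _ (<⇒≤ (≰⇒> poor)) ⟩
        R + missing k  ∎
      m≡ : m ≡ sum missing
      m≡ = outside-occ (adj G x) Q
      second : ∀ k → Poor k → Dec (∃ λ k′ → k′ ≢ k × Poor k′) →
               (A + B) * T ≤ m + (R + R) + 𝟙 (low l Q) * (B * T)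
      second k poor (yes (k′ , k′≢k , poor′)) = begin
        (A + B) * T  ≤⟨ *-monoˡ-≤ T (two-sizes j k′≢k) ⟩
        (size j k′ + size j k) * T               ≡⟨ *-distribʳ-+ T (size j k′) (size j k) ⟩
        size j k′ * T + size j k * T             ≤⟨ +-mono-≤ (poor-part k′ poor′) (poor-part k poor) ⟩
        (R + missing k′) + (R + missing k)       ≡⟨ rearrange R (missing k′) (missing k) ⟩
        (missing k′ + missing k) + (R + R)       ≤⟨ +-monoˡ-≤ (R + R) (two-terms≤sum missing k′≢k) ⟩
        sum missing + (R + R)  ≡⟨ cong (_+ (R + R)) m≡ ⟨
        m + (R + R)  ≤⟨ m≤m+n _ _ ⟩
        m + (R + R) + 𝟙 (low l Q) * (B * T)      ∎
        where
        rearrange : ∀ a b c → (a + b) + (a + c) ≡ (b + c) + (a + a)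
        rearrange = solve-∀
      second k poor (no others) = begin
        (A + B) * T  ≡⟨ *-distribʳ-+ T A B ⟩
        A * T + B * T  ≡⟨ cong (λ z → z * T + B * T) (size-other k≢j) ⟨
        size j k * T + B * T  ≤⟨ +-monoˡ-≤ (B * T) (poor-part k poor) ⟩
        R + missing k + B * T  ≤⟨ +-monoˡ-≤ (B * T) (+-mono-≤ (m≤m+n R R) (term≤sum missing k)) ⟩
        R + R + sum missing + B * T              ≡⟨ cong (λ z → R + R + z + B * T) m≡ ⟨
        R + R + m + B * T  ≡⟨ rearrange (R + R) m (B * T) ⟩
        m + (R + R) + 1 * (B * T)  ≡⟨ cong (λ z → m + (R + R) + 𝟙 z * (B * T)) is-low ⟨
        m + (R + R) + 𝟙 (low l Q) * (B * T)      ∎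
        where
        rearrange : ∀ a b c → a + b + c ≡ b + a + 1 * c
        rearrange = solve-∀
        rich : Rich t Q k x
        rich k′ k′≢k with R ≤? # (parts Q k′ ∩ adj G x)
        ... | yes h = h
        ... | no ¬h = ⊥-elim (others (k′ , k′≢k , ¬h))
        k≢j : k ≢ j
        k≢j k≡j = none (k , rich , inj₁ k≡j)
        few : # (parts Q k ∩ Higher l) < A * t
        few = ≰⇒> λ h → none (k , rich , inj₂ h)
        is-low : low l Q ≡ true
        is-low = ⌊⌋-complete (A * (c₀ * t) ≤? outside (Higher l) (occ Q)) (+-cancelˡ-≤ (A * t) _ _ (begin
          A * t + A * (c₀ * t)  ≡⟨ *-distribˡ-+ A t (c₀ * t) ⟨
          A * T  ≡⟨ cong (_* T) (size-other k≢j) ⟨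
          size j k * T  ≡⟨ card Q k ⟨
          # (parts Q k)  ≡⟨ #-split (parts Q k) (Higher l) ⟩
          # (parts Q k ∩ Higher l) + # (parts Q k ∖ Higher l)      ≤⟨ +-mono-≤ (<⇒≤ few) (term≤sum (λ k → # (parts Q k ∖ Higher l)) k) ⟩
          A * t + sum (λ k → # (parts Q k ∖ Higher l))             ≡⟨ cong (A * t +_) (outside-occ (Higher l) Q) ⟨
          A * t + outside (Higher l) (occ Q)  ∎))
      first : Dec (∃ Poor) → (A + B) * T ≤ m + (R + R) + 𝟙 (low l Q) * (B * T)
      first (no all-rich) = ⊥-elim (none (j , rich , inj₁ refl))
        where
        rich : Rich t Q j x
        rich k _ with R ≤? # (parts Q k ∩ adj G x)
        ... | yes h = h
        ... | no ¬h = ⊥-elim (all-rich (k , ¬h))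
      first (yes (k , poor)) = second k poor (any? (λ k′ → ¬? (k′ ≟ᶠ k) ×-dec ¬? (R ≤? # (parts Q k′ ∩ adj G x))))

    non-neighbours-in-tile : ∀ Q x →
      (A + B) * T ≤ outside (adj G x) (occ Q) + (R + R) + 𝟙 (low (ℓ x) Q) * (B * T) + 𝟙 (useful Q x) * ((A + B) * T)
    non-neighbours-in-tile Q x = cases (Useful? Q x) refl
      where
      cases : (u : Dec (∃ (Candidate Q x))) → ⌊ u ⌋ ≡ useful Q x → (A + B) * T ≤
        outside (adj G x) (occ Q) + (R + R) + 𝟙 (low (ℓ x) Q) * (B * T) + 𝟙 (useful Q x) * ((A + B) * T)
      cases (no none) _ = ≤-trans (non-neighbours-in-useless Q x none) (m≤m+n _ _)
      cases (yes _)   e = ≤-trans (≤-reflexive (trans (sym (*-identityˡ _)) (cong (λ z → 𝟙 z * ((A + B) * T)) e))) (m≤n+m _ _)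

    lows : ℕ → List (Tile T) → ℕ
    lows l []       = 0
    lows l (Q ∷ Qs) = 𝟙 (low l Q) + lows l Qs

    uses : List (Tile T) → Fin n → ℕ
    uses []       x = 0
    uses (Q ∷ Qs) x = 𝟙 (useful Q x) + uses Qs x

    lows≤length : ∀ l Qs → lows l Qs ≤ length Qs
    lows≤length l []       = z≤n
    lows≤length l (Q ∷ Qs) = +-mono-≤ (𝟙≤1 (low l Q)) (lows≤length l Qs)

    lows-bound : ∀ l Qs → lows l Qs * (A * (c₀ * t)) ≤ outside (Higher l) (occs Qs)
    lows-bound l []       = z≤n
    lows-bound l (Q ∷ Qs) = subst₂ _≤_ (sym (*-distribʳ-+ (A * (c₀ * t)) (𝟙 (low l Q)) (lows l Qs)))
      (sym (outside-+ (Higher l) (occ Q) (occs Qs))) (+-mono-≤ here (lows-bound l Qs))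
      where
      here : 𝟙 (low l Q) * (A * (c₀ * t)) ≤ outside (Higher l) (occ Q)
      here = cases (A * (c₀ * t) ≤? outside (Higher l) (occ Q)) refl
        where
        cases : (d : Dec (A * (c₀ * t) ≤ outside (Higher l) (occ Q))) → ⌊ d ⌋ ≡ low l Q →
                𝟙 (low l Q) * (A * (c₀ * t)) ≤ outside (Higher l) (occ Q)
        cases (yes h) e = subst (λ z → 𝟙 z * (A * (c₀ * t)) ≤ outside (Higher l) (occ Q)) e (≤-trans (≤-reflexive (*-identityˡ _)) h)
        cases (no _)  e = subst (λ z → 𝟙 z * (A * (c₀ * t)) ≤ outside (Higher l) (occ Q)) e z≤n

    non-neighbours-in-tiles : ∀ Qs x → length Qs * ((A + B) * T) ≤
      outside (adj G x) (occs Qs) + length Qs * (R + R) + lows (ℓ x) Qs * (B * T) + uses Qs x * ((A + B) * T)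
    non-neighbours-in-tiles []       x = z≤n
    non-neighbours-in-tiles (Q ∷ Qs) x = begin
      (A + B) * T + length Qs * ((A + B) * T)
        ≤⟨ +-mono-≤ (non-neighbours-in-tile Q x) (non-neighbours-in-tiles Qs x) ⟩
      (a + (R + R) + α * (B * T) + β * ((A + B) * T)) + (a′ + length Qs * (R + R) + α′ * (B * T) + β′ * ((A + B) * T))
        ≡⟨ rearrange a (R + R) α (B * T) β ((A + B) * T) a′ (length Qs) α′ β′ ⟩
      (a + a′) + suc (length Qs) * (R + R) + (α + α′) * (B * T) + (β + β′) * ((A + B) * T)
        ≡⟨ cong (λ z → z + suc (length Qs) * (R + R) + (α + α′) * (B * T) + (β + β′) * ((A + B) * T)) (outside-+ (adj G x) (occ Q) (occs Qs)) ⟨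
      outside (adj G x) (occs (Q ∷ Qs)) + suc (length Qs) * (R + R) + (α + α′) * (B * T) + (β + β′) * ((A + B) * T) ∎
      where
      open ≤-Reasoning
      a  = outside (adj G x) (occ Q)
      a′ = outside (adj G x) (occs Qs)
      α  = 𝟙 (low (ℓ x) Q)
      α′ = lows (ℓ x) Qs
      β  = 𝟙 (useful Q x)
      β′ = uses Qs x
      rearrange : ∀ a p α q β w a′ m α′ β′ → (a + p + α * q + β * w) + (a′ + m * p + α′ * q + β′ * w)
                  ≡ (a + a′) + suc m * p + (α + α′) * q + (β + β′) * w
      rearrange = solve-∀

    search : ∀ (Y : VSet n) (Qs : List (Tile T)) → All (λ Q → # (Y ∩ useful Q) ≤ K⁺) Qs ⊎
      ∃ λ (Q : Tile T) → ∃ λ (Rs : List (Tile T)) → K⁺ < # (Y ∩ useful Q) × (∀ v → occs Qs v ≡ occ Q v + occs Rs v)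
    search Y []       = inj₁ []
    search Y (Q ∷ Qs) with # (Y ∩ useful Q) ≤? K⁺ | search Y Qs
    ... | no many | _                           = inj₂ (Q , Qs , ≰⇒> many , λ _ → refl)
    ... | yes few | inj₁ all                    = inj₁ (few ∷ all)
    ... | yes _   | inj₂ (Q′ , Rs , many , eq)  = inj₂ (Q′ , Q ∷ Rs , many , λ v →
      trans (cong (occ Q v +_) (eq v)) (exchange (occ Q v) (occ Q′ v) (occs Rs v)))
      where
      exchange : ∀ a b c → a + (b + c) ≡ b + (a + c)
      exchange = solve-∀

    sum-uses : ∀ (Y : VSet n) Qs → All (λ Q → # (Y ∩ useful Q) ≤ K⁺) Qs →
               sum (λ x → 𝟙 (Y x) * uses Qs x) ≤ length Qs * K⁺
    sum-uses Y []       []          = ≤-reflexive (sum-≡0 (λ x → *-zeroʳ (𝟙 (Y x))))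
    sum-uses Y (Q ∷ Qs) (few ∷ all) = begin
      sum (λ x → 𝟙 (Y x) * (𝟙 (useful Q x) + uses Qs x))
        ≡⟨ sum-cong-≗ (λ x → trans (*-distribˡ-+ (𝟙 (Y x)) _ (uses Qs x)) (cong (_+ 𝟙 (Y x) * uses Qs x) (sym (𝟙-∧ (Y x) (useful Q x))))) ⟩
      sum (λ x → 𝟙 ((Y ∩ useful Q) x) + 𝟙 (Y x) * uses Qs x)
        ≡⟨ ∑-distrib-+ (𝟙 ∘ (Y ∩ useful Q)) (λ x → 𝟙 (Y x) * uses Qs x) ⟩
      # (Y ∩ useful Q) + sum (λ x → 𝟙 (Y x) * uses Qs x)
        ≤⟨ +-mono-≤ few (sum-uses Y Qs all) ⟩
      K⁺ + length Qs * K⁺ ∎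
      where open ≤-Reasoning

  -- Greedy construction of a tile in a set with few non-edges

  budget : ℕ → ℕ → ℕ → ℕ
  budget N zero    M = 0
  -- Adding a part shrinks the earlier ones by a factor N, so these must start with size N M. The
  -- power of 2 is the price of a common trace on them. The sum dominates the pool needed at each
  -- stage.
  budget N (suc j) M = 2 ^ (j * (N * M)) * M + budget N j (N * M)

  module Cliques {n : ℕ} (G : Graph n) (s A B : ℕ) (B<A : B < A) (Y : VSet n) where

    open Tiling G s A B

    y : ℕ
    y = # Y

    -- The degree condition gives (A / N₁) y up to errors; `suc A` leaves y / N₁ for them.
    Joined : Fin n → Set
    Joined v = v ∈ Y × N₁ * # (Y ∖ adj G v) ≤ suc A * y

    double-count : ∀ (P Q : VSet n) →
      sum (λ x → 𝟙 (Q x) * # (P ∖ adj G x)) ≡ sum (λ v → 𝟙 (P v) * # (Q ∖ adj G v))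
    double-count P Q = begin
      sum (λ x → 𝟙 (Q x) * # (P ∖ adj G x))
        ≡⟨ sum-cong-≗ (λ x → *-distribˡ-sum (𝟙 (Q x)) (𝟙 ∘ (P ∖ adj G x))) ⟩
      sum (λ x → sum (λ v → 𝟙 (Q x) * 𝟙 ((P ∖ adj G x) v)))
        ≡⟨ ∑-comm (λ x v → 𝟙 (Q x) * 𝟙 ((P ∖ adj G x) v)) ⟩
      sum (λ v → sum (λ x → 𝟙 (Q x) * 𝟙 ((P ∖ adj G x) v)))
        ≡⟨ sum-cong-≗ (λ v → sum-cong-≗ (λ x → flip v x)) ⟩
      sum (λ v → sum (λ x → 𝟙 (P v) * 𝟙 ((Q ∖ adj G v) x)))
        ≡⟨ sum-cong-≗ (λ v → *-distribˡ-sum (𝟙 (P v)) (𝟙 ∘ (Q ∖ adj G v))) ⟨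
      sum (λ v → 𝟙 (P v) * # (Q ∖ adj G v)) ∎
      where
      open ≡-Reasoning
      flip : ∀ v x → 𝟙 (Q x) * 𝟙 ((P ∖ adj G x) v) ≡ 𝟙 (P v) * 𝟙 ((Q ∖ adj G v) x)
      flip v x = begin
        𝟙 (Q x) * 𝟙 (P v ∧ not (adj G x v))          ≡⟨ cong (𝟙 (Q x) *_) (𝟙-∧ (P v) _) ⟩
        𝟙 (Q x) * (𝟙 (P v) * 𝟙 (not (adj G x v)))    ≡⟨ *-exchange (𝟙 (Q x)) (𝟙 (P v)) _ ⟩
        𝟙 (P v) * (𝟙 (Q x) * 𝟙 (not (adj G x v)))    ≡⟨ cong (λ b → 𝟙 (P v) * (𝟙 (Q x) * 𝟙 (not b))) (Graph.sym G x v) ⟩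
        𝟙 (P v) * (𝟙 (Q x) * 𝟙 (not (adj G v x)))    ≡⟨ cong (𝟙 (P v) *_) (𝟙-∧ (Q x) _) ⟨
        𝟙 (P v) * 𝟙 (Q x ∧ not (adj G v x))          ∎

    rich-in : ℕ → VSet n → VSet n
    rich-in M P x = ⌊ M ≤? # (P ∩ adj G x) ⌋

    -- Double counting of the non-edges between P and Y. A poor vertex misses at least (N₁ - 1) M of
    -- the N₁ M vertices of P, so the number q of poor vertices satisfies (N₁ - 1) q ≤ (A + 1) y;
    -- adding q ≤ y gives A + 2.
    few-poor : ∀ M (P : VSet n) → 1 ≤ M → # P ≡ N₁ * M → (∀ v → v ∈ P → Joined v) →
               N₁ * # (Y ∖ rich-in M P) ≤ (2 + A) * y
    few-poor M P 1≤M #P joined = go N₁ refl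
      where
      open ≤-Reasoning
      q = # (Y ∖ rich-in M P)
      D = sum (λ v → 𝟙 (P v) * # (Y ∖ adj G v))
      upper : N₁ * D ≤ N₁ * M * (suc A * y)
      upper = begin
        N₁ * D  ≡⟨ *-distribˡ-sum N₁ (λ v → 𝟙 (P v) * # (Y ∖ adj G v)) ⟩
        sum (λ v → N₁ * (𝟙 (P v) * # (Y ∖ adj G v)))      ≤⟨ sum-mono pointwise ⟩
        sum (λ v → 𝟙 (P v) * (suc A * y))  ≡⟨ *-distribʳ-sum (suc A * y) (𝟙 ∘ P) ⟨
        # P * (suc A * y)  ≡⟨ cong (_* (suc A * y)) #P ⟩
        N₁ * M * (suc A * y)  ∎
        where
        pointwise : ∀ v → N₁ * (𝟙 (P v) * # (Y ∖ adj G v)) ≤ 𝟙 (P v) * (suc A * y)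
        pointwise v with P v in v∈
        ... | true  = subst₂ _≤_ (cong (N₁ *_) (sym (*-identityˡ (# (Y ∖ adj G v))))) (sym (*-identityˡ (suc A * y))) (proj₂ (joined v v∈))
        ... | false = ≤-reflexive (*-zeroʳ N₁)
      -- Generalising `N₁` exposes its predecessor, which is the `N` of the second clause.
      go : ∀ N → N ≡ N₁ → N * q ≤ (2 + A) * y
      go zero    e = z≤n
      go (suc N) e = begin
        q + N * q  ≤⟨ +-mono-≤ (#-mono (∖⊆ Y (rich-in M P))) (*-cancelʳ-≤ (N * q) (suc A * y) M {{>-nonZero 1≤M}} inner) ⟩
        y + suc A * y             ∎
        where
        lower : q * (N * M) ≤ D
        lower = ≤-trans (markov (Y ∖ rich-in M P) (λ x → 𝟙 (Y x) * # (P ∖ adj G x)) (N * M) many)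
                  (≤-reflexive (double-count P Y))
          where
          many : ∀ x → x ∈ Y ∖ rich-in M P → N * M ≤ 𝟙 (Y x) * # (P ∖ adj G x)
          many x x∈ = begin
            N * M  ≤⟨ +-cancelˡ-≤ M _ _ whole ⟩
            # (P ∖ adj G x)  ≡⟨ *-identityˡ _ ⟨
            1 * # (P ∖ adj G x)             ≡⟨ cong (λ b → 𝟙 b * # (P ∖ adj G x)) (proj₁ (∖⁻ Y (rich-in M P) x x∈)) ⟨
            𝟙 (Y x) * # (P ∖ adj G x)       ∎
            where
            whole : M + N * M ≤ M + # (P ∖ adj G x)
            whole = begin
              suc N * M  ≡⟨ cong (_* M) e ⟩
              N₁ * M  ≡⟨ #P ⟨
              # P  ≡⟨ #-split P (adj G x) ⟩
              # (P ∩ adj G x) + # (P ∖ adj G x)           ≤⟨ +-monoˡ-≤ _ (<⇒≤ (≰⇒> (⌊⌋-false (M ≤? # (P ∩ adj G x)) (proj₂ (∖⁻ Y (rich-in M P) x x∈))))) ⟩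
              M + # (P ∖ adj G x)  ∎
        upper′ : D ≤ M * (suc A * y)
        upper′ = *-cancelˡ-≤ (suc N) (subst₂ _≤_ (cong (_* D) (sym e))
          (trans (cong (λ z → z * M * (suc A * y)) (sym e)) (*-assoc (suc N) M (suc A * y))) upper)
        inner : N * q * M ≤ suc A * y * M
        inner = begin
          N * q * M            ≡⟨ rearrange N q M ⟩
          q * (N * M)          ≤⟨ ≤-trans lower upper′ ⟩
          M * (suc A * y)      ≡⟨ *-comm M (suc A * y) ⟩
          suc A * y * M        ∎
          where
          rearrange : ∀ a b c → a * b * c ≡ b * (a * c)
          rearrange = solve-∀

    Family : ℕ → ℕ → (Fin n → Set) → Set
    Family j M Φ = ∃ λ (P : Fin j → VSet n) → Complete P × (∀ k → # (P k) ≡ M) × (∀ k v → v ∈ P k → Φ v)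

    Rich-in-all? : ∀ {j} M (P : Fin j → VSet n) x → Dec (∀ k → M ≤ # (P k ∩ adj G x))
    Rich-in-all? M P x = all? (λ k → M ≤? # (P k ∩ adj G x))

    rich-in-all : ∀ {j} → ℕ → (Fin j → VSet n) → VSet n
    rich-in-all M P x = ⌊ Rich-in-all? M P x ⌋

    few-poor-in-some : ∀ {j} M (P : Fin j → VSet n) (X : VSet n) → X ⊆ Y → 1 ≤ M → (∀ k → # (P k) ≡ N₁ * M) →
      (∀ k v → v ∈ P k → Joined v) → N₁ * # (X ∖ rich-in-all M P) ≤ j * ((2 + A) * y)
    few-poor-in-some {j} M P X X⊆Y 1≤M #P joined = begin
      N₁ * # (X ∖ rich-in-all M P)  ≤⟨ *-monoʳ-≤ N₁ union ⟩
      N₁ * sum (λ k → # (Y ∖ rich-in M (P k)))            ≡⟨ *-distribˡ-sum N₁ (λ k → # (Y ∖ rich-in M (P k))) ⟩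
      sum (λ k → N₁ * # (Y ∖ rich-in M (P k)))            ≤⟨ sum-mono (λ k → few-poor M (P k) 1≤M (#P k) (joined k)) ⟩
      sum {j} (λ _ → (2 + A) * y)  ≡⟨ sum-const j _ ⟩
      j * ((2 + A) * y)  ∎
      where
      open ≤-Reasoning
      union : # (X ∖ rich-in-all M P) ≤ sum (λ k → # (Y ∖ rich-in M (P k)))
      union = ≤-trans (sum-mono pointwise) (≤-reflexive (∑-comm (λ x k → 𝟙 ((Y ∖ rich-in M (P k)) x))))
        where
        pointwise : ∀ x → 𝟙 ((X ∖ rich-in-all M P) x) ≤ sum (λ k → 𝟙 ((Y ∖ rich-in M (P k)) x))
        pointwise x = cases ((X ∖ rich-in-all M P) x) refl
          where
          cases : ∀ b → (X ∖ rich-in-all M P) x ≡ b → 𝟙 b ≤ sum (λ k → 𝟙 ((Y ∖ rich-in M (P k)) x))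
          cases false _ = z≤n
          cases true  e = ≤-trans (≤-reflexive (cong 𝟙 (sym here))) (term≤sum (λ k → 𝟙 ((Y ∖ rich-in M (P k)) x)) (proj₁ poor))
            where
            poor : ∃ λ k → ¬ (M ≤ # (P k ∩ adj G x))
            poor = ¬∀⟶∃¬ j (λ k → M ≤ # (P k ∩ adj G x)) (λ k → M ≤? # (P k ∩ adj G x))
              (⌊⌋-false (Rich-in-all? M P x) (proj₂ (∖⁻ X (rich-in-all M P) x e)))
            here : x ∈ Y ∖ rich-in M (P (proj₁ poor))
            here = ∧-true⁺ (X⊆Y x (∖⊆ X (rich-in-all M P) x e))
              (cong not (¬true⇒false (λ t → proj₂ poor (⌊⌋-sound (M ≤? # (P (proj₁ poor) ∩ adj G x)) t))))

    cons : ∀ {j} → VSet n → (Fin j → VSet n) → Fin (suc j) → VSet n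
    cons S P zero    = S
    cons S P (suc k) = P k

    -- The new part consists of vertices of X with the same trace on the old parts, which shrink to
    -- neighbours of it. Only the old parts have to be `Joined`, so the last part of a tile may come
    -- from all of Y.
    extend : ∀ {j} M (X : VSet n) → 1 ≤ N₁ → X ⊆ Y → 1 ≤ M → Family j (N₁ * M) Joined →
             j * ((2 + A) * y) + N₁ * (2 ^ (j * (N₁ * M)) * M) ≤ N₁ * # X →
             ∃ λ (P : Fin (suc j) → VSet n) → Complete P × (∀ k → # (P k) ≡ M) ×
               P zero ⊆ X × (∀ k v → v ∈ P (suc k) → Joined v)
    extend {j} M X 1≤N₁ X⊆Y 1≤M (P , complete , #P , joined) enough =
      finish (common-neighbours (⋃ P) Z M 1≤M (≤-trans (*-monoˡ-≤ M (^-monoʳ-≤ 2 #⋃)) many))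
      where
      open ≤-Reasoning
      Z = X ∩ rich-in-all M P
      #⋃ : # (⋃ P) ≤ j * (N₁ * M)
      #⋃ = ≤-trans (#⋃≤ P) (≤-reflexive (trans (sum-cong-≗ #P) (sum-const j _)))
      many : 2 ^ (j * (N₁ * M)) * M ≤ # Z
      many = *-cancelˡ-≤ N₁ {{>-nonZero 1≤N₁}} (+-cancelˡ-≤ (j * ((2 + A) * y)) _ _ (begin
        j * ((2 + A) * y) + N₁ * (2 ^ (j * (N₁ * M)) * M)    ≤⟨ enough ⟩
        N₁ * # X  ≡⟨ cong (N₁ *_) (#-split X (rich-in-all M P)) ⟩
        N₁ * (# Z + # (X ∖ rich-in-all M P))  ≡⟨ *-distribˡ-+ N₁ (# Z) _ ⟩
        N₁ * # Z + N₁ * # (X ∖ rich-in-all M P)              ≤⟨ +-monoʳ-≤ (N₁ * # Z) (few-poor-in-some M P X X⊆Y 1≤M #P joined) ⟩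
        N₁ * # Z + j * ((2 + A) * y)  ≡⟨ +-comm (N₁ * # Z) _ ⟩
        j * ((2 + A) * y) + N₁ * # Z  ∎))
      finish : (∃ λ S → ∃ λ x → x ∈ Z × S ⊆ Z × # S ≡ M ×
        (∀ u v → u ∈ S → v ∈ ⋃ P → adj G x v ≡ true → adj G u v ≡ true)) →
        ∃ λ (P : Fin (suc j) → VSet n) → Complete P × (∀ k → # (P k) ≡ M) ×
               P zero ⊆ X × (∀ k v → v ∈ P (suc k) → Joined v)
      finish (S , x , x∈Z , S⊆Z , #S , nbr) = cons S P′ , complete′ , #P′ ,
          (λ v v∈ → ∩⊆ˡ X (rich-in-all M P) v (S⊆Z v v∈)) , (λ k v v∈ → joined k v (P′⊆P k v v∈))
        where
        rich : ∀ k → M ≤ # (P k ∩ adj G x)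
        rich = ⌊⌋-sound (Rich-in-all? M P x) (∩⊆ʳ X (rich-in-all M P) x x∈Z)
        P′ : Fin j → VSet n
        P′ k = proj₁ (choose-subset (P k ∩ adj G x) M (rich k))
        P′⊆ : ∀ k → P′ k ⊆ P k ∩ adj G x
        P′⊆ k = proj₁ (proj₂ (choose-subset (P k ∩ adj G x) M (rich k)))
        P′⊆P : ∀ k → P′ k ⊆ P k
        P′⊆P k v v∈ = ∩⊆ˡ (P k) (adj G x) v (P′⊆ k v v∈)
        #P′ : ∀ k → # (cons S P′ k) ≡ M
        #P′ zero    = #S
        #P′ (suc k) = proj₂ (proj₂ (choose-subset (P k ∩ adj G x) M (rich k)))
        S~P′ : ∀ k {u v} → u ∈ S → v ∈ P′ k → adj G u v ≡ true
        S~P′ k {u} {v} u∈ v∈ = nbr u v u∈ (⊆⋃ P k v (P′⊆P k v v∈)) (∩⊆ʳ (P k) (adj G x) v (P′⊆ k v v∈))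
        complete′ : Complete (cons S P′)
        complete′ {zero}  {zero}  i≢j u∈ v∈ = ⊥-elim (i≢j refl)
        complete′ {zero}  {suc j} i≢j u∈ v∈ = S~P′ j u∈ v∈
        complete′ {suc i} {zero}  i≢j u∈ v∈ = trans (Graph.sym G _ _) (S~P′ i v∈ u∈)
        complete′ {suc i} {suc j} i≢j u∈ v∈ = complete (i≢j ∘ cong suc) (P′⊆P i _ u∈) (P′⊆P j _ v∈)

    families : ∀ (High : VSet n) → 1 ≤ N₁ → High ⊆ Y → (∀ v → v ∈ High → Joined v) →
      ∀ j M → j ≤ ρ → 1 ≤ M → s * ((2 + A) * y) + N₁ * budget N₁ j M ≤ N₁ * # High → Family j M Joined
    families High 1≤N₁ High⊆Y joined zero    M _   _   _ = (λ ()) , (λ { {()} }) , (λ ()) , (λ ())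
    families High 1≤N₁ High⊆Y joined (suc j) M (s≤s j≤s) 1≤M enough =
      let (P , complete , #P , P₀⊆ , P₊) = extend M High 1≤N₁ High⊆Y 1≤M smaller here
      in P , complete , #P , λ { zero v v∈ → joined v (P₀⊆ v v∈) ; (suc k) v v∈ → P₊ k v v∈ }
      where
      smaller : Family j (N₁ * M) Joined
      smaller = families High 1≤N₁ High⊆Y joined j (N₁ * M) (m≤n⇒m≤1+n j≤s) (*-mono-≤ 1≤N₁ 1≤M)
        (≤-trans (+-monoʳ-≤ (s * ((2 + A) * y)) (*-monoʳ-≤ N₁ (m≤n+m (budget N₁ j (N₁ * M)) _))) enough)
      here : j * ((2 + A) * y) + N₁ * (2 ^ (j * (N₁ * M)) * M) ≤ N₁ * # High
      here = ≤-trans (+-mono-≤ (*-monoˡ-≤ ((2 + A) * y) j≤s) (*-monoʳ-≤ N₁ (m≤m+n _ (budget N₁ j (N₁ * M))))) enough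

    -- `High` has room for ρ parts only: ρ parts rule out about (ρ A / N₁) y vertices, while `High`
    -- is only known to contain about (s A + B) y / N₁, which is less as B < A. In Y itself about (B
    -- / N₁) y vertices survive.
    tile-in : ∀ (High : VSet n) t → High ⊆ Y → (∀ v → v ∈ High → Joined v) → 1 ≤ t →
      s * ((2 + A) * y) + N₁ * budget N₁ ρ (N₁ * (A * t)) ≤ N₁ * # High →
      ρ * ((2 + A) * y) + N₁ * (2 ^ (ρ * (N₁ * (A * t))) * (A * t)) ≤ N₁ * y →
      ∃ λ (Q : Tile t) → ∀ k → parts Q k ⊆ Y
    tile-in High t High⊆Y joined 1≤t enough enough′ = finish
      (extend (A * t) Y 1≤N₁ (λ _ z → z) (*-mono-≤ 1≤A 1≤t)
        (families High 1≤N₁ High⊆Y joined ρ (N₁ * (A * t)) ≤-refl (*-mono-≤ 1≤N₁ (*-mono-≤ 1≤A 1≤t)) enough) enough′)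
      where
      1≤A : 1 ≤ A
      1≤A = ≤-trans (s≤s z≤n) B<A
      1≤N₁ : 1 ≤ N₁
      1≤N₁ = ≤-trans 1≤A (≤-trans (m≤m+n A (s * A)) (m≤m+n _ B))
      finish : (∃ λ (P : Fin r → VSet n) → Complete P × (∀ k → # (P k) ≡ A * t) ×
               P zero ⊆ Y × (∀ k v → v ∈ P (suc k) → Joined v)) → ∃ λ (Q : Tile t) → ∀ k → parts Q k ⊆ Y
      finish (P , complete , #P , P₀⊆ , P₊) =
        -- All parts have A t vertices, so any of them could be cut down to B t.
        record { parts = S ; special = zero ; card = #S ; complete = Complete-⊆ S⊆P complete } ,
        λ { zero v v∈ → P₀⊆ v (S⊆P zero v v∈) ; (suc k) v v∈ → proj₁ (P₊ k v (S⊆P (suc k) v v∈)) }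
        where
        enoughₖ : ∀ k → size zero k * t ≤ # (P k)
        enoughₖ k = ≤-trans (*-monoˡ-≤ t (size≤A k)) (≤-reflexive (sym (#P k)))
          where
          size≤A : ∀ k → size zero k ≤ A
          size≤A zero    = <⇒≤ B<A
          size≤A (suc k) = ≤-refl
        S : Fin r → VSet n
        S k = proj₁ (choose-subset (P k) (size zero k * t) (enoughₖ k))
        S⊆P : ∀ k → S k ⊆ P k
        S⊆P k = proj₁ (proj₂ (choose-subset (P k) (size zero k * t) (enoughₖ k)))
        #S : ∀ k → # (S k) ≡ size zero k * t
        #S k = proj₂ (proj₂ (choose-subset (P k) (size zero k * t) (enoughₖ k)))

  -- Estimates

  -- In this order: vertices on new tiles, rounding to levels, the few neighbours in poor parts, the
  -- `bad` tiles that the vertex could improve, and the margin A t in `low`.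
  error-terms : (A B N Nc e p w bad T t : ℕ) → ℕ
  error-terms A B N Nc e p w bad T t =
    A * ((A + B) * Nc) + N * (B * e) + A * (N * (p * w)) + A * (N * (bad * ((A + B) * T))) + A * (N * (B * (t * p)))

  -- The weighted sum of the hypotheses is an equation up to the slack; the coefficients come from
  -- eliminating everything but mY, the number of free non-neighbours.
  missing-low : ∀ A B N mY mO miss l e p λₗ bad T′ t Nc y s w →
    mO + mY ≤ miss →
    N * (A * miss) + B * (N * (e * l)) ≤ (A + B) * (A * (p * (N * (t + T′)) + Nc + y)) →
    p * ((A + B) * (t + T′)) ≤ mO + p * w + λₗ * (B * (t + T′)) + bad * ((A + B) * (t + T′)) →
    λₗ * (A * T′) + s ≤ suc l * e →
    A * y ≤ N * s →
    λₗ ≤ p →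
    A * (N * mY) ≤ A * (A * y) + error-terms A B N Nc e p w bad (t + T′) t
  missing-low A B N mY mO miss l e p λₗ bad T′ t Nc y s w f₁ f₅ f₂ f₃ g λ≤p =
    ≤-by-certificate 0
      (+-mono-≤ (+-mono-≤ (+-mono-≤ (*-monoʳ-≤ (A * N) f₁) f₅) (*-monoʳ-≤ (A * N) f₂))
                (+-mono-≤ (+-mono-≤ (*-monoʳ-≤ (N * B) f₃) (*-monoʳ-≤ B g)) (*-monoʳ-≤ (A * (N * (B * t))) λ≤p)))
      (identity A B N mY mO miss l e p λₗ bad T′ t Nc y s w)
    where
    identity : ∀ A B N mY mO miss l e p λₗ bad T′ t Nc y s w →
      A * (N * mY) +
      (A * N * miss + (A + B) * (A * (p * (N * (t + T′)) + Nc + y))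
        + A * N * (mO + p * w + λₗ * (B * (t + T′)) + bad * ((A + B) * (t + T′)))
        + (N * B * ((1 + l) * e) + B * (N * s) + A * (N * (B * t)) * p)) + 0
      ≡ A * (A * y) + (A * ((A + B) * Nc) + N * (B * e) + A * (N * (p * w)) + A * (N * (bad * ((A + B) * (t + T′)))) + A * (N * (B * (t * p))))
      + (A * N * (mO + mY) + (N * (A * miss) + B * (N * (e * l)))
        + A * N * (p * ((A + B) * (t + T′)))
        + (N * B * (λₗ * (A * T′) + s) + B * (A * y) + A * (N * (B * t)) * λₗ))
    identity = solve-∀

  -- At the top level there is no bound on the vertices of no higher level. Instead all p tiles may
  -- count as low, which is affordable because e L is about (A / N) n.
  missing-top : ∀ A B N mY mO miss L e p λₗ bad T t Nc y w →
    mO + mY ≤ miss →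
    N * (A * miss) + B * (N * (e * L)) ≤ (A + B) * (A * (p * (N * T) + Nc + y)) →
    p * ((A + B) * T) ≤ mO + p * w + λₗ * (B * T) + bad * ((A + B) * T) →
    λₗ ≤ p →
    A * (p * (N * T) + Nc + y) ≤ N * (e * L) + N * L →
    L ≤ e →
    A * (N * mY) ≤ A * (A * y) + error-terms A B N Nc e p w bad T t
  missing-top A B N mY mO miss L e p λₗ bad T t Nc y w f₁ f₅ f₂ λ≤p top L≤e =
    ≤-by-certificate (A * (B * Nc) + A * (N * (B * (t * p))))
      (+-mono-≤ (+-mono-≤ (+-mono-≤ (*-monoʳ-≤ (A * N) f₁) f₅) (*-monoʳ-≤ (A * N) f₂))
                (+-mono-≤ (+-mono-≤ (*-monoʳ-≤ B top) (*-monoʳ-≤ (N * B) L≤e)) (*-monoʳ-≤ (A * (N * (B * T))) λ≤p)))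
      (identity A B N mY mO miss L e p λₗ bad T t Nc y w)
    where
    identity : ∀ A B N mY mO miss L e p λₗ bad T t Nc y w →
      A * (N * mY) +
      (A * N * miss + (A + B) * (A * (p * (N * T) + Nc + y))
        + A * N * (mO + p * w + λₗ * (B * T) + bad * ((A + B) * T))
        + (B * (N * (e * L) + N * L) + N * B * e + A * (N * (B * T)) * p)) + (A * (B * Nc) + A * (N * (B * (t * p))))
      ≡ A * (A * y) + (A * ((A + B) * Nc) + N * (B * e) + A * (N * (p * w)) + A * (N * (bad * ((A + B) * T))) + A * (N * (B * (t * p))))
      + (A * N * (mO + mY) + (N * (A * miss) + B * (N * (e * L)))
        + A * N * (p * ((A + B) * T))
        + (B * (A * (p * (N * T) + Nc + y)) + N * B * L + A * (N * (B * T)) * λₗ))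
    identity = solve-∀

  -- Each of the five terms is at most A n / (5 H), and n ≤ H y. The ratio 10 H A N of the scales
  -- comes from the third term, where 5 H times w = 2 A N t must be at most c₀ t.
  error-bound : ∀ A B N Nc e p bad t n y H → B ≤ A → 1 ≤ N → 1 ≤ H → n ≤ H * y →
    5 * H * ((A + B) * Nc) ≤ n →
    N * (e * (5 * H * B)) ≤ A * n →
    p * (N * (t + 10 * (H * (A * N)) * t)) ≤ n →
    5 * H * (A + B) * bad ≤ p →
    error-terms A B N Nc e p (A * N * t + A * N * t) bad (t + 10 * (H * (A * N)) * t) t ≤ A * y
  error-bound A B N Nc e p bad t n y H B≤A 1≤N 1≤H n≤ fN fe fp fb =
    *-cancelˡ-≤ (5 * H) {{>-nonZero (*-mono-≤ {1} {5} (s≤s z≤n) 1≤H)}} (begin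
      5 * H * (a₁ + a₂ + a₃ + a₄ + a₅)
        ≡⟨ distribute (5 * H) a₁ a₂ a₃ a₄ a₅ ⟩
      5 * H * a₁ + 5 * H * a₂ + 5 * H * a₃ + 5 * H * a₄ + 5 * H * a₅
        ≤⟨ +-mono-≤ (+-mono-≤ (+-mono-≤ (+-mono-≤ b₁ b₂) b₃) b₄) b₅ ⟩
      A * n + A * n + A * n + A * n + A * n
        ≡⟨ five (A * n) ⟩
      5 * (A * n)
        ≤⟨ *-monoʳ-≤ 5 (*-monoʳ-≤ A n≤) ⟩
      5 * (A * (H * y))
        ≡⟨ regroup A H y ⟩
      5 * H * (A * y) ∎)
    where
    open ≤-Reasoning
    c₀ T a₁ a₂ a₃ a₄ a₅ : ℕ
    c₀ = 10 * (H * (A * N))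
    T  = t + c₀ * t
    a₁ = A * ((A + B) * Nc)
    a₂ = N * (B * e)
    a₃ = A * (N * (p * (A * N * t + A * N * t)))
    a₄ = A * (N * (bad * ((A + B) * T)))
    a₅ = A * (N * (B * (t * p)))
    distribute : ∀ k a b c d e → k * (a + b + c + d + e) ≡ k * a + k * b + k * c + k * d + k * e
    distribute = solve-∀
    five : ∀ a → a + a + a + a + a ≡ 5 * a
    five = solve-∀
    regroup : ∀ a h y → 5 * (a * (h * y)) ≡ 5 * h * (a * y)
    regroup = solve-∀
    b₁ : 5 * H * a₁ ≤ A * n
    b₁ = ≤-trans (≤-reflexive (move H A ((A + B) * Nc))) (*-monoʳ-≤ A fN)
      where
      move : ∀ h a z → 5 * h * (a * z) ≡ a * (5 * h * z)
      move = solve-∀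
    b₂ : 5 * H * a₂ ≤ A * n
    b₂ = ≤-trans (≤-reflexive (move H N B e)) fe
      where
      move : ∀ h n b e → 5 * h * (n * (b * e)) ≡ n * (e * (5 * h * b))
      move = solve-∀
    tiles : A * (p * (N * (c₀ * t))) ≤ A * n
    tiles = *-monoʳ-≤ A (≤-trans (*-monoʳ-≤ p (*-monoʳ-≤ N (m≤n+m (c₀ * t) t))) fp)
    b₃ : 5 * H * a₃ ≤ A * n
    b₃ = ≤-trans (≤-reflexive (move H A N p t)) tiles
      where
      move : ∀ h a n p t → 5 * h * (a * (n * (p * (a * n * t + a * n * t)))) ≡ a * (p * (n * (10 * (h * (a * n)) * t)))
      move = solve-∀
    b₄ : 5 * H * a₄ ≤ A * n
    b₄ = begin
      5 * H * a₄  ≡⟨ move H A B N bad T ⟩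
      A * (5 * H * (A + B) * bad * (N * T))     ≤⟨ *-monoʳ-≤ A (≤-trans (*-monoˡ-≤ (N * T) fb) fp) ⟩
      A * n  ∎
      where
      move : ∀ h a b n z t → 5 * h * (a * (n * (z * ((a + b) * t)))) ≡ a * (5 * h * (a + b) * z * (n * t))
      move = solve-∀
    b₅ : 5 * H * a₅ ≤ A * n
    b₅ = begin
      5 * H * a₅  ≡⟨ move H A N B t p ⟩
      A * (p * (N * (5 * (H * B) * t)))         ≤⟨ *-monoʳ-≤ A (*-monoʳ-≤ p (*-monoʳ-≤ N (*-monoˡ-≤ t small))) ⟩
      A * (p * (N * (c₀ * t)))  ≤⟨ tiles ⟩
      A * n  ∎
      where
      move : ∀ h a n b t p → 5 * h * (a * (n * (b * (t * p)))) ≡ a * (p * (n * (5 * (h * b) * t)))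
      move = solve-∀
      small : 5 * (H * B) ≤ c₀
      small = *-mono-≤ {5} {10} (m≤m+n 5 5) (*-monoʳ-≤ H (≤-trans B≤A (m≤m*n A N {{>-nonZero 1≤N}})))

  joined-from-error : ∀ A N mY y E → 1 ≤ A → A * (N * mY) ≤ A * (A * y) + E → E ≤ A * y → N * mY ≤ suc A * y
  joined-from-error A N mY y E 1≤A h E≤ = *-cancelˡ-≤ A {{>-nonZero 1≤A}} (begin
    A * (N * mY)               ≤⟨ h ⟩
    A * (A * y) + E            ≤⟨ +-monoʳ-≤ (A * (A * y)) E≤ ⟩
    A * (A * y) + A * y        ≡⟨ rearrange A y ⟩
    A * (suc A * y)            ∎)
    where
    open ≤-Reasoning
    rearrange : ∀ a y → a * (a * y) + a * y ≡ a * (suc a * y)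
    rearrange = solve-∀

  -- N = ρ A + B, so the s (respectively ρ) parts already built leave at least (B - 2ρ) y over.
  room-high : ∀ s A B y hi lo b k → 2 * suc s + 2 ≤ B → y ≡ hi + lo →
    let N = suc s * A + B in N * lo ≤ A * y + N * k → N * (b + k) ≤ y → s * ((2 + A) * y) + N * b ≤ N * hi
  room-high s A B .(hi + lo) hi lo b k B≥ refl = subst
    (λ B → let N = suc s * A + B in N * lo ≤ A * (hi + lo) + N * k → N * (b + k) ≤ hi + lo → s * ((2 + A) * (hi + lo)) + N * b ≤ N * hi)
    (m+[n∸m]≡n B≥) λ fl fy → ≤-by-certificate ((3 + β) * (hi + lo)) (+-mono-≤ fl fy) (identity s A β hi lo b k)
    where
    β = B ∸ (2 * suc s + 2)
    identity : ∀ s A β hi lo b k →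
      s * ((2 + A) * (hi + lo)) + ((1 + s) * A + (2 * (1 + s) + 2 + β)) * b
        + (A * (hi + lo) + ((1 + s) * A + (2 * (1 + s) + 2 + β)) * k + (hi + lo)) + (3 + β) * (hi + lo)
      ≡ ((1 + s) * A + (2 * (1 + s) + 2 + β)) * hi
        + (((1 + s) * A + (2 * (1 + s) + 2 + β)) * lo + ((1 + s) * A + (2 * (1 + s) + 2 + β)) * (b + k))
    identity = solve-∀

  room-all : ∀ s A B y b → 2 * suc s + 2 ≤ B →
    let N = suc s * A + B in N * b ≤ y → suc s * ((2 + A) * y) + N * b ≤ N * y
  room-all s A B y b B≥ = subst
    (λ B → let N = suc s * A + B in N * b ≤ y → suc s * ((2 + A) * y) + N * b ≤ N * y)
    (m+[n∸m]≡n B≥) λ fy → ≤-by-certificate ((1 + β) * y) fy (identity s A β y b)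
    where
    β = B ∸ (2 * suc s + 2)
    identity : ∀ s A β y b → (1 + s) * ((2 + A) * y) + ((1 + s) * A + (2 * (1 + s) + 2 + β)) * b + y + (1 + β) * y
      ≡ ((1 + s) * A + (2 * (1 + s) + 2 + β)) * y + ((1 + s) * A + (2 * (1 + s) + 2 + β)) * b
    identity = solve-∀

  -- Levels, and one improvement of a tiling with two scales

  module _ {n : ℕ} (G : Graph n) where

    non-neighbours : Fin n → ℕ
    non-neighbours v = # (λ u → not (adj G v u))

    -- ℓ coarsens the rank of a vertex in the degree sequence to L levels, each merging `width` ranks,
    -- so that swapping vertices of different levels gains a constant amount of potential.
    record Levelling (N A B L : ℕ) : Set where
      field
        ℓ            : Fin n → ℕ
        ℓ≤L          : ∀ v → ℓ v ≤ L
        width        : ℕ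
        L≤width      : L ≤ width
        width-upper  : N * (width * L) ≤ A * n
        width-lower  : A * n ≤ N * (width * L) + N * L
        by-level     : ∀ v → N * (A * non-neighbours v) + B * (N * (width * ℓ v)) ≤ (A + B) * (A * n)
        few-below    : ∀ l → l < L → # (λ v → not ⌊ l <? ℓ v ⌋) ≤ suc l * width

    outside-total : ∀ (P : VSet n) f g (Q : VSet n) → (∀ v → f v + g v + 𝟙 (Q v) ≡ 1) →
                    outside P f + # (Q ∖ P) ≤ # (λ v → not (P v))
    outside-total P f g Q total = begin
      outside P f + # (Q ∖ P)  ≤⟨ +-monoˡ-≤ (# (Q ∖ P)) (m≤m+n (outside P f) (outside P g)) ⟩
      outside P f + outside P g + # (Q ∖ P)  ≡⟨ cong₂ _+_ (outside-+ P f g) (outside-set P Q) ⟨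
      outside P (λ v → f v + g v) + outside P (𝟙 ∘ Q)      ≡⟨ outside-+ P (λ v → f v + g v) (𝟙 ∘ Q) ⟨
      outside P (λ v → f v + g v + 𝟙 (Q v))  ≡⟨ sum-cong-≗ (λ v → trans (cong (_* 𝟙 (not (P v))) (total v)) (*-identityˡ _)) ⟩
      # (λ v → not (P v))  ∎
      where open ≤-Reasoning

  part-count : ℕ → ℕ → ℕ → ℕ
  part-count s A B = suc s * A + B

  module Step {n : ℕ} (G : Graph n) (s A B H : ℕ) (B<A : B < A) (1≤H : 1 ≤ H) (B≥ : 2 * suc s + 2 ≤ B)
              (𝓛 : Levelling G (part-count s A B) A B (5 * H * B)) (t : ℕ) (1≤t : 1 ≤ t) where

    open Levelling 𝓛
    open Tiling G s A B

    L c₀ F : ℕ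
    L  = 5 * H * B
    c₀ = 10 * (H * (A * N₁))
    F  = 5 * H * (A + B)

    open Improvement G s A B B<A ℓ L
    open Obstruction G s A B B<A ℓ L ℓ≤L c₀ t 1≤t

    -- Within a phase only `old` tiles are examined. The `new` ones are too small to be improved at
    -- scale `t` again; they count as an error and must stay few.
    record State : Set where
      field
        old   : List (Tile T)
        new   : List (Tile t)
        valid : ∀ v → occs old v + occs new v ≤ 1

    open State

    free : State → VSet n
    free S v = ⌊ occs (old S) v + occs (new S) v ≟ 0 ⌋

    potential : State → ℕ
    potential S = W (occs (old S)) + W (occs (new S))

    covered-or-free : ∀ S v → occs (old S) v + occs (new S) v + 𝟙 (free S v) ≡ 1
    covered-or-free S v = cases (occs (old S) v + occs (new S) v) (valid S v)
      where
      cases : ∀ m → m ≤ 1 → m + 𝟙 ⌊ m ≟ 0 ⌋ ≡ 1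
      cases zero          _ = refl
      cases (suc zero)    _ = refl
      cases (suc (suc m)) (s≤s ())

    order : ∀ S → n ≡ length (old S) * (N₁ * T) + length (new S) * (N₁ * t) + # (free S)
    order S = begin
      n  ≡⟨ trans (sum-const n 1) (*-identityʳ n) ⟨
      sum {n} (λ _ → 1)  ≡⟨ sum-cong-≗ (covered-or-free S) ⟨
      sum (λ v → occs (old S) v + occs (new S) v + 𝟙 (free S v))           ≡⟨ ∑-distrib-+ (λ v → occs (old S) v + occs (new S) v) (𝟙 ∘ free S) ⟩
      sum (λ v → occs (old S) v + occs (new S) v) + # (free S)             ≡⟨ cong (_+ # (free S)) (∑-distrib-+ (occs (old S)) (occs (new S))) ⟩
      sum (occs (old S)) + sum (occs (new S)) + # (free S)  ≡⟨ cong (_+ # (free S)) (cong₂ _+_ (sum-occs (old S)) (sum-occs (new S))) ⟩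
      length (old S) * (N₁ * T) + length (new S) * (N₁ * t) + # (free S)   ∎
      where open ≡-Reasoning

    -- The factor H turns a requirement on the number of free vertices into one on n, as n ≤ H times
    -- that number. The three summands serve the ρ parts in `High`, the vertices that are not
    -- `good`, and the last part.
    threshold : ℕ
    threshold = H * (N₁ * (budget N₁ ρ (N₁ * (A * t)) + F * K⁺ + 2 ^ (ρ * (N₁ * (A * t))) * (A * t)))

    Better : State → Set
    Better S = ∃ λ S′ → length (new S′) ≤ suc c₀ + N₁ + length (new S) × potential S + t ≤ potential S′

    e₀≤ : e₀ ≤ suc c₀
    e₀≤ = ≤-trans (+-monoˡ-≤ B (m≤n+m (s * A) A)) (≤-trans (≤-trans (m≤n*m N₁ A {{>-nonZero 1≤A}})
      (m≤n*m (A * N₁) H {{>-nonZero 1≤H}})) (≤-trans (m≤n*m (H * (A * N₁)) 10) (n≤1+n c₀)))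

    use-tile : ∀ S → (∃ λ (Q : Tile T) → ∃ λ (Rs : List (Tile T)) → K⁺ < # (free S ∩ useful Q) ×
               (∀ v → occs (old S) v ≡ occ Q v + occs Rs v)) → Better S
    use-tile S (Q , Rs , many , split) = finish (improve Q (free S) e₀≤ many)
      where
      finish : Improved (suc c₀ + N₁) t Q (free S) → Better S
      finish (ts , Z , D , len , Z⊆ , balance , gain) =
        record { old = Rs ; new = ts ++ new S ; valid = λ v → +-cancelʳ-≤ (𝟙 (D v)) _ 1 (fits v) } ,
        ≤-trans (≤-reflexive (length-++ ts)) (+-monoˡ-≤ (length (new S)) len) , +-cancelʳ-≤ (W (𝟙 ∘ D)) _ _ better
        where
        open ≤-Reasoning
        exchange : ∀ v → occs Rs v + occs (ts ++ new S) v + 𝟙 (D v) ≡ occs (old S) v + occs (new S) v + 𝟙 (Z v)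
        exchange v = begin-equality
          occs Rs v + occs (ts ++ new S) v + 𝟙 (D v)            ≡⟨ cong (λ z → occs Rs v + z + 𝟙 (D v)) (occs-++ ts (new S) v) ⟩
          occs Rs v + (occs ts v + occs (new S) v) + 𝟙 (D v)    ≡⟨ shuffle₁ (occs Rs v) (occs ts v) (occs (new S) v) (𝟙 (D v)) ⟩
          occs Rs v + occs (new S) v + (occs ts v + 𝟙 (D v))    ≡⟨ cong (occs Rs v + occs (new S) v +_) (balance v) ⟩
          occs Rs v + occs (new S) v + (occ Q v + 𝟙 (Z v))      ≡⟨ shuffle₂ (occs Rs v) (occs (new S) v) (occ Q v) (𝟙 (Z v)) ⟩
          occ Q v + occs Rs v + occs (new S) v + 𝟙 (Z v)        ≡⟨ cong (λ z → z + occs (new S) v + 𝟙 (Z v)) (split v) ⟨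
          occs (old S) v + occs (new S) v + 𝟙 (Z v)             ∎
          where
          shuffle₁ : ∀ a b c d → a + (b + c) + d ≡ a + c + (b + d)
          shuffle₁ = solve-∀
          shuffle₂ : ∀ a b c d → a + b + (c + d) ≡ c + a + b + d
          shuffle₂ = solve-∀
        fits : ∀ v → occs Rs v + occs (ts ++ new S) v + 𝟙 (D v) ≤ 1 + 𝟙 (D v)
        fits v = begin
          occs Rs v + occs (ts ++ new S) v + 𝟙 (D v)           ≡⟨ exchange v ⟩
          occs (old S) v + occs (new S) v + 𝟙 (Z v)            ≤⟨ +-monoʳ-≤ _ (𝟙-mono (Z⊆ v)) ⟩
          occs (old S) v + occs (new S) v + 𝟙 (free S v)       ≡⟨ covered-or-free S v ⟩
          1  ≤⟨ m≤m+n 1 _ ⟩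
          1 + 𝟙 (D v)  ∎
        better : W (occs (old S)) + W (occs (new S)) + t + W (𝟙 ∘ D) ≤ W (occs Rs) + W (occs (ts ++ new S)) + W (𝟙 ∘ D)
        better = begin
          W (occs (old S)) + W (occs (new S)) + t + W (𝟙 ∘ D)
            ≡⟨ shuffle (W (occs (old S)) + W (occs (new S))) t (W (𝟙 ∘ D)) ⟩
          W (occs (old S)) + W (occs (new S)) + (W (𝟙 ∘ D) + t)
            ≤⟨ +-monoʳ-≤ _ gain ⟩
          W (occs (old S)) + W (occs (new S)) + W (𝟙 ∘ Z)
            ≡⟨ cong (_+ W (𝟙 ∘ Z)) (W-distrib-+ (occs (old S)) (occs (new S))) ⟨
          W (λ v → occs (old S) v + occs (new S) v) + W (𝟙 ∘ Z)
            ≡⟨ W-distrib-+ (λ v → occs (old S) v + occs (new S) v) (𝟙 ∘ Z) ⟨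
          W (λ v → occs (old S) v + occs (new S) v + 𝟙 (Z v))
            ≡⟨ W-cong exchange ⟨
          W (λ v → occs Rs v + occs (ts ++ new S) v + 𝟙 (D v))
            ≡⟨ W-distrib-+ (λ v → occs Rs v + occs (ts ++ new S) v) (𝟙 ∘ D) ⟩
          W (λ v → occs Rs v + occs (ts ++ new S) v) + W (𝟙 ∘ D)
            ≡⟨ cong (_+ W (𝟙 ∘ D)) (W-distrib-+ (occs Rs) (occs (ts ++ new S))) ⟩
          W (occs Rs) + W (occs (ts ++ new S)) + W (𝟙 ∘ D) ∎
          where
          shuffle : ∀ a b c → a + b + c ≡ a + (c + b)
          shuffle = solve-∀

    add-tile : ∀ S → (∃ λ (Q : Tile t) → ∀ k → parts Q k ⊆ free S) → Better S
    add-tile S (Q , Q⊆) =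
      record { old = old S ; new = Q ∷ new S ; valid = fits } ,
      +-monoˡ-≤ (length (new S)) (s≤s z≤n) , better
      where
      open ≤-Reasoning
      disjoint : ∀ v i j → i ≢ j → v ∈ parts Q i → v ∈ parts Q j → ⊥
      disjoint v i j i≢j v∈i v∈j = true≢false (complete Q i≢j v∈i v∈j) (loopless G v)
      occ≤free : ∀ v → occ Q v ≤ 𝟙 (free S v)
      occ≤free v = cases (free S v) refl
        where
        cases : ∀ b → free S v ≡ b → occ Q v ≤ 𝟙 b
        cases true  _ = sum-𝟙≤1 (λ i → parts Q i v) (disjoint v)
        cases false e = ≤-reflexive (sum-≡0 (λ i → cong 𝟙 (¬true⇒false (λ v∈ → true≢false (Q⊆ i v v∈) e))))
      shuffle : ∀ a b c → a + (b + c) ≡ a + c + b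
      shuffle = solve-∀
      fits : ∀ v → occs (old S) v + (occ Q v + occs (new S) v) ≤ 1
      fits v = begin
        occs (old S) v + (occ Q v + occs (new S) v)        ≡⟨ shuffle (occs (old S) v) (occ Q v) (occs (new S) v) ⟩
        occs (old S) v + occs (new S) v + occ Q v          ≤⟨ +-monoʳ-≤ _ (occ≤free v) ⟩
        occs (old S) v + occs (new S) v + 𝟙 (free S v)     ≡⟨ covered-or-free S v ⟩
        1  ∎
      t≤W : t ≤ W (occ Q)
      t≤W = begin
        t  ≤⟨ m≤n*m t N₁ {{>-nonZero 1≤N₁}} ⟩
        N₁ * t            ≡⟨ sum-occ Q ⟨
        sum (occ Q)       ≤⟨ sum-mono (λ v → m≤n*m (occ Q v) (wt v) {{>-nonZero (≤-trans (m≤n+m 1 _) (C≤wt v))}}) ⟩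
        W (occ Q)         ∎
      better : W (occs (old S)) + W (occs (new S)) + t ≤ W (occs (old S)) + W (occs (Q ∷ new S))
      better = begin
        W (occs (old S)) + W (occs (new S)) + t             ≤⟨ +-monoʳ-≤ _ t≤W ⟩
        W (occs (old S)) + W (occs (new S)) + W (occ Q)     ≡⟨ shuffle (W (occs (old S))) (W (occ Q)) (W (occs (new S))) ⟨
        W (occs (old S)) + (W (occ Q) + W (occs (new S)))   ≡⟨ cong (W (occs (old S)) +_) (W-distrib-+ (occ Q) (occs (new S))) ⟨
        W (occs (old S)) + W (occs (Q ∷ new S))             ∎
    module Few (S : State) (n≤Hy : n ≤ H * # (free S))
               (few-new : 5 * H * ((A + B) * (length (new S) * (N₁ * t))) ≤ n) (large : threshold ≤ n)
               (few : All (λ Q → # (free S ∩ useful Q) ≤ K⁺) (old S)) where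

      Y : VSet n
      Y = free S

      open Cliques G s A B B<A Y
      open ≤-Reasoning

      p Nc : ℕ
      p  = length (old S)
      Nc = length (new S) * (N₁ * t)

      -- A vertex is `good` if it could improve at most p / F of the old tiles. The second
      -- alternative in `above` is the hypothesis of `missing-low` on the number of free vertices of
      -- no higher level; the first leads to `missing-top`.
      good above High : VSet n
      good  x = ⌊ F * uses (old S) x ≤? p ⌋
      above x = ⌊ (L ≤? ℓ x) ⊎-dec (A * y ≤? N₁ * # (Y ∖ Higher (ℓ x))) ⌋
      High = Y ∩ (good ∩ above)

      errors : ∀ x → x ∈ good → error-terms A B N₁ Nc width p (R + R) (uses (old S) x) T t ≤ A * y
      errors x x∈ = error-bound A B N₁ Nc width p (uses (old S) x) t n y H (<⇒≤ B<A) 1≤N₁ 1≤H n≤Hy few-new width-upper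
        (≤-trans (≤-trans (m≤m+n _ Nc) (m≤m+n _ y)) (≤-reflexive (sym (order S)))) (⌊⌋-sound (F * uses (old S) x ≤? p) x∈)

      level-bound : ∀ x → N₁ * (A * non-neighbours G x) + B * (N₁ * (width * ℓ x)) ≤ (A + B) * (A * (p * (N₁ * T) + Nc + y))
      level-bound x = subst (λ m → N₁ * (A * non-neighbours G x) + B * (N₁ * (width * ℓ x)) ≤ (A + B) * (A * m)) (order S) (by-level x)

      split-missing : ∀ x → outside (adj G x) (occs (old S)) + # (Y ∖ adj G x) ≤ non-neighbours G x
      split-missing x = outside-total G (adj G x) (occs (old S)) (occs (new S)) Y (covered-or-free S)

      joined-top : ∀ x → x ∈ good → ℓ x ≡ L → N₁ * # (Y ∖ adj G x) ≤ suc A * y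
      joined-top x x∈ e = joined-from-error A N₁ (# (Y ∖ adj G x)) y _ 1≤A
        (missing-top A B N₁ (# (Y ∖ adj G x)) (outside (adj G x) (occs (old S))) (non-neighbours G x) L width p
          (lows (ℓ x) (old S)) (uses (old S) x) T t Nc y (R + R)
          (split-missing x)
          (subst (λ l → N₁ * (A * non-neighbours G x) + B * (N₁ * (width * l)) ≤ (A + B) * (A * (p * (N₁ * T) + Nc + y))) e (level-bound x))
          (non-neighbours-in-tiles (old S) x)
          (lows≤length (ℓ x) (old S))
          (subst (λ m → A * m ≤ N₁ * (width * L) + N₁ * L) (order S) width-lower)
          L≤width)
        (errors x x∈)

      joined-low : ∀ x → x ∈ good → ℓ x < L → A * y ≤ N₁ * # (Y ∖ Higher (ℓ x)) → N₁ * # (Y ∖ adj G x) ≤ suc A * y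
      joined-low x x∈ l<L many = joined-from-error A N₁ (# (Y ∖ adj G x)) y _ 1≤A
        (missing-low A B N₁ (# (Y ∖ adj G x)) (outside (adj G x) (occs (old S))) (non-neighbours G x) l width p
          (lows l (old S)) (uses (old S) x) (c₀ * t) t Nc y (# (Y ∖ Higher l)) (R + R)
          (split-missing x) (level-bound x) (non-neighbours-in-tiles (old S) x)
          (begin
            lows l (old S) * (A * (c₀ * t)) + # (Y ∖ Higher l)     ≤⟨ +-monoˡ-≤ _ (lows-bound l (old S)) ⟩
            outside (Higher l) (occs (old S)) + # (Y ∖ Higher l)   ≤⟨ outside-total G (Higher l) (occs (old S)) (occs (new S)) Y (covered-or-free S) ⟩
            # (λ v → not (Higher l v))  ≤⟨ few-below l l<L ⟩
            suc l * width  ∎)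
          many (lows≤length l (old S)))
        (errors x x∈)
        where
        l = ℓ x

      high-joined : ∀ x → x ∈ High → Joined x
      high-joined x x∈ = proj₁ x∈′ , by-cases (L ≤? ℓ x) (⌊⌋-sound ((L ≤? ℓ x) ⊎-dec (A * y ≤? N₁ * # (Y ∖ Higher (ℓ x)))) (proj₂ x∈″))
        where
        x∈′ = ∩⁻ Y (good ∩ above) x x∈
        x∈″ = ∩⁻ good above x (proj₂ x∈′)
        by-cases : Dec (L ≤ ℓ x) → L ≤ ℓ x ⊎ A * y ≤ N₁ * # (Y ∖ Higher (ℓ x)) → N₁ * # (Y ∖ adj G x) ≤ suc A * y
        by-cases (yes h) _        = joined-top x (proj₁ x∈″) (≤-antisym (ℓ≤L x) h)
        by-cases (no ¬h) (inj₁ h) = ⊥-elim (¬h h)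
        by-cases (no ¬h) (inj₂ g) = joined-low x (proj₁ x∈″) (≰⇒> ¬h) g

      few-not-good : # (Y ∖ good) ≤ F * K⁺
      -- There may be no old tiles, so p + 1 is cancelled rather than p.
      few-not-good = *-cancelʳ-≤ (# (Y ∖ good)) (F * K⁺) (suc p) (begin
        # (Y ∖ good) * suc p  ≤⟨ markov (Y ∖ good) (λ x → F * (𝟙 (Y x) * uses (old S) x)) (suc p) often ⟩
        sum (λ x → F * (𝟙 (Y x) * uses (old S) x))       ≡⟨ *-distribˡ-sum F (λ x → 𝟙 (Y x) * uses (old S) x) ⟨
        F * sum (λ x → 𝟙 (Y x) * uses (old S) x)         ≤⟨ *-monoʳ-≤ F (sum-uses Y (old S) few) ⟩
        F * (p * K⁺)  ≡⟨ rearrange F p K⁺ ⟩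
        F * K⁺ * p  ≤⟨ *-monoʳ-≤ (F * K⁺) (n≤1+n p) ⟩
        F * K⁺ * suc p  ∎)
        where
        rearrange : ∀ a b c → a * (b * c) ≡ a * c * b
        rearrange = solve-∀
        often : ∀ x → x ∈ Y ∖ good → suc p ≤ F * (𝟙 (Y x) * uses (old S) x)
        often x x∈ = begin
          suc p  ≤⟨ ≰⇒> (⌊⌋-false (F * uses (old S) x ≤? p) (proj₂ (∖⁻ Y good x x∈))) ⟩
          F * uses (old S) x  ≡⟨ cong (F *_) (*-identityˡ (uses (old S) x)) ⟨
          F * (1 * uses (old S) x)             ≡⟨ cong (λ b → F * (𝟙 b * uses (old S) x)) (proj₁ (∖⁻ Y good x x∈)) ⟨
          F * (𝟙 (Y x) * uses (old S) x)       ∎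

      -- Take a vertex `v` of highest level among those in question. All the others are of no higher
      -- level, and as `v` itself fails to be `above`, there are fewer than A y / N₁ of these.
      few-not-above : N₁ * # (Y ∖ above) ≤ A * y
      few-not-above = by-cases (argmax (Y ∖ above) ℓ)
        where
        by-cases : (∀ v → (Y ∖ above) v ≡ false) ⊎ (∃ λ v → v ∈ Y ∖ above × (∀ u → u ∈ Y ∖ above → ℓ u ≤ ℓ v)) →
                   N₁ * # (Y ∖ above) ≤ A * y
        by-cases (inj₁ none) = begin
          N₁ * # (Y ∖ above)     ≡⟨ cong (N₁ *_) (sum-≡0 (λ v → cong 𝟙 (none v))) ⟩
          N₁ * 0  ≡⟨ *-zeroʳ N₁ ⟩
          0  ≤⟨ z≤n ⟩
          A * y  ∎
        by-cases (inj₂ (v , v∈ , max)) = begin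
          N₁ * # (Y ∖ above)             ≤⟨ *-monoʳ-≤ N₁ (#-mono below) ⟩
          N₁ * # (Y ∖ Higher (ℓ v))      ≤⟨ <⇒≤ (≰⇒> (λ h → ⌊⌋-false ((L ≤? ℓ v) ⊎-dec (A * y ≤? N₁ * # (Y ∖ Higher (ℓ v)))) (proj₂ (∖⁻ Y above v v∈)) (inj₂ h))) ⟩
          A * y  ∎
          where
          below : Y ∖ above ⊆ Y ∖ Higher (ℓ v)
          below u u∈ = ∧-true⁺ (∖⊆ Y above u u∈)
            (cong not (¬true⇒false (λ h → <⇒≱ (⌊⌋-sound (ℓ v <? ℓ u) h) (max u u∈))))

      few-not-high : N₁ * # (Y ∖ High) ≤ A * y + N₁ * (F * K⁺)
      few-not-high = begin
        N₁ * # (Y ∖ High)  ≤⟨ *-monoʳ-≤ N₁ (≤-trans (sum-mono (λ x → pointwise (Y x) (good x) (above x)))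
                                                       (≤-reflexive (∑-distrib-+ (𝟙 ∘ (Y ∖ above)) (𝟙 ∘ (Y ∖ good))))) ⟩
        N₁ * (# (Y ∖ above) + # (Y ∖ good))        ≡⟨ *-distribˡ-+ N₁ (# (Y ∖ above)) _ ⟩
        N₁ * # (Y ∖ above) + N₁ * # (Y ∖ good)     ≤⟨ +-mono-≤ few-not-above (*-monoʳ-≤ N₁ few-not-good) ⟩
        A * y + N₁ * (F * K⁺)  ∎
        where
        pointwise : ∀ a b c → 𝟙 (a ∧ not (a ∧ (b ∧ c))) ≤ 𝟙 (a ∧ not c) + 𝟙 (a ∧ not b)
        pointwise false _     _     = z≤n
        pointwise true  true  true  = z≤n
        pointwise true  true  false = ≤-refl
        pointwise true  false true  = ≤-refl
        pointwise true  false false = s≤s z≤n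

      tile-in-free : ∃ λ (Q : Tile t) → ∀ k → parts Q k ⊆ Y
      tile-in-free = tile-in High t (∩⊆ˡ Y (good ∩ above)) high-joined 1≤t
        (room-high s A B y (# High) (# (Y ∖ High)) b₁ (F * K⁺) B≥ (#-∖ (∩⊆ˡ Y (good ∩ above))) few-not-high
          (≤-trans (*-monoʳ-≤ N₁ (m≤m+n (b₁ + F * K⁺) b₂)) room))
        (room-all s A B y b₂ B≥ (≤-trans (*-monoʳ-≤ N₁ (m≤n+m b₂ (b₁ + F * K⁺))) room))
        where
        b₁ b₂ : ℕ
        b₁ = budget N₁ ρ (N₁ * (A * t))
        b₂ = 2 ^ (ρ * (N₁ * (A * t))) * (A * t)
        room : N₁ * (b₁ + F * K⁺ + b₂) ≤ y
        room = *-cancelˡ-≤ H {{>-nonZero 1≤H}} (≤-trans large n≤Hy)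

    step : ∀ S → n ≤ H * # (free S) → 5 * H * ((A + B) * (length (new S) * (N₁ * t))) ≤ n → threshold ≤ n → Better S
    step S n≤Hy few-new large = by-cases (search (free S) (old S))
      where
      by-cases : All (λ Q → # (free S ∩ useful Q) ≤ K⁺) (old S) ⊎
        (∃ λ (Q : Tile T) → ∃ λ (Rs : List (Tile T)) → K⁺ < # (free S ∩ useful Q) × (∀ v → occs (old S) v ≡ occ Q v + occs Rs v)) → Better S
      by-cases (inj₁ few)  = add-tile S (Few.tile-in-free S n≤Hy few-new large few)
      by-cases (inj₂ tile) = use-tile S tile

  -- Iterating the step

  -- These constants repeat those of `Step` in terms of the parameters alone, because n₀ is fixed
  -- before the graph is given.
  subdivision : (s A B H : ℕ) → ℕ
  subdivision s A B H = suc (10 * (H * (A * part-count s A B)))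

  growth : (s A B H : ℕ) → ℕ
  growth s A B H = subdivision s A B H + part-count s A B

  -- One more than `scale` times C + L: a phase gains at least n / `scale`, and the potential never
  -- exceeds (C + L) n.
  rounds-needed : (s A B H : ℕ) → ℕ
  rounds-needed s A B H = suc (10 * H * ((A + B) * (growth s A B H * part-count s A B)) *
    (5 * H * B * (B * (s * A + B)) + 1 + 5 * H * B))

  -- One step creates at most `growth` new tiles, so as long as j * `quota` ≤ n the new tiles of j
  -- steps are few enough for `step`.
  quota : (s A B H t : ℕ) → ℕ
  quota s A B H t = 5 * H * ((A + B) * (growth s A B H * (part-count s A B * t)))

  -- Unfolds to `Step.threshold`.
  room-needed : (s A B H t : ℕ) → ℕ
  room-needed s A B H t = H * (N * (budget N (suc s) (N * (A * t)) + 5 * H * (A + B) * (suc (suc s) * (suc (5 * H * B) *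
      (2 ^ (N * (subdivision s A B H * t)) * (A * N * t)))) + 2 ^ (suc s * (N * (A * t))) * (A * t)))
    where
    N = part-count s A B

  module Phases {n : ℕ} (G : Graph n) (s A B H : ℕ) (B<A : B < A) (1≤H : 1 ≤ H) (B≥ : 2 * suc s + 2 ≤ B)
                (𝓛 : Levelling G (part-count s A B) A B (5 * H * B)) where

    open Levelling 𝓛
    open Tiling G s A B
    open Improvement G s A B B<A ℓ (5 * H * B)

    AlmostPerfect : Set
    AlmostPerfect = ∃ λ (ts : List (Tile 1)) → (∀ v → occs ts v ≤ 1) × H * # (λ v → ⌊ occs ts v ≟ 0 ⌋) ≤ n

    c g : ℕ
    c = subdivision s A B H
    g = growth s A B H

    scale : ℕ
    scale = 10 * H * ((A + B) * (g * N₁))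

    refine : ∀ t (Os : List (Tile (c * t))) (Ns : List (Tile t)) →
             ∃ λ (ts : List (Tile t)) → ∀ v → occs ts v ≡ occs Os v + occs Ns v
    refine t Os Ns = proj₁ (subdivide-all c t Os) ++ Ns , λ v →
      trans (occs-++ (proj₁ (subdivide-all c t Os)) Ns v) (cong (_+ occs Ns v) (proj₂ (subdivide-all c t Os) v))

    finest : ∀ t (ts : List (Tile t)) → ∃ λ (us : List (Tile 1)) → ∀ v → occs us v ≡ occs ts v
    finest t ts = proj₁ (subdivide-all t 1 (proj₁ (cast (*-identityʳ t)))) ,
      λ v → trans (proj₂ (subdivide-all t 1 (proj₁ (cast (*-identityʳ t)))) v) (proj₂ (cast (*-identityʳ t)) v)
      where
      cast : ∀ {u} → u ≡ t → ∃ λ (us : List (Tile u)) → ∀ v → occs us v ≡ occs ts v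
      cast refl = ts , λ _ → refl

    module _ (t : ℕ) (1≤t : 1 ≤ t) where

      open Step G s A B H B<A 1≤H B≥ 𝓛 t 1≤t using (State; free; potential; step; threshold)
      open State

      finished : ∀ S → ¬ n ≤ H * # (free S) → AlmostPerfect
      finished S done = us , (λ v → subst (_≤ 1) (sym (same v)) (valid S v)) ,
        ≤-trans (≤-reflexive (cong (H *_) (sum-cong-≗ (λ v → cong (λ m → 𝟙 ⌊ m ≟ 0 ⌋) (same v))))) (<⇒≤ (≰⇒> done))
        where
        ts = proj₁ (refine t (old S) (new S))
        us = proj₁ (finest t ts)
        same : ∀ v → occs us v ≡ occs (old S) v + occs (new S) v
        same v = trans (proj₂ (finest t ts) v) (proj₂ (refine t (old S) (new S)) v)

      -- `j` bounds the steps already made in this phase and `m` is the number still to be made;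
      -- their sum is limited by the quota.
      steps : ∀ m j S → (j + m) * quota s A B H t ≤ n → threshold ≤ n → length (new S) ≤ j * g →
              AlmostPerfect ⊎ ∃ λ S′ → potential S + m * t ≤ potential S′
      steps zero    j S _   _     _   = inj₂ (S , ≤-reflexive (+-identityʳ _))
      steps (suc m) j S fit large len = by-cases (n ≤? H * # (free S))
        where
        by-cases : Dec (n ≤ H * # (free S)) → AlmostPerfect ⊎ ∃ λ S′ → potential S + suc m * t ≤ potential S′
        by-cases (no done)  = inj₁ (finished S done)
        by-cases (yes todo) = continue (step S todo little large)
          where
          open ≤-Reasoning
          little : 5 * H * ((A + B) * (length (new S) * (N₁ * t))) ≤ n
          little = begin
            5 * H * ((A + B) * (length (new S) * (N₁ * t)))  ≤⟨ *-monoʳ-≤ (5 * H) (*-monoʳ-≤ (A + B) (*-monoˡ-≤ (N₁ * t) len)) ⟩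
            5 * H * ((A + B) * (j * g * (N₁ * t)))           ≡⟨ rearrange (5 * H) (A + B) j g (N₁ * t) ⟩
            j * quota s A B H t  ≤⟨ *-monoˡ-≤ (quota s A B H t) (m≤m+n j (suc m)) ⟩
            (j + suc m) * quota s A B H t  ≤⟨ fit ⟩
            n  ∎
            where
            rearrange : ∀ a b j g z → a * (b * (j * g * z)) ≡ j * (a * (b * (g * z)))
            rearrange = solve-∀
          continue : (∃ λ S′ → length (new S′) ≤ g + length (new S) × potential S + t ≤ potential S′) →
                     AlmostPerfect ⊎ ∃ λ S′ → potential S + suc m * t ≤ potential S′
          continue (S′ , len′ , gain) = add (steps m (suc j) S′
              (subst (λ z → z * quota s A B H t ≤ n) (+-suc j m) fit) large
              (≤-trans len′ (+-monoʳ-≤ g len)))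
            where
            add : (AlmostPerfect ⊎ ∃ λ S″ → potential S′ + m * t ≤ potential S″) →
                  AlmostPerfect ⊎ ∃ λ S″ → potential S + suc m * t ≤ potential S″
            add (inj₁ done)         = inj₁ done
            add (inj₂ (S″ , gain′)) = inj₂ (S″ , (begin
              potential S + (t + m * t)    ≡⟨ +-assoc (potential S) t (m * t) ⟨
              potential S + t + m * t      ≤⟨ +-monoˡ-≤ (m * t) gain ⟩
              potential S′ + m * t         ≤⟨ gain′ ⟩
              potential S″  ∎))

      -- The quota is proportional to t and each step gains t, so the gain of about n / `scale` is
      -- the same at every scale. This is why boundedly many phases suffice.
      phase : ∀ (Os : List (Tile (c * t))) → (∀ v → occs Os v ≤ 1) → 1 ≤ quota s A B H t → quota s A B H t ≤ n → threshold ≤ n →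
              AlmostPerfect ⊎ ∃ λ (ts : List (Tile t)) → (∀ v → occs ts v ≤ 1) × scale * W (occs Os) + n ≤ scale * W (occs ts)
      phase Os ok 1≤q q≤n large = conclude (steps m 0 initial (m/n*n≤m n q) large z≤n)
        where
        open ≤-Reasoning
        q = quota s A B H t
        instance
          q≢0 = >-nonZero 1≤q
        m = n / q
        initial : State
        initial = record { old = Os ; new = [] ; valid = λ v → subst (_≤ 1) (sym (+-identityʳ _)) (ok v) }
        1≤m : 1 ≤ m
        1≤m = by-cases m refl
          where
          by-cases : ∀ k → m ≡ k → 1 ≤ k
          by-cases (suc k) _ = s≤s z≤n
          by-cases zero    e = ⊥-elim (<⇒≱ (m%n<n n q) (≤-trans q≤n (≤-reflexive
            (trans (m≡m%n+[m/n]*n n q) (trans (cong (λ z → n % q + z * q) e) (+-identityʳ _))))))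
        -- Rounding n / q down loses at most a factor 2, as m ≥ 1; it turns the 5 of `quota` into
        -- the 10 of `scale`.
        n≤ : n ≤ scale * (m * t)
        n≤ = begin
          n  ≡⟨ m≡m%n+[m/n]*n n q ⟩
          n % q + m * q         ≤⟨ +-monoˡ-≤ (m * q) (<⇒≤ (m%n<n n q)) ⟩
          q + m * q             ≤⟨ +-monoˡ-≤ (m * q) (m≤n*m q m {{>-nonZero 1≤m}}) ⟩
          m * q + m * q         ≡⟨ rearrange m H (A + B) g N₁ t ⟩
          scale * (m * t)       ∎
          where
          rearrange : ∀ m h a g n t → m * (5 * h * (a * (g * (n * t)))) + m * (5 * h * (a * (g * (n * t)))) ≡ 10 * h * (a * (g * n)) * (m * t)
          rearrange = solve-∀
        conclude : (AlmostPerfect ⊎ ∃ λ S → potential initial + m * t ≤ potential S) →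
          AlmostPerfect ⊎ ∃ λ (ts : List (Tile t)) → (∀ v → occs ts v ≤ 1) × scale * W (occs Os) + n ≤ scale * W (occs ts)
        conclude (inj₁ done)       = inj₁ done
        conclude (inj₂ (S , gain)) = inj₂ (ts , (λ v → subst (_≤ 1) (sym (same v)) (valid S v)) , (begin
          scale * W (occs Os) + n  ≤⟨ +-mono-≤ (*-monoʳ-≤ scale (m≤m+n (W (occs Os)) (W (occs {t} [])))) n≤ ⟩
          scale * potential initial + scale * (m * t) ≡⟨ *-distribˡ-+ scale (potential initial) (m * t) ⟨
          scale * (potential initial + m * t)        ≤⟨ *-monoʳ-≤ scale gain ⟩
          scale * potential S  ≡⟨ cong (scale *_) (trans (W-cong same) (W-distrib-+ (occs (old S)) (occs (new S)))) ⟨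
          scale * W (occs ts)  ∎))
          where
          ts = proj₁ (refine t (old S) (new S))
          same : ∀ v → occs ts v ≡ occs (old S) v + occs (new S) v
          same = proj₂ (refine t (old S) (new S))

    1≤q : ∀ t → 1 ≤ t → 1 ≤ quota s A B H t
    1≤q t 1≤t = *-mono-≤ (*-mono-≤ {1} {5} (s≤s z≤n) 1≤H) (*-mono-≤ (≤-trans 1≤A (m≤m+n A B))
      (*-mono-≤ {1} {g} (s≤s z≤n) (*-mono-≤ 1≤N₁ 1≤t)))

    -- The scale descends to 1, since a phase turns tiles of scale c t into tiles of scale t.
    phases : ∀ k (ts : List (Tile (c ^ k))) → (∀ v → occs ts v ≤ 1) →
             (∀ j → j < k → quota s A B H (c ^ j) + room-needed s A B H (c ^ j) ≤ n) →
             AlmostPerfect ⊎ ∃ λ (us : List (Tile 1)) → (∀ v → occs us v ≤ 1) × scale * W (occs ts) + k * n ≤ scale * W (occs us)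
    phases zero    ts ok _     = inj₂ (ts , ok , ≤-reflexive (+-identityʳ _))
    phases (suc k) ts ok large = continue (phase (c ^ k) 1≤cᵏ ts ok (1≤q (c ^ k) 1≤cᵏ)
        (≤-trans (m≤m+n _ _) (large k ≤-refl)) (≤-trans (m≤n+m _ _) (large k ≤-refl)))
      where
      1≤cᵏ : 1 ≤ c ^ k
      1≤cᵏ = m^n>0 c k
      continue : (AlmostPerfect ⊎ ∃ λ (us : List (Tile (c ^ k))) → (∀ v → occs us v ≤ 1) × scale * W (occs ts) + n ≤ scale * W (occs us)) →
        AlmostPerfect ⊎ ∃ λ (us : List (Tile 1)) → (∀ v → occs us v ≤ 1) × scale * W (occs ts) + suc k * n ≤ scale * W (occs us)
      continue (inj₁ done) = inj₁ done
      continue (inj₂ (us , ok′ , gain)) = add (phases k us ok′ (λ j j<k → large j (m≤n⇒m≤1+n j<k)))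
        where
        add : (AlmostPerfect ⊎ ∃ λ (vs : List (Tile 1)) → (∀ v → occs vs v ≤ 1) × scale * W (occs us) + k * n ≤ scale * W (occs vs)) →
          AlmostPerfect ⊎ ∃ λ (vs : List (Tile 1)) → (∀ v → occs vs v ≤ 1) × scale * W (occs ts) + suc k * n ≤ scale * W (occs vs)
        add (inj₁ done) = inj₁ done
        add (inj₂ (vs , ok″ , gain′)) = inj₂ (vs , ok″ ,
          ≤-trans (≤-reflexive (sym (+-assoc (scale * W (occs ts)) n (k * n)))) (≤-trans (+-monoˡ-≤ (k * n) gain) gain′))

    rounds : ℕ
    rounds = rounds-needed s A B H

    -- The empty tiling counts as one of scale c ^ `rounds`. If no phase ended early, the gains
    -- would exceed the weight of all vertices.
    almost-perfect : 1 ≤ n → (∀ j → j < rounds → quota s A B H (c ^ j) + room-needed s A B H (c ^ j) ≤ n) → AlmostPerfect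
    almost-perfect 1≤n large = by-cases (phases rounds [] (λ _ → z≤n) large)
      where
      open ≤-Reasoning
      by-cases : (AlmostPerfect ⊎ ∃ λ (us : List (Tile 1)) → (∀ v → occs us v ≤ 1) ×
        scale * W (occs {c ^ rounds} []) + rounds * n ≤ scale * W (occs us)) → AlmostPerfect
      by-cases (inj₁ done) = done
      by-cases (inj₂ (us , ok , gain)) = ⊥-elim (<⇒≱ (begin-strict
        scale * W (occs us)  ≤⟨ *-monoʳ-≤ scale bound ⟩
        scale * ((C + 5 * H * B) * n)               ≡⟨ *-assoc scale (C + 5 * H * B) n ⟨
        scale * (C + 5 * H * B) * n  <⟨ m<n+m _ 1≤n ⟩
        rounds * n  ∎) (≤-trans (m≤n+m (rounds * n) (scale * W (occs {c ^ rounds} []))) gain))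
        where
        bound : W (occs us) ≤ (C + 5 * H * B) * n
        bound = begin
          W (occs us)  ≤⟨ sum-mono (λ v → *-mono-≤ (wt≤ v) (ok v)) ⟩
          sum {n} (λ _ → (C + 5 * H * B) * 1)       ≡⟨ sum-const n _ ⟩
          n * ((C + 5 * H * B) * 1)  ≡⟨ rearrange n (C + 5 * H * B) ⟩
          (C + 5 * H * B) * n  ∎
          where
          rearrange : ∀ n z → n * (z * 1) ≡ z * n
          rearrange = solve-∀

  total-room : (s A B H k : ℕ) → ℕ
  total-room s A B H zero    = 1
  total-room s A B H (suc k) = quota s A B H (subdivision s A B H ^ k) + room-needed s A B H (subdivision s A B H ^ k) + total-room s A B H k

  1≤total-room : ∀ s A B H k → 1 ≤ total-room s A B H k
  1≤total-room s A B H zero    = ≤-refl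
  1≤total-room s A B H (suc k) = ≤-trans (1≤total-room s A B H k) (m≤n+m _ _)

  room≤total : ∀ s A B H k j → j < k → quota s A B H (subdivision s A B H ^ j) + room-needed s A B H (subdivision s A B H ^ j) ≤ total-room s A B H k
  room≤total s A B H (suc k) j (s≤s j≤k) with m≤n⇒m<n∨m≡n j≤k
  ... | inj₁ j<k  = ≤-trans (room≤total s A B H k j j<k) (m≤n+m _ _)
  ... | inj₂ refl = m≤m+n _ _

  size-needed : (s A B H : ℕ) → ℕ
  size-needed s A B H = total-room s A B H (rounds-needed s A B H)

  almost-perfect-tiling : ∀ s A B H → (B<A : B < A) → 1 ≤ H → 2 * suc s + 2 ≤ B →
    ∀ n → size-needed s A B H ≤ n → (G : Graph n) → Levelling G (part-count s A B) A B (5 * H * B) →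
    let open Tiling G s A B in
    ∃ λ (ts : List (Tile 1)) → (∀ v → occs ts v ≤ 1) × H * # (λ v → ⌊ occs ts v ≟ 0 ⌋) ≤ n
  almost-perfect-tiling s A B H B<A 1≤H B≥ n large G 𝓛 =
    Phases.almost-perfect G s A B H B<A 1≤H B≥ 𝓛
      (≤-trans (1≤total-room s A B H (rounds-needed s A B H)) large)
      (λ j j< → ≤-trans (room≤total s A B H (rounds-needed s A B H) j j<) large)

  -- Degree sequences

  length-filter-tabulate : ∀ {a p} {X : Set a} {P : Pred X p} (P? : Decidable P) {n} (f : Fin n → X) →
                           length (filter P? (tabulate f)) ≡ # (λ v → ⌊ P? (f v) ⌋)
  length-filter-tabulate P? {zero}  f = refl
  length-filter-tabulate P? {suc n} f with P? (f zero)
  ... | yes _ = cong suc (length-filter-tabulate P? (f ∘ suc))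
  ... | no  _ = length-filter-tabulate P? (f ∘ suc)

  length-filter-∷ : ∀ {a p} {X : Set a} {P : Pred X p} (P? : Decidable P) x xs →
                    length (filter P? (x ∷ xs)) ≤ suc (length (filter P? xs))
  length-filter-∷ P? x xs with P? x
  ... | yes _ = ≤-refl
  ... | no  _ = n≤1+n _

  -- Positions are counted from 0. Past the end `nth` is 0, below which there is nothing.
  nth-sorted : ∀ {xs} → AllPairs _≤_ xs → ∀ j → length (filter (_<? nth xs j) xs) ≤ j
  nth-sorted []                      j       = z≤n
  nth-sorted (_∷_ {x} {xs} x≤ _)     zero    = ≤-reflexive (cong length
    (filter-none (_<? x) {x ∷ xs} (<-irrefl refl ∷ All.map ≤⇒≯ x≤)))
  nth-sorted (_∷_ {x} {xs} x≤ pairs) (suc j) =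
    ≤-trans (length-filter-∷ (_<? nth xs j) x xs) (s≤s (nth-sorted pairs j))

  module _ {n : ℕ} (G : Graph n) where

    degree≡# : ∀ v → degree G v ≡ # (adj G v)
    degree≡# v = trans (length-filter-tabulate (λ u → T? (adj G v u)) id) (sum-cong-≗ (λ u → cong 𝟙 (decided (adj G v u))))
      where
      decided : ∀ b → ⌊ T? b ⌋ ≡ b
      decided true  = refl
      decided false = refl

    degree+non-neighbours : ∀ v → degree G v + non-neighbours G v ≡ n
    degree+non-neighbours v = begin
      degree G v + non-neighbours G v  ≡⟨ cong (_+ non-neighbours G v) (degree≡# v) ⟩
      # (adj G v) + # (λ u → not (adj G v u))         ≡⟨ #-split (λ _ → true) (adj G v) ⟨
      sum {n} (λ _ → 1)  ≡⟨ trans (sum-const n 1) (*-identityʳ n) ⟩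
      n  ∎
      where open ≡-Reasoning

    few-of-smaller-degree : ∀ i → # (λ v → ⌊ degree G v <? d G i ⌋) ≤ i ∸ 1
    few-of-smaller-degree i = begin
      # (λ v → ⌊ degree G v <? d G i ⌋)  ≡⟨ length-filter-tabulate (_<? d G i) (degree G) ⟨
      length (filter (_<? d G i) (tabulate (degree G)))              ≡⟨ cong (λ xs → length (filter (_<? d G i) xs)) (map-tabulate id (degree G)) ⟨
      length (filter (_<? d G i) (map (degree G) (allFin n)))        ≡⟨ ↭-length (filter-↭ (_<? d G i) (sort-↭ (map (degree G) (allFin n)))) ⟨
      length (filter (_<? d G i) (degreeSequence G))  ≤⟨ nth-sorted (Linked⇒AllPairs ≤-trans (sort-↗ (map (degree G) (allFin n)))) (i ∸ 1) ⟩
      i ∸ 1  ∎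
      where open ≤-Reasoning

    -- Cleared of denominators, n - d_i ≤ ((A + B) / N) n - (B / A) i, arranged so that nothing is
    -- subtracted.
    DegreeCondition : (N A B : ℕ) → Set
    DegreeCondition N A B = ∀ i → 1 ≤ i → N * i ≤ A * n → N * (A * n) + B * (N * i) ≤ N * (A * d G i) + (A + B) * (A * n)

    module _ (N A B L : ℕ) (1≤N : 1 ≤ N) (1≤A : 1 ≤ A) (1≤B : 1 ≤ B) (1≤L : 1 ≤ L)
             (large : N * (L * L) ≤ n) (condition : DegreeCondition N A B) where

      private
        NL≢0 : NonZero (N * L)
        NL≢0 = >-nonZero (*-mono-≤ 1≤N 1≤L)
        e : ℕ
        e = _/_ (A * n) (N * L) {{NL≢0}}
        e-upper : e * (N * L) ≤ A * n
        e-upper = m/n*n≤m (A * n) (N * L) {{NL≢0}}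
        L≤e : L ≤ e
        L≤e = begin
          L  ≡⟨ m*n/n≡m L (N * L) {{NL≢0}} ⟨
          _/_ (L * (N * L)) (N * L) {{NL≢0}}     ≤⟨ /-monoˡ-≤ (N * L) {{NL≢0}} fits ⟩
          e  ∎
          where
          open ≤-Reasoning
          fits : L * (N * L) ≤ A * n
          fits = ≤-trans (≤-reflexive (rearrange L N)) (≤-trans large (m≤n*m n A {{>-nonZero 1≤A}}))
            where
            rearrange : ∀ l n → l * (n * l) ≡ n * (l * l)
            rearrange = solve-∀
        1≤e : 1 ≤ e
        1≤e = ≤-trans 1≤L L≤e
        -- By `miss≤` this subtraction is never truncated.
        slack : Fin n → ℕ
        slack v = (A + B) * (A * n) ∸ N * (A * non-neighbours G v)
        unit : ℕ
        unit = B * (N * e)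
        unit≢0 : NonZero unit
        unit≢0 = >-nonZero (*-mono-≤ 1≤B (*-mono-≤ 1≤N 1≤e))
        quotient : Fin n → ℕ
        quotient v = _/_ (slack v) unit {{unit≢0}}

        miss-bound : ∀ v i → 1 ≤ i → N * i ≤ A * n → d G i ≤ degree G v →
                     N * (A * non-neighbours G v) + B * (N * i) ≤ (A + B) * (A * n)
        miss-bound v i 1≤i fits d≤ = +-cancelˡ-≤ (N * (A * degree G v)) _ _ (begin
          N * (A * degree G v) + (N * (A * non-neighbours G v) + B * (N * i))
            ≡⟨ rearrange N A (degree G v) (non-neighbours G v) (B * (N * i)) ⟩
          N * (A * (degree G v + non-neighbours G v)) + B * (N * i)
            ≡⟨ cong (λ z → N * (A * z) + B * (N * i)) (degree+non-neighbours v) ⟩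
          N * (A * n) + B * (N * i)
            ≤⟨ condition i 1≤i fits ⟩
          N * (A * d G i) + (A + B) * (A * n)
            ≤⟨ +-monoˡ-≤ _ (*-monoʳ-≤ N (*-monoʳ-≤ A d≤)) ⟩
          N * (A * degree G v) + (A + B) * (A * n) ∎)
          where
          open ≤-Reasoning
          rearrange : ∀ n a x y z → n * (a * x) + (n * (a * y) + z) ≡ n * (a * (x + y)) + z
          rearrange = solve-∀

        first-fits : N * 1 ≤ A * n
        first-fits = ≤-trans (*-mono-≤ (≤-refl {N}) (≤-trans 1≤e (m≤m*n e L {{>-nonZero 1≤L}}))) (≤-trans (≤-reflexive (rearrange N e L)) e-upper)
          where
          rearrange : ∀ n e l → n * (e * l) ≡ e * (n * l)
          rearrange = solve-∀

        miss≤ : ∀ v → N * (A * non-neighbours G v) ≤ (A + B) * (A * n)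
        miss≤ v = ≤-trans (m≤m+n _ _) (miss-bound v 1 ≤-refl first-fits (≮⇒≥ not-smaller))
          where
          not-smaller : ¬ degree G v < d G 1
          not-smaller lt = <⇒≱ (≤-trans (≤-reflexive (cong 𝟙 (sym (⌊⌋-complete (degree G v <? d G 1) lt))))
            (term≤sum (λ u → 𝟙 ⌊ degree G u <? d G 1 ⌋) v)) (few-of-smaller-degree 1)

      -- The level is read off from the degree: it counts the multiples i of the width `e` at which
      -- the degree of `v` satisfies the bound for d_i, capped at L. This gives `by-level`. A vertex
      -- of level at most l < L violates the bound at i = (l + 1) e, so its degree is below d_i, and
      -- fewer than i vertices are of that kind.
      levelling : Levelling G N A B L
      levelling = record
        { ℓ           = λ v → quotient v ⊓ L
        ; ℓ≤L         = λ v → m⊓n≤n (quotient v) L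
        ; width       = e
        ; L≤width     = L≤e
        ; width-upper = ≤-trans (≤-reflexive (rearrange N e L)) e-upper
        ; width-lower = begin
            A * n  ≡⟨ m≡m%n+[m/n]*n (A * n) (N * L) {{NL≢0}} ⟩
            _%_ (A * n) (N * L) {{NL≢0}} + e * (N * L) ≤⟨ +-monoˡ-≤ _ (<⇒≤ (m%n<n (A * n) (N * L) {{NL≢0}})) ⟩
            N * L + e * (N * L)  ≡⟨ swap-terms N e L ⟩
            N * (e * L) + N * L  ∎
        ; by-level    = λ v → begin
            N * (A * non-neighbours G v) + B * (N * (e * (quotient v ⊓ L)))
              ≤⟨ +-monoʳ-≤ _ (*-monoʳ-≤ B (*-monoʳ-≤ N (*-monoʳ-≤ e (m⊓n≤m (quotient v) L)))) ⟩
            N * (A * non-neighbours G v) + B * (N * (e * quotient v))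
              ≡⟨ cong (N * (A * non-neighbours G v) +_) (regroup B N e (quotient v)) ⟩
            N * (A * non-neighbours G v) + quotient v * unit
              ≤⟨ +-monoʳ-≤ _ (m/n*n≤m (slack v) unit {{unit≢0}}) ⟩
            N * (A * non-neighbours G v) + slack v
              ≡⟨ m+[n∸m]≡n (miss≤ v) ⟩
            (A + B) * (A * n) ∎
        ; few-below   = λ l l<L → ≤-trans (#-mono (λ v → low-degree l l<L v)) (≤-trans (few-of-smaller-degree (suc l * e)) (m∸n≤m _ 1))
        }
        where
        open ≤-Reasoning
        rearrange : ∀ n e l → n * (e * l) ≡ e * (n * l)
        rearrange = solve-∀
        swap-terms : ∀ n e l → n * l + e * (n * l) ≡ n * (e * l) + n * l
        swap-terms = solve-∀
        regroup : ∀ b n e q → b * (n * (e * q)) ≡ q * (b * (n * e))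
        regroup = solve-∀
        regroup′ : ∀ b n e q → b * (n * (q * e)) ≡ q * (b * (n * e))
        regroup′ = solve-∀
        low-degree : ∀ l → l < L → ∀ v → not ⌊ l <? quotient v ⊓ L ⌋ ≡ true → ⌊ degree G v <? d G (suc l * e) ⌋ ≡ true
        low-degree l l<L v h = ⌊⌋-complete (degree G v <? d G (suc l * e)) (≰⇒> too-high)
          where
          not-higher : ¬ l < quotient v ⊓ L
          not-higher = ⌊⌋-false (l <? quotient v ⊓ L) (not-true⁻ h)
          too-high : ¬ d G (suc l * e) ≤ degree G v
          too-high d≤ = not-higher (⊓-glb (begin
            suc l  ≡⟨ m*n/n≡m (suc l) unit {{unit≢0}} ⟨
            _/_ (suc l * unit) unit {{unit≢0}}               ≤⟨ /-monoˡ-≤ unit {{unit≢0}} enough ⟩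
            quotient v  ∎) l<L)
            where
            fits : N * (suc l * e) ≤ A * n
            fits = ≤-trans (*-monoʳ-≤ N (*-monoˡ-≤ e l<L)) (≤-trans (≤-reflexive (trans (cong (N *_) (*-comm L e)) (rearrange N e L))) e-upper)
            enough : suc l * unit ≤ slack v
            enough = +-cancelˡ-≤ (N * (A * non-neighbours G v)) _ _ (begin
              N * (A * non-neighbours G v) + suc l * unit  ≡⟨ cong (N * (A * non-neighbours G v) +_) (regroup′ B N e (suc l)) ⟨
              N * (A * non-neighbours G v) + B * (N * (suc l * e))       ≤⟨ miss-bound v (suc l * e) (*-mono-≤ {1} {suc l} (s≤s z≤n) 1≤e) fits d≤ ⟩
              (A + B) * (A * n)  ≡⟨ m+[n∸m]≡n (miss≤ v) ⟨
              N * (A * non-neighbours G v) + slack v  ∎)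

  -- Copies of H inside a tile

  ⁅_⁆ : ∀ {n} → Fin n → VSet n
  ⁅ x ⁆ v = ⌊ v ≟ᶠ x ⌋

  #-⁅⁆ : ∀ {n} (x : Fin n) → # ⁅ x ⁆ ≡ 1
  #-⁅⁆ x = trans (sum-cong-≗ pointwise) (sum-δ x 1)
    where
    pointwise : ∀ v → 𝟙 (⁅ x ⁆ v) ≡ (if ⌊ v ≟ᶠ x ⌋ then 1 else 0)
    pointwise v with v ≟ᶠ x
    ... | yes _ = refl
    ... | no _  = refl

  fibre : ∀ {m k} → (Fin m → Fin k) → Fin k → VSet m
  fibre g k u = ⌊ g u ≟ᶠ k ⌋

  -- Injectivity is claimed within the fibres of `g` only, since the sets P may overlap here;
  -- `single` obtains the rest from the disjointness of complete parts.
  representatives : ∀ {n k} m (g : Fin m → Fin k) (P : Fin k → VSet n) → (∀ i → # (fibre g i) ≤ # (P i)) →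
    ∃ λ (f : Fin m → Fin n) → (∀ u → f u ∈ P (g u)) × (∀ u v → g u ≡ g v → f u ≡ f v → u ≡ v)
  representatives zero g P h = (λ ()) , (λ ()) , λ ()
  representatives {n} {k} (suc m) g P h = extend (representatives m (g ∘ suc) P′ enough)
    where
    k₀ = g zero
    first : ∃ λ x → x ∈ P k₀
    first = #-nonempty (P k₀) (≤-trans (≤-trans (≤-reflexive (cong 𝟙 (sym (⌊⌋-complete (k₀ ≟ᶠ k₀) refl)))) (m≤m+n _ _)) (h k₀))
    x = proj₁ first
    P′ : Fin k → VSet n
    P′ i with i ≟ᶠ k₀
    ... | yes _ = P i ∖ ⁅ x ⁆
    ... | no  _ = P i
    P′⊆P : ∀ i → P′ i ⊆ P i
    P′⊆P i v v∈ with i ≟ᶠ k₀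
    ... | yes _ = ∖⊆ (P i) ⁅ x ⁆ v v∈
    ... | no  _ = v∈
    x∉P′ : ∀ i → i ≡ k₀ → ¬ x ∈ P′ i
    x∉P′ i i≡ x∈ with i ≟ᶠ k₀
    ... | yes _ = true≢false (⌊⌋-complete (x ≟ᶠ x) refl) (proj₂ (∖⁻ (P i) ⁅ x ⁆ x x∈))
    ... | no ne = ne i≡
    singleton⊆ : ⁅ x ⁆ ⊆ P k₀
    singleton⊆ v v∈ = subst (_∈ P k₀) (sym (⌊⌋-sound (v ≟ᶠ x) v∈)) (proj₂ first)
    enough : ∀ i → # (fibre (g ∘ suc) i) ≤ # (P′ i)
    enough i with i ≟ᶠ k₀
    ... | yes refl = +-cancelˡ-≤ 1 _ _ (begin
        1 + # (fibre (g ∘ suc) k₀)      ≡⟨ cong (λ b → 𝟙 b + # (fibre (g ∘ suc) k₀)) (⌊⌋-complete (k₀ ≟ᶠ k₀) refl) ⟨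
        # (fibre g k₀)  ≤⟨ h k₀ ⟩
        # (P k₀)  ≡⟨ #-∖ singleton⊆ ⟩
        # ⁅ x ⁆ + # (P k₀ ∖ ⁅ x ⁆)      ≡⟨ cong (_+ # (P k₀ ∖ ⁅ x ⁆)) (#-⁅⁆ x) ⟩
        1 + # (P k₀ ∖ ⁅ x ⁆)            ∎)
      where open ≤-Reasoning
    ... | no _     = ≤-trans (m≤n+m _ _) (h i)
    extend : (∃ λ (f : Fin m → Fin n) → (∀ u → f u ∈ P′ (g (suc u))) × (∀ u v → g (suc u) ≡ g (suc v) → f u ≡ f v → u ≡ v)) →
             ∃ λ (f : Fin (suc m) → Fin n) → (∀ u → f u ∈ P (g u)) × (∀ u v → g u ≡ g v → f u ≡ f v → u ≡ v)
    extend (f , inside , inj) = f′ , inside′ , inj′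
      where
      f′ : Fin (suc m) → Fin n
      f′ zero    = x
      f′ (suc u) = f u
      inside′ : ∀ u → f′ u ∈ P (g u)
      inside′ zero    = proj₂ first
      inside′ (suc u) = P′⊆P (g (suc u)) (f u) (inside u)
      inj′ : ∀ u v → g u ≡ g v → f′ u ≡ f′ v → u ≡ v
      inj′ zero    zero    _ _ = refl
      inj′ zero    (suc v) e q = ⊥-elim (x∉P′ (g (suc v)) (sym e) (subst (_∈ P′ (g (suc v))) (sym q) (inside v)))
      inj′ (suc u) zero    e q = ⊥-elim (x∉P′ (g (suc u)) e (subst (_∈ P′ (g (suc u))) q (inside u)))
      inj′ (suc u) (suc v) e q = cong suc (inj u v e q)

  -- Row q of the addition table modulo suc s.
  rotate : ∀ {s} → Fin (suc s) → Fin (suc s) → Fin (suc s)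
  rotate {s} q a = fromℕ< (m%n<n (toℕ q + toℕ a) (suc s))

  rotate-injective : ∀ {s} (a : Fin (suc s)) {x y} → rotate x a ≡ rotate y a → x ≡ y
  rotate-injective {s} a {x} {y} e = toℕ-injective (trans (sym (undo x)) (trans (cong (λ z → (z + (suc s ∸ toℕ a)) % suc s) value) (undo y)))
    where
    value : (toℕ x + toℕ a) % suc s ≡ (toℕ y + toℕ a) % suc s
    value = trans (sym (toℕ-fromℕ< (m%n<n (toℕ x + toℕ a) (suc s)))) (trans (cong toℕ e) (toℕ-fromℕ< (m%n<n (toℕ y + toℕ a) (suc s))))
    undo : ∀ z → ((toℕ z + toℕ a) % suc s + (suc s ∸ toℕ a)) % suc s ≡ toℕ z
    undo z = begin
      (w % suc s + b) % suc s  ≡⟨ %-distribˡ-+ (w % suc s) b (suc s) ⟩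
      (w % suc s % suc s + b % suc s) % suc s    ≡⟨ cong (λ q → (q + b % suc s) % suc s) (m%n%n≡m%n w (suc s)) ⟩
      (w % suc s + b % suc s) % suc s            ≡⟨ %-distribˡ-+ w b (suc s) ⟨
      (w + b) % suc s  ≡⟨ cong (_% suc s) (trans (+-assoc (toℕ z) (toℕ a) b) (cong (toℕ z +_) (m+[n∸m]≡n (<⇒≤ (toℕ<n a))))) ⟩
      (toℕ z + suc s) % suc s  ≡⟨ [m+n]%n≡m%n (toℕ z) (suc s) ⟩
      toℕ z % suc s  ≡⟨ m<n⇒m%n≡m (toℕ<n z) ⟩
      toℕ z  ∎
      where
      open ≡-Reasoning
      w = toℕ z + toℕ a
      b = suc s ∸ toℕ a

  rotate-comm : ∀ {s} (x y : Fin (suc s)) → rotate x y ≡ rotate y x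
  rotate-comm {s} x y = toℕ-injective (trans (toℕ-fromℕ< (m%n<n (toℕ x + toℕ y) (suc s)))
    (trans (cong (_% suc s) (+-comm (toℕ x) (toℕ y))) (sym (toℕ-fromℕ< (m%n<n (toℕ y + toℕ x) (suc s))))))

  module Packings {h n : ℕ} (K : Graph h) (G : Graph n) where

    -- Recording a set that contains all copies makes it easy to unite packings in disjoint sets.
    record Packing (m : ℕ) (Z : VSet n) : Set where
      field
        emb      : Fin m → Fin h → Fin n
        inside   : ∀ a u → emb a u ∈ Z
        disjoint : ∀ a u b v → emb a u ≡ emb b v → a ≡ b × u ≡ v
        edges    : ∀ a u v → adj K u v ≡ true → adj G (emb a u) (emb a v) ≡ true
    open Packing

    empty-packing : ∀ {Z} → Packing 0 Z
    empty-packing = record { emb = λ () ; inside = λ () ; disjoint = λ () ; edges = λ () }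

    union : ∀ {m m′ Z Z′ W} → Packing m Z → Packing m′ Z′ → Z ⊆ W → Z′ ⊆ W → (∀ v → v ∈ Z → v ∈ Z′ → ⊥) → Packing (m + m′) W
    union {m} {m′} {Z} {Z′} {W} P P′ Z⊆ Z′⊆ apart = record
      { emb      = λ a → emb″ (splitAt m a)
      ; inside   = λ a → inside″ (splitAt m a)
      ; disjoint = λ a u b v e → let (p , q) = disjoint″ (splitAt m a) u (splitAt m b) v e in
                     trans (sym (join-splitAt m m′ a)) (trans (cong (join m m′) p) (join-splitAt m m′ b)) , q
      ; edges    = λ a → edges″ (splitAt m a)
      }
      where
      emb″ : Fin m ⊎ Fin m′ → Fin h → Fin n
      emb″ (inj₁ a) = emb P a
      emb″ (inj₂ a) = emb P′ a
      inside″ : ∀ a u → emb″ a u ∈ W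
      inside″ (inj₁ a) u = Z⊆ _ (inside P a u)
      inside″ (inj₂ a) u = Z′⊆ _ (inside P′ a u)
      disjoint″ : ∀ a u b v → emb″ a u ≡ emb″ b v → a ≡ b × u ≡ v
      disjoint″ (inj₁ a) u (inj₁ b) v e = let (p , q) = disjoint P a u b v e in cong inj₁ p , q
      disjoint″ (inj₂ a) u (inj₂ b) v e = let (p , q) = disjoint P′ a u b v e in cong inj₂ p , q
      disjoint″ (inj₁ a) u (inj₂ b) v e = ⊥-elim (apart _ (inside P a u) (subst (_∈ Z′) (sym e) (inside P′ b v)))
      disjoint″ (inj₂ a) u (inj₁ b) v e = ⊥-elim (apart _ (inside P b v) (subst (_∈ Z′) e (inside P′ a u)))
      edges″ : ∀ a u v → adj K u v ≡ true → adj G (emb″ a u) (emb″ a v) ≡ true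
      edges″ (inj₁ a) = edges P a
      edges″ (inj₂ a) = edges P′ a

    module _ (s A B : ℕ) where

      open Tiling G s A B

      Proper : (Fin h → Fin r) → Set
      Proper g = ∀ u v → adj K u v ≡ true → g u ≢ g v

      complete-disjoint : ∀ {P : Fin r → VSet n} → Complete P → ∀ {i j v} → v ∈ P i → v ∈ P j → i ≡ j
      complete-disjoint c {i} {j} v∈i v∈j with i ≟ᶠ j
      ... | yes e = e
      ... | no ne = ⊥-elim (true≢false (c ne v∈i v∈j) (loopless G _))

      member-of : ∀ {m} (P : Fin m → VSet n) v → v ∈ ⋃ P → ∃ λ i → v ∈ P i
      member-of P v v∈ = #-nonempty (λ i → P i v) (⌊⌋-sound (1 ≤? multiplicity P v) v∈)

      ⋃-mono : ∀ {m} {P Q : Fin m → VSet n} → (∀ i → P i ⊆ Q i) → ⋃ P ⊆ ⋃ Q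
      ⋃-mono {P = P} {Q} sub v v∈ = let (i , v∈i) = member-of P v v∈ in ⊆⋃ Q i v (sub i v v∈i)

      single : ∀ (g : Fin h → Fin r) (P : Fin r → VSet n) → Proper g → Complete P → (∀ k → # (fibre g k) ≤ # (P k)) → Packing 1 (⋃ P)
      single g P proper complete enough = from (representatives h g P enough)
        where
        from : (∃ λ (f : Fin h → Fin n) → (∀ u → f u ∈ P (g u)) × (∀ u v → g u ≡ g v → f u ≡ f v → u ≡ v)) → Packing 1 (⋃ P)
        from (f , inside , inj) = record
          { emb      = λ _ → f
          ; inside   = λ _ u → ⊆⋃ P (g u) (f u) (inside u)
          ; disjoint = λ { zero u zero v e → refl , inj u v (complete-disjoint complete (inside u) (subst (_∈ P (g v)) (sym e) (inside v))) e }
          ; edges    = λ _ u v uv → complete (proper u v uv) (inside u) (inside v)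
          }

      split-packing : ∀ {m m′} (P : Fin r → VSet n) → Complete P → (f g : Fin r → ℕ) → (∀ k → f k + g k ≤ # (P k)) →
        (∀ Q → Complete Q → (∀ k → f k ≤ # (Q k)) → Packing m (⋃ Q)) →
        (∀ Q → Complete Q → (∀ k → g k ≤ # (Q k)) → Packing m′ (⋃ Q)) → Packing (m + m′) (⋃ P)
      split-packing P complete f g enough first second =
        union (first P₁ (Complete-⊆ P₁⊆ complete) (λ k → ≤-reflexive (sym (#P₁ k))))
              (second P₂ (Complete-⊆ P₂⊆ complete) (λ k → +-cancelˡ-≤ (f k) _ _
                (≤-trans (enough k) (≤-reflexive (trans (#-∖ (P₁⊆ k)) (cong (_+ # (P₂ k)) (#P₁ k)))))))
              (⋃-mono P₁⊆) (⋃-mono P₂⊆) apart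
        where
        enough₁ : ∀ k → f k ≤ # (P k)
        enough₁ k = ≤-trans (m≤m+n _ _) (enough k)
        P₁ P₂ : Fin r → VSet n
        P₁ k = proj₁ (choose-subset (P k) (f k) (enough₁ k))
        P₂ k = P k ∖ P₁ k
        P₁⊆ : ∀ k → P₁ k ⊆ P k
        P₁⊆ k = proj₁ (proj₂ (choose-subset (P k) (f k) (enough₁ k)))
        #P₁ : ∀ k → # (P₁ k) ≡ f k
        #P₁ k = proj₂ (proj₂ (choose-subset (P k) (f k) (enough₁ k)))
        P₂⊆ : ∀ k → P₂ k ⊆ P k
        P₂⊆ k = ∖⊆ (P k) (P₁ k)
        apart : ∀ v → v ∈ ⋃ P₁ → v ∈ ⋃ P₂ → ⊥
        apart v v∈₁ v∈₂ =
          let (i , v∈i) = member-of P₁ v v∈₁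
              (j , v∈j) = member-of P₂ v v∈₂
              i≡j = complete-disjoint complete (P₁⊆ i v v∈i) (P₂⊆ j v v∈j)
          in true≢false (subst (λ k → v ∈ P₁ k) i≡j v∈i) (proj₂ (∖⁻ (P j) (P₁ j) v v∈j))

      several : ∀ m (g : Fin m → Fin h → Fin r) → (∀ q → Proper (g q)) → (P : Fin r → VSet n) → Complete P →
                (∀ k → sum (λ q → # (fibre (g q) k)) ≤ # (P k)) → Packing m (⋃ P)
      several zero    g proper P complete enough = empty-packing
      several (suc m) g proper P complete enough =
        split-packing P complete (λ k → # (fibre (g zero) k)) (λ k → sum (λ q → # (fibre (g (suc q)) k))) enough
          (λ Q → single (g zero) Q (proper zero)) (several m (g ∘ suc) (proper ∘ suc))

      repeated : ∀ X m (f : Fin r → ℕ) → (∀ Q → Complete Q → (∀ k → f k ≤ # (Q k)) → Packing m (⋃ Q)) →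
                 (P : Fin r → VSet n) → Complete P → (∀ k → X * f k ≤ # (P k)) → Packing (X * m) (⋃ P)
      repeated zero    m f pack P complete enough = empty-packing
      repeated (suc X) m f pack P complete enough =
        split-packing P complete f (λ k → X * f k) enough pack (repeated X m f pack)

      module _ (c : Fin h → Fin r) (proper : Proper c) (a : Fin r) (j : Fin r) where

        -- Colour `a` goes to the special part `j`. The remaining colours and parts are matched by a
        -- Latin square, so that over all `q` each of these colours meets each of these parts at
        -- most once.
        arrange : Fin ρ → Fin r → Fin r
        arrange q b with b ≟ᶠ a
        ... | yes _  = j
        ... | no b≢a = punchIn j (rotate q (punchOut (b≢a ∘ sym)))

        arrange-injective : ∀ q {b b′} → arrange q b ≡ arrange q b′ → b ≡ b′
        arrange-injective q {b} {b′} e with b ≟ᶠ a | b′ ≟ᶠ a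
        ... | yes p | yes p′ = trans p (sym p′)
        ... | yes _ | no _   = ⊥-elim (punchInᵢ≢i j _ (sym e))
        ... | no _  | yes _  = ⊥-elim (punchInᵢ≢i j _ e)
        ... | no p  | no p′  = punchOut-injective (p ∘ sym) (p′ ∘ sym) (rotate-injective q
          (trans (rotate-comm _ q) (trans (punchIn-injective j _ _ e) (rotate-comm q _))))

        proper-arrangement : ∀ q → Proper (arrange q ∘ c)
        proper-arrangement q u v uv e = proper u v uv (arrange-injective q e)

        one-arrangement : ∀ b k → b ≢ a → sum (λ q → 𝟙 ⌊ arrange q b ≟ᶠ k ⌋) ≤ 1
        one-arrangement b k b≢a = sum-𝟙≤1 (λ q → ⌊ arrange q b ≟ᶠ k ⌋) λ x y x≢y p q →
          x≢y (same x y (trans (⌊⌋-sound (arrange x b ≟ᶠ k) p) (sym (⌊⌋-sound (arrange y b ≟ᶠ k) q))))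
          where
          same : ∀ x y → arrange x b ≡ arrange y b → x ≡ y
          same x y e with b ≟ᶠ a
          ... | yes p = ⊥-elim (b≢a p)
          ... | no _  = rotate-injective _ (punchIn-injective j _ _ e)

        arrange-a : ∀ q → arrange q a ≡ j
        arrange-a q with a ≟ᶠ a
        ... | yes _ = refl
        ... | no ne = ⊥-elim (ne refl)

        load-special : sum (λ q → # (fibre (arrange q ∘ c) j)) ≤ ρ * # (fibre c a)
        load-special = ≤-trans (sum-mono (λ q → #-mono (sub q))) (≤-reflexive (sum-const ρ _))
          where
          sub : ∀ q → fibre (arrange q ∘ c) j ⊆ fibre c a
          sub q u u∈ = ⌊⌋-complete (c u ≟ᶠ a)
            (arrange-injective q (trans (⌊⌋-sound (arrange q (c u) ≟ᶠ j) u∈) (sym (arrange-a q))))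

        load-other : ∀ k → k ≢ j → sum (λ q → # (fibre (arrange q ∘ c) k)) ≤ # (λ u → not (fibre c a u))
        load-other k k≢j = ≤-trans (≤-reflexive (∑-comm (λ q u → 𝟙 (fibre (arrange q ∘ c) k u)))) (sum-mono pointwise)
          where
          pointwise : ∀ u → sum (λ q → 𝟙 (fibre (arrange q ∘ c) k u)) ≤ 𝟙 (not (fibre c a u))
          pointwise u = by-cases (c u ≟ᶠ a)
            where
            by-cases : (e : Dec (c u ≡ a)) → sum (λ q → 𝟙 (fibre (arrange q ∘ c) k u)) ≤ 𝟙 (not ⌊ e ⌋)
            by-cases (no ne) = one-arrangement (c u) k ne
            by-cases (yes e) = ≤-reflexive (sum-≡0 (λ q → cong 𝟙 (¬true⇒false (λ t →
              k≢j (trans (sym (⌊⌋-sound (arrange q (c u) ≟ᶠ k) t)) (trans (cong (arrange q) e) (arrange-a q)))))))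

      -- With σ the size of class `a`, the ρ arrangements together put ρ σ vertices into part `j`
      -- and at most h - σ into any other; this pattern is repeated X times.
      pack-tile : ∀ X (c : Fin h → Fin r) → Proper c → (a : Fin r) →
        X * (ρ * # (fibre c a)) ≤ B → X * # (λ u → not (fibre c a u)) ≤ A → (Q : Tile 1) → Packing (X * ρ) (⋃ (parts Q))
      pack-tile X c proper a B≥ A≥ Q = repeated X ρ load
        (λ P complete enough → several ρ (λ q → arrange c proper a j q ∘ c) (proper-arrangement c proper a j) P complete
          (λ k → ≤-trans (within k) (enough k)))
        (parts Q) (complete Q) (λ k → ≤-trans (fits k) (≤-reflexive (sym (trans (card Q k) (*-identityʳ _)))))
        where
        j = special Q
        load : Fin r → ℕ
        load k = if ⌊ k ≟ᶠ j ⌋ then ρ * # (fibre c a) else # (λ u → not (fibre c a u))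
        within : ∀ k → sum (λ q → # (fibre (arrange c proper a j q ∘ c) k)) ≤ load k
        within k = by-cases (k ≟ᶠ j)
          where
          by-cases : (e : Dec (k ≡ j)) → sum (λ q → # (fibre (arrange c proper a j q ∘ c) k)) ≤
                     (if ⌊ e ⌋ then ρ * # (fibre c a) else # (λ u → not (fibre c a u)))
          by-cases (yes refl) = load-special c proper a j
          by-cases (no k≢j)   = load-other c proper a j k k≢j
        fits : ∀ k → X * load k ≤ size j k
        fits k with k ≟ᶠ j
        ... | yes _ = B≥
        ... | no _  = A≥

      pack-tiles : ∀ X (c : Fin h → Fin r) → Proper c → (a : Fin r) →
        X * (ρ * # (fibre c a)) ≤ B → X * # (λ u → not (fibre c a u)) ≤ A →
        (ts : List (Tile 1)) → (∀ v → occs ts v ≤ 1) → Packing (length ts * (X * ρ)) (λ v → ⌊ 1 ≤? occs ts v ⌋)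
      pack-tiles X c proper a B≥ A≥ []       ok = empty-packing
      pack-tiles X c proper a B≥ A≥ (Q ∷ Qs) ok = union (pack-tile X c proper a B≥ A≥ Q)
          (pack-tiles X c proper a B≥ A≥ Qs (λ v → ≤-trans (m≤n+m _ (occ Q v)) (ok v)))
          (λ v v∈ → ⌊⌋-complete (1 ≤? occs (Q ∷ Qs) v) (≤-trans (⌊⌋-sound (1 ≤? occ Q v) v∈) (m≤m+n _ _)))
          (λ v v∈ → ⌊⌋-complete (1 ≤? occs (Q ∷ Qs) v) (≤-trans (⌊⌋-sound (1 ≤? occs Qs v) v∈) (m≤n+m _ (occ Q v))))
          (λ v v∈ v∈′ → <⇒≱ {1} ≤-refl (≤-trans (+-mono-≤ (⌊⌋-sound (1 ≤? occ Q v) v∈) (⌊⌋-sound (1 ≤? occs Qs v) v∈′)) (ok v)))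

    to-HTiling : ∀ {m Z} → Packing m Z → HTiling K G
    to-HTiling {m} P = record { copies = m ; emb = emb P ; disjointInjective = disjoint P ; edges = edges P }

  -- Clearing denominators

  -- `ℕ→ℚ` divides by a gcd and is stuck on a variable, so its arithmetic is transferred from
  -- unnormalised fractions.
  toℚᵘ-ℕ→ℚ : ∀ n → toℚᵘ (ℕ→ℚ n) ℚᵘ.≃ mkℚᵘ (ℤ.+ n) 0
  toℚᵘ-ℕ→ℚ n = ℚ.toℚᵘ-fromℚᵘ (mkℚᵘ (ℤ.+ n) 0)

  ℕ→ℚ-+ : ∀ m n → ℕ→ℚ (m + n) ≡ ℕ→ℚ m ℚ.+ ℕ→ℚ n
  ℕ→ℚ-+ m n = ℚ.toℚᵘ-injective (ℚᵘ.≃-trans (toℚᵘ-ℕ→ℚ (m + n)) (ℚᵘ.≃-sym (ℚᵘ.≃-trans (ℚ.toℚᵘ-homo-+ (ℕ→ℚ m) (ℕ→ℚ n))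
    (ℚᵘ.≃-trans (ℚᵘ.+-cong (toℚᵘ-ℕ→ℚ m) (toℚᵘ-ℕ→ℚ n)) (*≡* (lemma (ℤ.+ m) (ℤ.+ n)))))))
    where
    lemma : ∀ a b → (a ℤ.* (ℤ.+ 1) ℤ.+ b ℤ.* (ℤ.+ 1)) ℤ.* (ℤ.+ 1) ≡ (a ℤ.+ b) ℤ.* (ℤ.+ 1)
    lemma = ℤ-Ring.solve-∀

  ℕ→ℚ-* : ∀ m n → ℕ→ℚ (m * n) ≡ ℕ→ℚ m ℚ.* ℕ→ℚ n
  ℕ→ℚ-* m n = ℚ.toℚᵘ-injective (ℚᵘ.≃-trans (toℚᵘ-ℕ→ℚ (m * n)) (ℚᵘ.≃-sym (ℚᵘ.≃-trans (ℚ.toℚᵘ-homo-* (ℕ→ℚ m) (ℕ→ℚ n))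
    (ℚᵘ.≃-trans (ℚᵘ.*-cong (toℚᵘ-ℕ→ℚ m) (toℚᵘ-ℕ→ℚ n)) (*≡* (cong (ℤ._* (ℤ.+ 1)) (sym (ℤ.pos-* m n))))))))

  ℕ→ℚ-mono : ∀ {m n} → m ≤ n → ℕ→ℚ m ℚ.≤ ℕ→ℚ n
  ℕ→ℚ-mono {m} {n} m≤n = ℚ.toℚᵘ-cancel-≤ (ℚᵘ.≤-trans (ℚᵘ.≤-reflexive (toℚᵘ-ℕ→ℚ m))
    (ℚᵘ.≤-trans (*≤* (ℤ.*-monoʳ-≤-nonNeg (ℤ.+ 1) (ℤ.+≤+ m≤n))) (ℚᵘ.≤-reflexive (ℚᵘ.≃-sym (toℚᵘ-ℕ→ℚ n)))))

  ℕ→ℚ-cancel : ∀ {m n} → ℕ→ℚ m ℚ.≤ ℕ→ℚ n → m ≤ n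
  ℕ→ℚ-cancel {m} {n} h = ℤ.drop‿+≤+ (ℤ.*-cancelʳ-≤-pos (ℤ.+ m) (ℤ.+ n) (ℤ.+ 1) (ℚᵘ.drop-*≤* (ℚᵘ.≤-trans
    (ℚᵘ.≤-reflexive (ℚᵘ.≃-sym (toℚᵘ-ℕ→ℚ m))) (ℚᵘ.≤-trans (ℚ.toℚᵘ-mono-≤ h) (ℚᵘ.≤-reflexive (toℚᵘ-ℕ→ℚ n))))))

  ℕ→ℚ-injective : ∀ {m n} → ℕ→ℚ m ≡ ℕ→ℚ n → m ≡ n
  ℕ→ℚ-injective e = ≤-antisym (ℕ→ℚ-cancel (ℚ.≤-reflexive e)) (ℕ→ℚ-cancel (ℚ.≤-reflexive (sym e)))

  ℕ→ℚ-nonNeg : ∀ n → ℚ.NonNegative (ℕ→ℚ n)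
  ℕ→ℚ-nonNeg n = ℚ.nonNegative (ℕ→ℚ-mono {0} {n} z≤n)

  ℕ→ℚ-pos : ∀ {n} → 1 ≤ n → ℚ.Positive (ℕ→ℚ n)
  ℕ→ℚ-pos {n} 1≤n = ℚ.positive (ℚ.≰⇒> (λ h → <⇒≱ 1≤n (ℕ→ℚ-cancel {n} {0} h)))

  ℕ→ℚ-∸ : ∀ {m n} → n ≤ m → ℕ→ℚ (m ∸ n) ≡ ℕ→ℚ m ℚ.- ℕ→ℚ n
  ℕ→ℚ-∸ {m} {n} n≤m = trans (cancel (ℕ→ℚ (m ∸ n)) (ℕ→ℚ n)) (cong (ℚ._- ℕ→ℚ n) (trans (sym (ℕ→ℚ-+ (m ∸ n) n)) (cong ℕ→ℚ (m∸n+n≡m n≤m))))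
    where
    open +-*-Solver
    cancel : ∀ a b → a ≡ a ℚ.+ b ℚ.- b
    cancel = solve 2 (λ a b → a := a :+ b :- b) refl

  ÷′-* : ∀ p {q} → q ≢ 0ℚ → (p ÷' q) ℚ.* q ≡ p
  ÷′-* p {q} q≢0 with q ℚ.≟ 0ℚ
  ... | yes e  = ⊥-elim (q≢0 e)
  ... | no q≢0′ = trans (ℚ.*-assoc p _ q) (trans (cong (p ℚ.*_) (ℚ.*-inverseˡ q {{ℚ.≢-nonZero q≢0′}})) (ℚ.*-identityʳ p))

  denominator-clears : ∀ q → q ℚ.* ℕ→ℚ (↧ₙ q) ≡ (↥ q) ℚ./ 1
  denominator-clears q = ℚ.toℚᵘ-injective (ℚᵘ.≃-trans (ℚ.toℚᵘ-homo-* q (ℕ→ℚ (↧ₙ q)))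
    (ℚᵘ.≃-trans (ℚᵘ.*-cong (ℚᵘ.≃-refl {toℚᵘ q}) (toℚᵘ-ℕ→ℚ (↧ₙ q)))
    (ℚᵘ.≃-trans (cleared q) (ℚᵘ.≃-sym (ℚ.toℚᵘ-fromℚᵘ (mkℚᵘ (↥ q) 0))))))
    where
    cleared : ∀ q → toℚᵘ q ℚᵘ.* mkℚᵘ (ℤ.+ ↧ₙ q) 0 ℚᵘ.≃ mkℚᵘ (↥ q) 0
    cleared (mkℚ a d-1 _) = *≡* (lemma a (ℤ.+ suc d-1))
      where
      lemma : ∀ a b → a ℤ.* b ℤ.* (ℤ.+ 1) ≡ a ℤ.* (b ℤ.* (ℤ.+ 1))
      lemma = ℤ-Ring.solve-∀

  positive-fraction : ∀ q → 0ℚ ℚ.< q → ∃ λ m → ∃ λ k → 1 ≤ m × 1 ≤ k × q ℚ.* ℕ→ℚ k ≡ ℕ→ℚ m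
  positive-fraction q@(mkℚ (ℤ.+ zero) d c) 0<q = ⊥-elim (ℤ.<-irrefl refl (ℚ.drop-*<* 0<q))
  positive-fraction q@(mkℚ (ℤ.+ suc m) d c) 0<q = suc m , suc d , s≤s z≤n , s≤s z≤n , denominator-clears q
  positive-fraction q@(mkℚ (-[1+ m ]) d c) (ℚ.*<* ())

  -- `u`, `v`, `w` stand for the three quotients in the constant term, 1 / χ_cr, 1 / (r - 1) and x σ
  -- / h, given by what they multiply to. The right-hand side is (N - A - B) / D.
  density-identity : ∀ x u v w h σ ρ → u ℚ.* (ρ ℚ.* h) ≡ h ℚ.- σ → v ℚ.* ρ ≡ 1ℚ → w ℚ.* h ≡ x ℚ.* σ →
    (x ℚ.* (1ℚ ℚ.- u) ℚ.+ (1ℚ ℚ.- x) ℚ.* (1ℚ ℚ.- v) ℚ.- w) ℚ.* (ρ ℚ.* h) ≡ ρ ℚ.* h ℚ.- h ℚ.+ x ℚ.* σ ℚ.- ρ ℚ.* (x ℚ.* σ)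
  density-identity x u v w h σ ρ eu ev ew = trans (expand x u v w h ρ)
    (trans (cong₂ ℚ._-_ (cong₂ ℚ._+_ (cong (λ z → x ℚ.* (ρ ℚ.* h ℚ.- z)) eu) (cong (λ z → (1ℚ ℚ.- x) ℚ.* (ρ ℚ.* h ℚ.- h ℚ.* z)) ev)) (cong (ρ ℚ.*_) ew))
           (collect x h σ ρ))
    where
    open +-*-Solver
    expand : ∀ x u v w h ρ → (x ℚ.* (1ℚ ℚ.- u) ℚ.+ (1ℚ ℚ.- x) ℚ.* (1ℚ ℚ.- v) ℚ.- w) ℚ.* (ρ ℚ.* h) ≡
      x ℚ.* (ρ ℚ.* h ℚ.- u ℚ.* (ρ ℚ.* h)) ℚ.+ (1ℚ ℚ.- x) ℚ.* (ρ ℚ.* h ℚ.- h ℚ.* (v ℚ.* ρ)) ℚ.- ρ ℚ.* (w ℚ.* h)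
    expand = solve 6 (λ x u v w h ρ → (x :* (con 1ℚ :- u) :+ (con 1ℚ :- x) :* (con 1ℚ :- v) :- w) :* (ρ :* h) :=
      x :* (ρ :* h :- u :* (ρ :* h)) :+ (con 1ℚ :- x) :* (ρ :* h :- h :* (v :* ρ)) :- ρ :* (w :* h)) refl
    collect : ∀ x h σ ρ → x ℚ.* (ρ ℚ.* h ℚ.- (h ℚ.- σ)) ℚ.+ (1ℚ ℚ.- x) ℚ.* (ρ ℚ.* h ℚ.- h ℚ.* 1ℚ) ℚ.- ρ ℚ.* (x ℚ.* σ) ≡
      ρ ℚ.* h ℚ.- h ℚ.+ x ℚ.* σ ℚ.- ρ ℚ.* (x ℚ.* σ)
    collect = solve 4 (λ x h σ ρ → x :* (ρ :* h :- (h :- σ)) :+ (con 1ℚ :- x) :* (ρ :* h :- h :* con 1ℚ) :- ρ :* (x :* σ) :=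
      ρ :* h :- h :+ x :* σ :- ρ :* (x :* σ)) refl

  -- The lower bound for d_i multiplied by N A, where g = 1 - (A + B) / N and z = B / A.
  degree-bound-identity : ∀ x g z h σ ρ D n i →
    g ℚ.* (ρ ℚ.* h) ≡ ρ ℚ.* h ℚ.- h ℚ.+ x ℚ.* σ ℚ.- ρ ℚ.* (x ℚ.* σ) → z ℚ.* (h ℚ.- x ℚ.* σ) ≡ ρ ℚ.* x ℚ.* σ →
    (g ℚ.* n ℚ.+ z ℚ.* i) ℚ.* (ρ ℚ.* (h ℚ.* D) ℚ.* (h ℚ.* D ℚ.- x ℚ.* D ℚ.* σ))
      ℚ.+ (h ℚ.* D ℚ.- x ℚ.* D ℚ.* σ ℚ.+ ρ ℚ.* (x ℚ.* D ℚ.* σ)) ℚ.* ((h ℚ.* D ℚ.- x ℚ.* D ℚ.* σ) ℚ.* n)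
    ≡ ρ ℚ.* (h ℚ.* D) ℚ.* ((h ℚ.* D ℚ.- x ℚ.* D ℚ.* σ) ℚ.* n) ℚ.+ ρ ℚ.* (x ℚ.* D ℚ.* σ) ℚ.* (ρ ℚ.* (h ℚ.* D) ℚ.* i)
  degree-bound-identity x g z h σ ρ D n i eg ez = trans (expand x g z h σ ρ D n i)
    (trans (cong₂ (λ a b → a ℚ.* n ℚ.* D ℚ.* (D ℚ.* (h ℚ.- x ℚ.* σ)) ℚ.+ b ℚ.* (ρ ℚ.* h ℚ.* D ℚ.* D ℚ.* i) ℚ.+ (D ℚ.* (h ℚ.- x ℚ.* σ ℚ.+ ρ ℚ.* (x ℚ.* σ))) ℚ.* (D ℚ.* (h ℚ.- x ℚ.* σ) ℚ.* n)) eg ez)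
           (collect x h σ ρ D n i))
    where
    open +-*-Solver
    expand : ∀ x g z h σ ρ D n i →
      (g ℚ.* n ℚ.+ z ℚ.* i) ℚ.* (ρ ℚ.* (h ℚ.* D) ℚ.* (h ℚ.* D ℚ.- x ℚ.* D ℚ.* σ))
        ℚ.+ (h ℚ.* D ℚ.- x ℚ.* D ℚ.* σ ℚ.+ ρ ℚ.* (x ℚ.* D ℚ.* σ)) ℚ.* ((h ℚ.* D ℚ.- x ℚ.* D ℚ.* σ) ℚ.* n)
      ≡ g ℚ.* (ρ ℚ.* h) ℚ.* n ℚ.* D ℚ.* (D ℚ.* (h ℚ.- x ℚ.* σ)) ℚ.+ z ℚ.* (h ℚ.- x ℚ.* σ) ℚ.* (ρ ℚ.* h ℚ.* D ℚ.* D ℚ.* i)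
        ℚ.+ (D ℚ.* (h ℚ.- x ℚ.* σ ℚ.+ ρ ℚ.* (x ℚ.* σ))) ℚ.* (D ℚ.* (h ℚ.- x ℚ.* σ) ℚ.* n)
    expand = solve 9 (λ x g z h σ ρ D n i →
      (g :* n :+ z :* i) :* (ρ :* (h :* D) :* (h :* D :- x :* D :* σ))
        :+ (h :* D :- x :* D :* σ :+ ρ :* (x :* D :* σ)) :* ((h :* D :- x :* D :* σ) :* n)
      := g :* (ρ :* h) :* n :* D :* (D :* (h :- x :* σ)) :+ z :* (h :- x :* σ) :* (ρ :* h :* D :* D :* i)
        :+ (D :* (h :- x :* σ :+ ρ :* (x :* σ))) :* (D :* (h :- x :* σ) :* n)) refl
    collect : ∀ x h σ ρ D n i →
      (ρ ℚ.* h ℚ.- h ℚ.+ x ℚ.* σ ℚ.- ρ ℚ.* (x ℚ.* σ)) ℚ.* n ℚ.* D ℚ.* (D ℚ.* (h ℚ.- x ℚ.* σ)) ℚ.+ ρ ℚ.* x ℚ.* σ ℚ.* (ρ ℚ.* h ℚ.* D ℚ.* D ℚ.* i)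
        ℚ.+ (D ℚ.* (h ℚ.- x ℚ.* σ ℚ.+ ρ ℚ.* (x ℚ.* σ))) ℚ.* (D ℚ.* (h ℚ.- x ℚ.* σ) ℚ.* n)
      ≡ ρ ℚ.* (h ℚ.* D) ℚ.* ((h ℚ.* D ℚ.- x ℚ.* D ℚ.* σ) ℚ.* n) ℚ.+ ρ ℚ.* (x ℚ.* D ℚ.* σ) ℚ.* (ρ ℚ.* (h ℚ.* D) ℚ.* i)
    collect = solve 7 (λ x h σ ρ D n i →
      (ρ :* h :- h :+ x :* σ :- ρ :* (x :* σ)) :* n :* D :* (D :* (h :- x :* σ)) :+ ρ :* x :* σ :* (ρ :* h :* D :* D :* i)
        :+ (D :* (h :- x :* σ :+ ρ :* (x :* σ))) :* (D :* (h :- x :* σ) :* n)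
      := ρ :* (h :* D) :* ((h :* D :- x :* D :* σ) :* n) :+ ρ :* (x :* D :* σ) :* (ρ :* (h :* D) :* i)) refl

  ℕ→ℚ-≢0 : ∀ {n} → 1 ≤ n → ℕ→ℚ n ≢ 0ℚ
  ℕ→ℚ-≢0 {n} 1≤n e = <⇒≢ 1≤n (sym (ℕ→ℚ-injective {n} {0} e))

  *-≢0 : ∀ {p q r} → p ℚ.* q ≡ r → r ≢ 0ℚ → p ≢ 0ℚ
  *-≢0 {q = q} e r≢0 refl = r≢0 (trans (sym e) (ℚ.*-zeroˡ q))

  -- The degree condition in integers

  module DegreeTranslation (x : ℚ) (h s σ X D : ℕ) (1≤h : 1 ≤ h) (1≤D : 1 ≤ D) (σ<h : σ < h)
           (Xσ<hD : X * σ < h * D) (xD≡X : x ℚ.* ℕ→ℚ D ≡ ℕ→ℚ X) where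

    ρ A B N : ℕ
    ρ = suc s
    A = h * D ∸ X * σ
    B = ρ * (X * σ)
    N = part-count s A B

    N≡ : N ≡ ρ * (h * D)
    N≡ = trans (sym (*-distribˡ-+ ρ A (X * σ))) (cong (ρ *_) (m∸n+n≡m (<⇒≤ Xσ<hD)))

    private
      hℚ σℚ ρℚ Dℚ : ℚ
      hℚ = ℕ→ℚ h
      σℚ = ℕ→ℚ σ
      ρℚ = ℕ→ℚ ρ
      Dℚ = ℕ→ℚ D

    ℕ→ℚ-Xσ : ℕ→ℚ (X * σ) ≡ x ℚ.* Dℚ ℚ.* σℚ
    ℕ→ℚ-Xσ = trans (ℕ→ℚ-* X σ) (cong (ℚ._* σℚ) (sym xD≡X))

    ℕ→ℚ-A : ℕ→ℚ A ≡ hℚ ℚ.* Dℚ ℚ.- x ℚ.* Dℚ ℚ.* σℚ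
    ℕ→ℚ-A = trans (ℕ→ℚ-∸ (<⇒≤ Xσ<hD)) (cong₂ ℚ._-_ (ℕ→ℚ-* h D) ℕ→ℚ-Xσ)

    ℕ→ℚ-B : ℕ→ℚ B ≡ ρℚ ℚ.* (x ℚ.* Dℚ ℚ.* σℚ)
    ℕ→ℚ-B = trans (ℕ→ℚ-* ρ (X * σ)) (cong (ρℚ ℚ.*_) ℕ→ℚ-Xσ)

    ℕ→ℚ-N : ℕ→ℚ N ≡ ρℚ ℚ.* (hℚ ℚ.* Dℚ)
    ℕ→ℚ-N = trans (cong ℕ→ℚ N≡) (trans (ℕ→ℚ-* ρ (h * D)) (cong (ρℚ ℚ.*_) (ℕ→ℚ-* h D)))

    1≤A : 1 ≤ A
    1≤A = m<n⇒0<n∸m Xσ<hD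

    1≤N : 1 ≤ N
    1≤N = ≤-trans 1≤A (≤-trans (m≤m+n A (s * A)) (m≤m+n _ B))

    ρh≢0 : ρℚ ℚ.* hℚ ≢ 0ℚ
    ρh≢0 e = ℕ→ℚ-≢0 (*-mono-≤ {1} {ρ} (s≤s z≤n) 1≤h) (trans (ℕ→ℚ-* ρ h) e)

    h-σ≢0 : hℚ ℚ.- σℚ ≢ 0ℚ
    h-σ≢0 e = ℕ→ℚ-≢0 (m<n⇒0<n∸m σ<h) (trans (ℕ→ℚ-∸ (<⇒≤ σ<h)) e)

    h-xσ≢0 : hℚ ℚ.- x ℚ.* σℚ ≢ 0ℚ
    h-xσ≢0 = *-≢0 (trans (distribute hℚ x σℚ Dℚ) (sym ℕ→ℚ-A)) (ℕ→ℚ-≢0 1≤A)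
      where
      open +-*-Solver
      distribute : ∀ h x σ D → (h ℚ.- x ℚ.* σ) ℚ.* D ≡ h ℚ.* D ℚ.- x ℚ.* D ℚ.* σ
      distribute = solve 4 (λ h x σ D → (h :- x :* σ) :* D := h :* D :- x :* D :* σ) refl

    -- Equal to A / N, since the common factor D cancels.
    range : ℚ
    range = (hℚ ℚ.- x ℚ.* σℚ) ÷' (ρℚ ℚ.* hℚ)

    in-range : ∀ {n} i → N * i ≤ A * n → ℕ→ℚ i ℚ.≤ range ℚ.* ℕ→ℚ n
    in-range {n} i fits = ℚ.*-cancelʳ-≤-pos (ℕ→ℚ N) {{ℕ→ℚ-pos 1≤N}} (begin
      ℕ→ℚ i ℚ.* ℕ→ℚ N  ≡⟨ trans (ℚ.*-comm (ℕ→ℚ i) (ℕ→ℚ N)) (sym (ℕ→ℚ-* N i)) ⟩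
      ℕ→ℚ (N * i)  ≤⟨ ℕ→ℚ-mono fits ⟩
      ℕ→ℚ (A * n)  ≡⟨ trans (ℕ→ℚ-* A n) (cong (ℚ._* ℕ→ℚ n) ℕ→ℚ-A) ⟩
      (hℚ ℚ.* Dℚ ℚ.- x ℚ.* Dℚ ℚ.* σℚ) ℚ.* ℕ→ℚ n            ≡⟨ collect hℚ x σℚ Dℚ (ℕ→ℚ n) ⟩
      (hℚ ℚ.- x ℚ.* σℚ) ℚ.* Dℚ ℚ.* ℕ→ℚ n  ≡⟨ cong (λ z → z ℚ.* Dℚ ℚ.* ℕ→ℚ n) (÷′-* (hℚ ℚ.- x ℚ.* σℚ) ρh≢0) ⟨
      range ℚ.* (ρℚ ℚ.* hℚ) ℚ.* Dℚ ℚ.* ℕ→ℚ n               ≡⟨ reorder range ρℚ hℚ Dℚ (ℕ→ℚ n) ⟩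
      range ℚ.* ℕ→ℚ n ℚ.* (ρℚ ℚ.* (hℚ ℚ.* Dℚ))             ≡⟨ cong (range ℚ.* ℕ→ℚ n ℚ.*_) ℕ→ℚ-N ⟨
      range ℚ.* ℕ→ℚ n ℚ.* ℕ→ℚ N  ∎)
      where
      open ℚ.≤-Reasoning
      open +-*-Solver
      collect : ∀ h x σ D n → (h ℚ.* D ℚ.- x ℚ.* D ℚ.* σ) ℚ.* n ≡ (h ℚ.- x ℚ.* σ) ℚ.* D ℚ.* n
      collect = solve 5 (λ h x σ D n → (h :* D :- x :* D :* σ) :* n := (h :- x :* σ) :* D :* n) refl
      reorder : ∀ g ρ h D n → g ℚ.* (ρ ℚ.* h) ℚ.* D ℚ.* n ≡ g ℚ.* n ℚ.* (ρ ℚ.* (h ℚ.* D))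
      reorder = solve 5 (λ g ρ h D n → g :* (ρ :* h) :* D :* n := g :* n :* (ρ :* (h :* D))) refl

    -- Equal to 1 - (A + B) / N and B / A.
    intercept slope : ℚ
    intercept = gH h (suc (suc s)) σ x ℚ.- (x ℚ.* σℚ) ÷' hℚ
    slope     = (ρℚ ℚ.* x ℚ.* σℚ) ÷' (hℚ ℚ.- x ℚ.* σℚ)

    intercept-cleared : intercept ℚ.* (ρℚ ℚ.* hℚ) ≡ ρℚ ℚ.* hℚ ℚ.- hℚ ℚ.+ x ℚ.* σℚ ℚ.- ρℚ ℚ.* (x ℚ.* σℚ)
    intercept-cleared = density-identity x (1ℚ ÷' χ) (1ℚ ÷' ρℚ) ((x ℚ.* σℚ) ÷' hℚ) hℚ σℚ ρℚ
      (trans (cong ((1ℚ ÷' χ) ℚ.*_) (sym χ-cleared)) (trans (sym (ℚ.*-assoc (1ℚ ÷' χ) χ (hℚ ℚ.- σℚ)))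
        (trans (cong (ℚ._* (hℚ ℚ.- σℚ)) (÷′-* 1ℚ χ≢0)) (ℚ.*-identityˡ (hℚ ℚ.- σℚ)))))
      (÷′-* 1ℚ (ℕ→ℚ-≢0 {ρ} (s≤s z≤n)))
      (÷′-* (x ℚ.* σℚ) (ℕ→ℚ-≢0 1≤h))
      where
      χ : ℚ
      χ = χcr h (suc (suc s)) σ
      χ-cleared : χ ℚ.* (hℚ ℚ.- σℚ) ≡ ρℚ ℚ.* hℚ
      χ-cleared = ÷′-* (ρℚ ℚ.* hℚ) h-σ≢0
      χ≢0 : χ ≢ 0ℚ
      χ≢0 = *-≢0 χ-cleared ρh≢0

    bound-cleared : ∀ n i δ → intercept ℚ.* ℕ→ℚ n ℚ.+ slope ℚ.* ℕ→ℚ i ℚ.≤ ℕ→ℚ δ →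
                    N * (A * n) + B * (N * i) ≤ N * (A * δ) + (A + B) * (A * n)
    bound-cleared n i δ bound = ℕ→ℚ-cancel (begin
      ℕ→ℚ (N * (A * n) + B * (N * i))
        ≡⟨ trans (ℕ→ℚ-+ (N * (A * n)) (B * (N * i))) (cong₂ ℚ._+_
             (trans (ℕ→ℚ-* N (A * n)) (cong₂ ℚ._*_ ℕ→ℚ-N (trans (ℕ→ℚ-* A n) (cong (ℚ._* ℕ→ℚ n) ℕ→ℚ-A))))
             (trans (ℕ→ℚ-* B (N * i)) (cong₂ ℚ._*_ ℕ→ℚ-B (trans (ℕ→ℚ-* N i) (cong (ℚ._* ℕ→ℚ i) ℕ→ℚ-N))))) ⟩
      ρℚ ℚ.* (hℚ ℚ.* Dℚ) ℚ.* (Aℚ ℚ.* ℕ→ℚ n) ℚ.+ ρℚ ℚ.* (x ℚ.* Dℚ ℚ.* σℚ) ℚ.* (ρℚ ℚ.* (hℚ ℚ.* Dℚ) ℚ.* ℕ→ℚ i)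
        ≡⟨ degree-bound-identity x intercept slope hℚ σℚ ρℚ Dℚ (ℕ→ℚ n) (ℕ→ℚ i) intercept-cleared (÷′-* (ρℚ ℚ.* x ℚ.* σℚ) h-xσ≢0) ⟨
      (intercept ℚ.* ℕ→ℚ n ℚ.+ slope ℚ.* ℕ→ℚ i) ℚ.* (ρℚ ℚ.* (hℚ ℚ.* Dℚ) ℚ.* Aℚ) ℚ.+ rest
        ≡⟨ cong (λ z → (intercept ℚ.* ℕ→ℚ n ℚ.+ slope ℚ.* ℕ→ℚ i) ℚ.* z ℚ.+ rest) NA≡ ⟨
      (intercept ℚ.* ℕ→ℚ n ℚ.+ slope ℚ.* ℕ→ℚ i) ℚ.* ℕ→ℚ (N * A) ℚ.+ rest
        ≤⟨ ℚ.+-monoˡ-≤ rest (ℚ.*-monoʳ-≤-nonNeg (ℕ→ℚ (N * A)) {{ℕ→ℚ-nonNeg (N * A)}} bound) ⟩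
      ℕ→ℚ δ ℚ.* ℕ→ℚ (N * A) ℚ.+ rest
        ≡⟨ cong₂ ℚ._+_ (trans (sym (ℕ→ℚ-* δ (N * A))) (cong ℕ→ℚ (regroup δ N A))) rest≡ ⟩
      ℕ→ℚ (N * (A * δ)) ℚ.+ ℕ→ℚ ((A + B) * (A * n))
        ≡⟨ ℕ→ℚ-+ (N * (A * δ)) ((A + B) * (A * n)) ⟨
      ℕ→ℚ (N * (A * δ) + (A + B) * (A * n)) ∎)
      where
      open ℚ.≤-Reasoning
      Aℚ rest : ℚ
      Aℚ = hℚ ℚ.* Dℚ ℚ.- x ℚ.* Dℚ ℚ.* σℚ
      rest = (Aℚ ℚ.+ ρℚ ℚ.* (x ℚ.* Dℚ ℚ.* σℚ)) ℚ.* (Aℚ ℚ.* ℕ→ℚ n)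
      NA≡ : ℕ→ℚ (N * A) ≡ ρℚ ℚ.* (hℚ ℚ.* Dℚ) ℚ.* Aℚ
      NA≡ = trans (ℕ→ℚ-* N A) (cong₂ ℚ._*_ ℕ→ℚ-N ℕ→ℚ-A)
      rest≡ : rest ≡ ℕ→ℚ ((A + B) * (A * n))
      rest≡ = sym (trans (ℕ→ℚ-* (A + B) (A * n)) (cong₂ ℚ._*_ (trans (ℕ→ℚ-+ A B) (cong₂ ℚ._+_ ℕ→ℚ-A ℕ→ℚ-B))
        (trans (ℕ→ℚ-* A n) (cong (ℚ._* ℕ→ℚ n) ℕ→ℚ-A))))
      regroup : ∀ d n a → d * (n * a) ≡ n * (a * d)
      regroup = solve-∀

    degree-condition : ∀ {n} (G : Graph n) →
      (∀ i → 1 ≤ i → ℕ→ℚ i ℚ.≤ range ℚ.* ℕ→ℚ n → intercept ℚ.* ℕ→ℚ n ℚ.+ slope ℚ.* ℕ→ℚ i ℚ.≤ ℕ→ℚ (d G i)) →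
      DegreeCondition G N A B
    degree-condition {n} G hyp i 1≤i fits = bound-cleared n i (d G i) (hyp i 1≤i (in-range i fits))

  -- Colour classes and the choice of parameters

  classSize≡# : ∀ {h k} (c : Fin h → Fin k) a → classSize c a ≡ # (fibre c a)
  classSize≡# c a = length-filter-tabulate (λ v → c v ≟ᶠ a) id

  sum-fibres : ∀ {h k} (c : Fin h → Fin k) → sum (λ a → # (fibre c a)) ≡ h
  sum-fibres {h} {k} c = trans (∑-comm (λ a u → 𝟙 (fibre c a u))) (trans (sum-cong-≗ one) (trans (sum-const h 1) (*-identityʳ h)))
    where
    one : ∀ u → sum (λ a → 𝟙 (fibre c a u)) ≡ 1
    one u = trans (sum-cong-≗ flip) (sum-δ (c u) 1)
      where
      flip : ∀ a → 𝟙 (fibre c a u) ≡ (if ⌊ a ≟ᶠ c u ⌋ then 1 else 0)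
      flip a with c u ≟ᶠ a | a ≟ᶠ c u
      ... | yes _ | yes _ = refl
      ... | no _  | no _  = refl
      ... | yes p | no q  = ⊥-elim (q (sym p))
      ... | no p  | yes q = ⊥-elim (p (sym q))

  fewer-colours : ∀ {h k} (K : Graph h) (c : Fin h → Fin (suc k)) → ProperColouring K (suc k) c → ∀ a → # (fibre c a) ≡ 0 → Colourable K k
  fewer-colours {h} {k} K c proper a empty = (λ u → punchOut (avoid u)) , λ u v uv e → proper u v uv (punchOut-injective (avoid u) (avoid v) e)
    where
    avoid : ∀ u → a ≢ c u
    avoid u e = <⇒≱ {0} {1} ≤-refl (≤-trans (≤-reflexive (cong 𝟙 (sym (⌊⌋-complete (c u ≟ᶠ a) (sym e)))))
      (≤-trans (term≤sum (𝟙 ∘ fibre c a) u) (≤-reflexive empty)))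

  two-colours-needed : ∀ {h r} (K : Graph h) → HasEdge K → Colourable K r → ∃ λ s → r ≡ suc (suc s)
  two-colours-needed {r = zero}        K (i , _) (c , _) with c i
  ... | ()
  two-colours-needed {r = suc zero}    K (i , j , e) (c , proper) = ⊥-elim (proper i j e (same (c i) (c j)))
    where
    same : ∀ (a b : Fin 1) → a ≡ b
    same zero zero = refl
  two-colours-needed {r = suc (suc s)} K _ _ = s , refl

  -- An empty class could be dropped, contradicting the minimality of the chromatic number.
  1≤σ : ∀ {h k σ} (K : Graph h) → IsChromaticNumber K (suc k) → IsSigma K (suc k) σ → 1 ≤ σ
  1≤σ {k = k} {zero}  K (_ , minimal) ((c , proper , a , size) , _) =
    ⊥-elim (minimal k ≤-refl (fewer-colours K c proper a (trans (sym (classSize≡# c a)) size)))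
  1≤σ {σ = suc _} K _ _ = s≤s z≤n

  rσ≤h : ∀ {h r σ} (K : Graph h) → IsSigma K r σ → r * σ ≤ h
  rσ≤h {h} {r} {σ} K ((c , proper , _) , least) = begin
    r * σ  ≡⟨ sum-const r σ ⟨
    sum {r} (λ _ → σ)            ≤⟨ sum-mono (λ a → ≤-trans (least c proper a) (≤-reflexive (classSize≡# c a))) ⟩
    sum (λ a → # (fibre c a))    ≡⟨ sum-fibres c ⟩
    h  ∎
    where open ≤-Reasoning

  covers-enough : ∀ x η n y m c E → 0ℚ ℚ.< η → 0ℚ ℚ.< x → x ℚ.< 1ℚ → 1ℚ ℚ.≤ η ℚ.* ℕ→ℚ E → E * y ≤ n → m + y ≡ n →
    x ℚ.* ℕ→ℚ m ≡ ℕ→ℚ c → (x ℚ.- η) ℚ.* ℕ→ℚ n ℚ.≤ ℕ→ℚ c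
  covers-enough x η n y m c E 0<η 0<x x<1 1≤ηE Ey≤n m+y≡n xm≡c = begin
    (x ℚ.- η) ℚ.* ℕ→ℚ n  ≡⟨ expand x η (ℕ→ℚ n) ⟩
    x ℚ.* ℕ→ℚ n ℚ.+ ℚ.- (η ℚ.* ℕ→ℚ n)  ≤⟨ ℚ.+-monoʳ-≤ (x ℚ.* ℕ→ℚ n) (ℚ.neg-antimono-≤ xy≤ηn) ⟩
    x ℚ.* ℕ→ℚ n ℚ.+ ℚ.- (x ℚ.* ℕ→ℚ y)  ≡⟨ cong (λ z → x ℚ.* z ℚ.+ ℚ.- (x ℚ.* ℕ→ℚ y)) (trans (cong ℕ→ℚ (sym m+y≡n)) (ℕ→ℚ-+ m y)) ⟩
    x ℚ.* (ℕ→ℚ m ℚ.+ ℕ→ℚ y) ℚ.+ ℚ.- (x ℚ.* ℕ→ℚ y)        ≡⟨ cancel x (ℕ→ℚ m) (ℕ→ℚ y) ⟩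
    x ℚ.* ℕ→ℚ m  ≡⟨ xm≡c ⟩
    ℕ→ℚ c  ∎
    where
    open ℚ.≤-Reasoning
    open +-*-Solver
    expand : ∀ x η n → (x ℚ.- η) ℚ.* n ≡ x ℚ.* n ℚ.+ ℚ.- (η ℚ.* n)
    expand = solve 3 (λ x η n → (x :- η) :* n := x :* n :+ :- (η :* n)) refl
    cancel : ∀ x m y → x ℚ.* (m ℚ.+ y) ℚ.+ ℚ.- (x ℚ.* y) ≡ x ℚ.* m
    cancel = solve 3 (λ x m y → x :* (m :+ y) :+ :- (x :* y) := x :* m) refl
    xy≤ηn : x ℚ.* ℕ→ℚ y ℚ.≤ η ℚ.* ℕ→ℚ n
    xy≤ηn = begin
      x ℚ.* ℕ→ℚ y  ≤⟨ ℚ.*-monoʳ-≤-nonNeg (ℕ→ℚ y) {{ℕ→ℚ-nonNeg y}} (ℚ.<⇒≤ x<1) ⟩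
      1ℚ ℚ.* ℕ→ℚ y  ≤⟨ ℚ.*-monoʳ-≤-nonNeg (ℕ→ℚ y) {{ℕ→ℚ-nonNeg y}} 1≤ηE ⟩
      η ℚ.* ℕ→ℚ E ℚ.* ℕ→ℚ y             ≡⟨ trans (ℚ.*-assoc η (ℕ→ℚ E) (ℕ→ℚ y)) (cong (η ℚ.*_) (sym (ℕ→ℚ-* E y))) ⟩
      η ℚ.* ℕ→ℚ (E * y)  ≤⟨ ℚ.*-monoˡ-≤-nonNeg η {{ℚ.nonNegative (ℚ.<⇒≤ 0<η)}} (ℕ→ℚ-mono Ey≤n) ⟩
      η ℚ.* ℕ→ℚ n  ∎

  module Main (x : ℚ) (0<x : 0ℚ ℚ.< x) (x<1 : x ℚ.< 1ℚ) (h : ℕ) (K : Graph h) (s σ : ℕ)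
              (chromatic : IsChromaticNumber K (suc (suc s))) (sigma : IsSigma K (suc (suc s)) σ)
              (η : ℚ) (0<η : 0ℚ ℚ.< η) where

    κ X₀ D₀ X D E : ℕ
    κ  = 2 * suc s + 2
    X₀ = proj₁ (positive-fraction x 0<x)
    D₀ = proj₁ (proj₂ (positive-fraction x 0<x))
    -- Scaling by κ makes B large compared with ρ, which absorbs the rounding errors.
    X  = κ * X₀
    D  = κ * D₀
    -- The denominator of η, which plays the role of H: since 1 ≤ η E, leaving n / E vertices
    -- uncovered is good enough.
    E  = proj₁ (proj₂ (positive-fraction η 0<η))

    1≤X₀ : 1 ≤ X₀
    1≤X₀ = proj₁ (proj₂ (proj₂ (positive-fraction x 0<x)))
    1≤D₀ : 1 ≤ D₀
    1≤D₀ = proj₁ (proj₂ (proj₂ (proj₂ (positive-fraction x 0<x))))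
    xD₀≡X₀ : x ℚ.* ℕ→ℚ D₀ ≡ ℕ→ℚ X₀
    xD₀≡X₀ = proj₂ (proj₂ (proj₂ (proj₂ (positive-fraction x 0<x))))
    1≤E : 1 ≤ E
    1≤E = proj₁ (proj₂ (proj₂ (proj₂ (positive-fraction η 0<η))))

    1≤κ : 1 ≤ κ
    1≤κ = ≤-trans (s≤s z≤n) (m≤n+m 2 (2 * suc s))

    κ≤X : κ ≤ X
    κ≤X = m≤m*n κ X₀ {{>-nonZero 1≤X₀}}

    1≤D : 1 ≤ D
    1≤D = *-mono-≤ 1≤κ 1≤D₀

    xD≡X : x ℚ.* ℕ→ℚ D ≡ ℕ→ℚ X
    xD≡X = begin
      x ℚ.* ℕ→ℚ (κ * D₀)             ≡⟨ cong (x ℚ.*_) (ℕ→ℚ-* κ D₀) ⟩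
      x ℚ.* (ℕ→ℚ κ ℚ.* ℕ→ℚ D₀)       ≡⟨ exchange x (ℕ→ℚ κ) (ℕ→ℚ D₀) ⟩
      ℕ→ℚ κ ℚ.* (x ℚ.* ℕ→ℚ D₀)       ≡⟨ cong (ℕ→ℚ κ ℚ.*_) xD₀≡X₀ ⟩
      ℕ→ℚ κ ℚ.* ℕ→ℚ X₀               ≡⟨ ℕ→ℚ-* κ X₀ ⟨
      ℕ→ℚ (κ * X₀)  ∎
      where
      open ≡-Reasoning
      open +-*-Solver
      exchange : ∀ a b c → a ℚ.* (b ℚ.* c) ≡ b ℚ.* (a ℚ.* c)
      exchange = solve 3 (λ a b c → a :* (b :* c) := b :* (a :* c)) refl

    X≤D : X ≤ D
    X≤D = ℕ→ℚ-cancel (ℚ.≤-trans (ℚ.≤-reflexive (sym xD≡X)) (ℚ.≤-trans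
      (ℚ.*-monoʳ-≤-nonNeg (ℕ→ℚ D) {{ℕ→ℚ-nonNeg D}} (ℚ.<⇒≤ x<1)) (ℚ.≤-reflexive (ℚ.*-identityˡ (ℕ→ℚ D)))))

    X<D : X < D
    X<D = ≤∧≢⇒< X≤D λ X≡D → ℚ.<-irrefl refl (ℚ.<-≤-trans x<1 (ℚ.*-cancelʳ-≤-pos (ℕ→ℚ D) {{ℕ→ℚ-pos 1≤D}}
      (ℚ.≤-reflexive (trans (ℚ.*-identityˡ (ℕ→ℚ D)) (trans (cong ℕ→ℚ (sym X≡D)) (sym xD≡X))))))

    0<σ : 1 ≤ σ
    0<σ = 1≤σ K chromatic sigma

    all-classes : suc (suc s) * σ ≤ h
    all-classes = rσ≤h K sigma

    σ<h : σ < h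
    σ<h = ≤-trans (≤-trans (+-monoˡ-≤ σ 0<σ) (+-monoʳ-≤ σ (m≤m+n σ (s * σ)))) all-classes

    1≤h : 1 ≤ h
    1≤h = ≤-trans (s≤s z≤n) σ<h

    hX<hD : h * X < h * D
    hX<hD = *-monoʳ-< h {{>-nonZero 1≤h}} X<D

    rXσ<hD : suc (suc s) * (X * σ) < h * D
    rXσ<hD = ≤-<-trans (≤-trans (≤-reflexive (*-exchange (suc (suc s)) X σ)) (≤-trans (*-monoʳ-≤ X all-classes) (≤-reflexive (*-comm X h)))) hX<hD

    Xσ<hD : X * σ < h * D
    Xσ<hD = ≤-<-trans (m≤m+n (X * σ) (suc s * (X * σ))) rXσ<hD

    open DegreeTranslation x h s σ X D 1≤h 1≤D σ<h Xσ<hD xD≡X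

    -- This is r X σ < h D in disguise. It follows from r σ ≤ h and X < D, so x < 1 makes it strict
    -- even if all colour classes have the same size.
    B<A : B < A
    B<A = +-cancelʳ-< (X * σ) B A (subst₂ _<_ (+-comm (X * σ) B) (sym (m∸n+n≡m (<⇒≤ Xσ<hD))) rXσ<hD)

    κ≤B : κ ≤ B
    κ≤B = ≤-trans κ≤X (≤-trans (m≤m*n X σ {{>-nonZero 0<σ}}) (m≤n*m (X * σ) ρ))

    -- The second summand of `n₀` makes the width of a level at least L.
    L n₀ : ℕ
    L  = 5 * E * B
    n₀ = size-needed s A B E + N * (L * L)

    1≤B : 1 ≤ B
    1≤B = ≤-trans 1≤κ κ≤B

    colouring : Fin h → Fin (suc (suc s))
    colouring = proj₁ (proj₁ sigma)

    smallest : Fin (suc (suc s))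
    smallest = proj₁ (proj₂ (proj₂ (proj₁ sigma)))

    #smallest : # (fibre colouring smallest) ≡ σ
    #smallest = trans (sym (classSize≡# colouring smallest)) (proj₂ (proj₂ (proj₂ (proj₁ sigma))))

    #others : # (λ u → not (fibre colouring smallest u)) ≡ h ∸ σ
    #others = begin
      # others  ≡⟨ m+n∸m≡n σ (# others) ⟨
      σ + # others ∸ σ  ≡⟨ cong (_∸ σ) (cong (_+ # others) #smallest) ⟨
      # (fibre colouring smallest) + # others ∸ σ ≡⟨ cong (_∸ σ) (trans (sym (#-split (λ _ → true) (fibre colouring smallest))) (trans (sum-const h 1) (*-identityʳ h))) ⟩
      h ∸ σ  ∎
      where
      open ≡-Reasoning
      others : VSet h
      others u = not (fibre colouring smallest u)

    special-fits : X * (ρ * # (fibre colouring smallest)) ≤ B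
    special-fits = ≤-reflexive (trans (cong (λ z → X * (ρ * z)) #smallest) (*-exchange X ρ σ))

    -- The slack is h (D - X): the copies of the graph leave this many vertices of each large part
    -- uncovered, which lowers the density from 1 to X / D.
    others-fit : X * # (λ u → not (fibre colouring smallest u)) ≤ A
    others-fit = begin
      X * # (λ u → not (fibre colouring smallest u))   ≡⟨ cong (X *_) #others ⟩
      X * (h ∸ σ)  ≡⟨ *-distribˡ-∸ X h σ ⟩
      X * h ∸ X * σ  ≤⟨ ∸-monoˡ-≤ (X * σ) (≤-trans (≤-reflexive (*-comm X h)) (<⇒≤ hX<hD)) ⟩
      A  ∎
      where open ≤-Reasoning

    1≤ηE : 1ℚ ℚ.≤ η ℚ.* ℕ→ℚ E
    1≤ηE = ℚ.≤-trans (ℕ→ℚ-mono (proj₁ (proj₂ (proj₂ (positive-fraction η 0<η)))))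
      (ℚ.≤-reflexive (sym (proj₂ (proj₂ (proj₂ (proj₂ (positive-fraction η 0<η)))))))

    tiling : ∀ n → n₀ ≤ n → (G : Graph n) →
      (∀ i → 1 ≤ i → ℕ→ℚ i ℚ.≤ range ℚ.* ℕ→ℚ n → intercept ℚ.* ℕ→ℚ n ℚ.+ slope ℚ.* ℕ→ℚ i ℚ.≤ ℕ→ℚ (d G i)) →
      Σ (HTiling K G) λ T → (x ℚ.- η) ℚ.* ℕ→ℚ n ℚ.≤ ℕ→ℚ (covered T)
    tiling n n₀≤n G hyp = finish (almost-perfect-tiling s A B E B<A 1≤E κ≤B n (≤-trans (m≤m+n _ _) n₀≤n) G
        (levelling G N A B L 1≤N 1≤A 1≤B 1≤L (≤-trans (m≤n+m _ _) n₀≤n) (degree-condition G hyp)))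
      where
      open Tiling G s A B hiding (ρ)
      open Packings K G
      1≤L : 1 ≤ L
      1≤L = *-mono-≤ (*-mono-≤ {1} {5} (s≤s z≤n) 1≤E) 1≤B
      finish : (∃ λ (ts : List (Tile 1)) → (∀ v → occs ts v ≤ 1) × E * # (λ v → ⌊ occs ts v ≟ 0 ⌋) ≤ n) →
               Σ (HTiling K G) λ T → (x ℚ.- η) ℚ.* ℕ→ℚ n ℚ.≤ ℕ→ℚ (covered T)
      finish (ts , ok , few) = to-HTiling (pack-tiles s A B X colouring (proj₁ (proj₂ (proj₁ sigma))) smallest special-fits others-fit ts ok) ,
        covers-enough x η n y (sum (occs ts)) (length ts * (X * ρ) * h) E 0<η 0<x x<1 1≤ηE few total density
        where
        y = # (λ v → ⌊ occs ts v ≟ 0 ⌋)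
        total : sum (occs ts) + y ≡ n
        total = trans (sym (∑-distrib-+ (occs ts) (λ v → 𝟙 ⌊ occs ts v ≟ 0 ⌋)))
          (trans (sum-cong-≗ (λ v → one (occs ts v) (ok v))) (trans (sum-const n 1) (*-identityʳ n)))
          where
          one : ∀ m → m ≤ 1 → m + 𝟙 ⌊ m ≟ 0 ⌋ ≡ 1
          one zero          _ = refl
          one (suc zero)    _ = refl
          one (suc (suc m)) (s≤s ())
        -- Each tile has ρ h D vertices, and its X ρ copies cover ρ h X of them.
        density : x ℚ.* ℕ→ℚ (sum (occs ts)) ≡ ℕ→ℚ (length ts * (X * ρ) * h)
        density = begin
          x ℚ.* ℕ→ℚ (sum (occs ts))  ≡⟨ cong (λ z → x ℚ.* ℕ→ℚ z) covered-by-tiles ⟩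
          x ℚ.* ℕ→ℚ (D * (length ts * (ρ * h)))              ≡⟨ cong (x ℚ.*_) (ℕ→ℚ-* D (length ts * (ρ * h))) ⟩
          x ℚ.* (ℕ→ℚ D ℚ.* ℕ→ℚ (length ts * (ρ * h)))        ≡⟨ ℚ.*-assoc x (ℕ→ℚ D) (ℕ→ℚ (length ts * (ρ * h))) ⟨
          x ℚ.* ℕ→ℚ D ℚ.* ℕ→ℚ (length ts * (ρ * h))          ≡⟨ cong (ℚ._* ℕ→ℚ (length ts * (ρ * h))) xD≡X ⟩
          ℕ→ℚ X ℚ.* ℕ→ℚ (length ts * (ρ * h))  ≡⟨ ℕ→ℚ-* X (length ts * (ρ * h)) ⟨
          ℕ→ℚ (X * (length ts * (ρ * h)))  ≡⟨ cong ℕ→ℚ (reorder X (length ts) ρ h) ⟩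
          ℕ→ℚ (length ts * (X * ρ) * h)  ∎
          where
          open ≡-Reasoning
          reorder : ∀ x l r h → x * (l * (r * h)) ≡ l * (x * r) * h
          reorder = solve-∀
          reorder′ : ∀ l r h d → l * (r * (h * d) * 1) ≡ d * (l * (r * h))
          reorder′ = solve-∀
          covered-by-tiles : sum (occs ts) ≡ D * (length ts * (ρ * h))
          covered-by-tiles = trans (sum-occs ts) (trans (cong (λ z → length ts * (z * 1)) N≡) (reorder′ (length ts) ρ h D))

open import Data.Rational using (ℚ; 0ℚ; 1ℚ; _+_; _*_; _-_; _<_) renaming (_≤_ to _≤ℚ_)

theorem1p5 : (x : ℚ) → 0ℚ < x → x < 1ℚ →
    (h : ℕ) (H : Graph h) → HasEdge H →
    (r σ : ℕ) → IsChromaticNumber H r → IsSigma H r σ →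
    (η : ℚ) → 0ℚ < η →
    ∃ λ (n₀ : ℕ) → ∀ (n : ℕ) → n₀ ≤ n → (G : Graph n) →
    (∀ (i : ℕ) → 1 ≤ i →
    ℕ→ℚ i ≤ℚ ((ℕ→ℚ h - x * ℕ→ℚ σ) ÷' (ℕ→ℚ (r ∸ 1) * ℕ→ℚ h)) * ℕ→ℚ n →
    ((gH h r σ x - (x * ℕ→ℚ σ) ÷' ℕ→ℚ h) * ℕ→ℚ n
    + ((ℕ→ℚ (r ∸ 1) * x * ℕ→ℚ σ) ÷' (ℕ→ℚ h - x * ℕ→ℚ σ)) * ℕ→ℚ i)
    ≤ℚ ℕ→ℚ (d G i)) →
    Σ (HTiling H G) λ T → (x - η) * ℕ→ℚ n ≤ℚ ℕ→ℚ (covered T)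
theorem1p5 x 0<x x<1 h H edge r σ chromatic sigma η 0<η
  with Tilings.two-colours-needed H edge (proj₁ chromatic)
-- Once r is s + 2, `r ∸ 1` reduces to ρ and the degree hypothesis is definitionally that of
-- `tiling`.
... | s , refl = Main.n₀ , Main.tiling
  where module Main = Tilings.Main x 0<x x<1 h H s σ chromatic sigma η 0<η
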